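{- For every integer $r\ge1$, the poset $IR(r,\mathbb F_2)$ is simply connected, i.e. its geometric realization $|IR(r,\mathbb F_2)|$ is simply connected.
   Context: A matroid is binary if it is representable over $\mathbb F_2$. A binary matroid is regular if it has no minor isomorphic to the Fano matroid $F_7$ (the linear matroid on the seven nonzero vectors of $\mathbb F_2^3$) or to its dual $F_7^*$ (by Tutte's theorem this is equivalent to the usual definitions of regular matroid). Any subset of $\mathbb F_2^r$ is regarded as a matroid in which independence is linear independence over $\mathbb F_2$. For $r\ge1$, $IR(r,\mathbb F_2)$ is the poset, ordered by inclusion, of all subsets of $\mathbb F_2^r\setminus\{0\}$ which are regular matroids of rank $r$. The geometric realization $|P|$ of a poset $P$ is the geometric realization of its order complex, the simplicial complex whose $k$-simplices are the chains $x_0<x_1<\cdots<x_k$ in $P$. -}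

module Defs where

open import Algebra.Bundles using (CommutativeMonoid)
import Algebra.Properties.CommutativeSemigroup as CommutativeSemigroupProperties
open import Data.Bool using (Bool; true; false; T; not; _∧_; _xor_)
open import Data.List using (List; []; _∷_; _++_; map; foldr; length)
open import Data.List.Relation.Binary.Disjoint.Propositional using (Disjoint)
open import Data.List.Relation.Unary.All using (All)
open import Data.List.Relation.Unary.Unique.Propositional using (Unique)
import Data.List.Membership.Setoid as SetoidMembership
import Data.List.Relation.Unary.Unique.Setoid as SetoidUnique
open import Data.Nat as ℕ using (ℕ)
import Data.Nat.Properties as ℕₚ
open import Data.Product using (Σ-syntax; ∃-syntax; _×_; _,_; proj₁; proj₂)
open import Data.Rational
open import Data.Rational.Properties
open import Data.Sum using (_⊎_)
open import Data.Vec using (Vec; []; _∷_; replicate; zipWith)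
import Data.Vec as Vec
open import Function using (_∘_; _⇔_; _↔_; Inverse)
open import Level using (0ℓ)
open import Relation.Binary.Bundles using (Poset)
open import Relation.Binary.PropositionalEquality
open import Relation.Nullary using (¬_)

------------------------------------------------------------------------
-- Real numbers: Cauchy sequences of rationals, with an explicit modulus,
-- up to the equality _≃ᴿ_.

Eventually : (ℕ → Set) → Set
Eventually P = ∃[ N ] (∀ n → N ℕ.≤ n → P n)

record ℝ : Set where
  constructor mkℝ
  field
    seq    : ℕ → ℚ
    cauchy : ∀ ε → 0ℚ < ε →
             ∃[ N ] (∀ m n → N ℕ.≤ m → N ℕ.≤ n → ∣ seq m - seq n ∣ ≤ ε)

open ℝ public

-- ∣ x - y ∣ ≤ ε.  The slack η is needed because a limit that is ≤ ε may be
-- approached from above.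
Within : ℚ → ℝ → ℝ → Set
Within ε x y = ∀ η → 0ℚ < η → Eventually λ n → ∣ seq x n - seq y n ∣ ≤ ε + η

infix 4 _≃ᴿ_ _≤ᴿ_ _<ᴿ_

_≃ᴿ_ : ℝ → ℝ → Set
x ≃ᴿ y = Within 0ℚ x y

_≤ᴿ_ : ℝ → ℝ → Set
x ≤ᴿ y = ∀ η → 0ℚ < η → Eventually λ n → seq x n ≤ seq y n + η

_<ᴿ_ : ℝ → ℝ → Set
x <ᴿ y = ∃[ ε ] (0ℚ < ε × Eventually λ n → seq x n + ε ≤ seq y n)

fromℚ : ℚ → ℝ
fromℚ q = mkℝ (λ _ → q) λ ε 0<ε → 0 , λ _ _ _ _ →
  ≤-trans (≤-reflexive (cong ∣_∣ (+-inverseʳ q))) (<⇒≤ 0<ε)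

0ᴿ 1ᴿ : ℝ
0ᴿ = fromℚ 0ℚ
1ᴿ = fromℚ 1ℚ

private
  half-pos : ∀ ε → 0ℚ < ε → 0ℚ < ½ * ε
  half-pos ε 0<ε = *-monoʳ-<-pos ½ 0<ε

  halves : ∀ ε → ½ * ε + ½ * ε ≡ ε
  halves ε = trans (sym (*-distribʳ-+ ε ½ ½)) (*-identityˡ ε)

  regroup : ∀ a b c d → (a + b) - (c + d) ≡ (a - c) + (b - d)
  regroup a b c d = trans
    (cong (a + b +_) (neg-distrib-+ c d))
    (interchange a b (- c) (- d))
    where open CommutativeSemigroupProperties
                 (CommutativeMonoid.commutativeSemigroup +-0-commutativeMonoid)
                 using (interchange)

infixl 6 _+ᴿ_

_+ᴿ_ : ℝ → ℝ → ℝ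
x +ᴿ y = mkℝ (λ n → seq x n + seq y n) λ ε 0<ε →
  let M , hx = cauchy x (½ * ε) (half-pos ε 0<ε)
      N , hy = cauchy y (½ * ε) (half-pos ε 0<ε)
  in M ℕ.⊔ N , λ m n m≥ n≥ → begin
    ∣ (seq x m + seq y m) - (seq x n + seq y n) ∣
      ≡⟨ cong ∣_∣ (regroup (seq x m) (seq y m) (seq x n) (seq y n)) ⟩
    ∣ (seq x m - seq x n) + (seq y m - seq y n) ∣
      ≤⟨ ∣p+q∣≤∣p∣+∣q∣ (seq x m - seq x n) (seq y m - seq y n) ⟩
    ∣ seq x m - seq x n ∣ + ∣ seq y m - seq y n ∣
      ≤⟨ +-mono-≤
           (hx m n (ℕₚ.≤-trans (ℕₚ.m≤m⊔n M N) m≥) (ℕₚ.≤-trans (ℕₚ.m≤m⊔n M N) n≥))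
           (hy m n (ℕₚ.≤-trans (ℕₚ.m≤n⊔m M N) m≥) (ℕₚ.≤-trans (ℕₚ.m≤n⊔m M N) n≥)) ⟩
    ½ * ε + ½ * ε
      ≡⟨ halves ε ⟩
    ε ∎
  where open ≤-Reasoning

sumᴿ : List ℝ → ℝ
sumᴿ = foldr _+ᴿ_ 0ᴿ

------------------------------------------------------------------------
-- Paths, homotopies and simple connectedness

-- A metric space, presented by the relation  Near ε p q  :  d(p , q) ≤ ε.
record Space : Set₁ where
  field
    Pt   : Set
    Near : ℚ → Pt → Pt → Set

  infix 4 _≈ₚ_
  _≈ₚ_ : Pt → Pt → Set
  p ≈ₚ q = ∀ ε → 0ℚ < ε → Near ε p q

open Space public

-- On the compact domains used below (the unit interval and the unit square)
-- continuity means uniform continuity; by Heine–Cantor this agrees with the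
-- pointwise notion classically.  A continuous map respects _≈ₚ_.
Continuous : (A B : Space) → (Pt A → Pt B) → Set
Continuous A B f = ∀ ε → 0ℚ < ε →
  ∃[ δ ] (0ℚ < δ × (∀ p q → Near A δ p q → Near B ε (f p) (f q)))

_⊗_ : Space → Space → Space
A ⊗ B = record
  { Pt   = Pt A × Pt B
  ; Near = λ ε p q → Near A ε (proj₁ p) (proj₁ q) × Near B ε (proj₂ p) (proj₂ q)
  }

record UnitInterval : Set where
  constructor mkI
  field
    value : ℝ
    lower : 0ᴿ ≤ᴿ value
    upper : value ≤ᴿ 1ᴿ

open UnitInterval public

𝕀 : Space
𝕀 = record { Pt = UnitInterval ; Near = λ ε s t → Within ε (value s) (value t) }

record Path (S : Space) (p q : Pt S) : Set where
  field
    at         : UnitInterval → Pt S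
    continuous : Continuous 𝕀 S at
    source     : ∀ t → value t ≃ᴿ 0ᴿ → _≈ₚ_ S (at t) p
    target     : ∀ t → value t ≃ᴿ 1ᴿ → _≈ₚ_ S (at t) q

open Path public

-- A homotopy, relative to the endpoints, from the loop γ at p to the constant
-- loop at p.  The first coordinate is the homotopy parameter.
record NullHomotopy (S : Space) {p : Pt S} (γ : Path S p p) : Set where
  field
    at         : UnitInterval × UnitInterval → Pt S
    continuous : Continuous (𝕀 ⊗ 𝕀) S at
    start      : ∀ s t → value s ≃ᴿ 0ᴿ → _≈ₚ_ S (at (s , t)) (Path.at γ t)
    end        : ∀ s t → value s ≃ᴿ 1ᴿ → _≈ₚ_ S (at (s , t)) p
    left       : ∀ s t → value t ≃ᴿ 0ᴿ → _≈ₚ_ S (at (s , t)) p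
    right      : ∀ s t → value t ≃ᴿ 1ᴿ → _≈ₚ_ S (at (s , t)) p

record SimplyConnected (S : Space) : Set where
  field
    point         : Pt S
    pathConnected : ∀ p q → Path S p q
    nullHomotopic : ∀ p (γ : Path S p p) → NullHomotopy S γ

------------------------------------------------------------------------
-- Geometric realization of (the order complex of) a poset

module _ (P : Poset 0ℓ 0ℓ 0ℓ) where
  private module P = Poset P
  open SetoidMembership P.Eq.setoid using (_∈_)
  open SetoidUnique P.Eq.setoid using () renaming (Unique to Distinct)

  -- Barycentric coordinates: non-negative weights on the elements of P, of
  -- total weight 1, such that the elements of positive weight form a finite
  -- chain.  The list `support` may also contain elements of weight 0, since
  -- it is not decidable whether a real number is positive.
  record RealizationPoint : Set where
    field
      weight      : P.Carrier → ℝ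
      weight-cong : ∀ {x y} → x P.≈ y → weight x ≃ᴿ weight y
      nonneg      : ∀ x → 0ᴿ ≤ᴿ weight x
      chain       : ∀ x y → 0ᴿ <ᴿ weight x → 0ᴿ <ᴿ weight y →
                    x P.≤ y ⊎ y P.≤ x
      support     : List P.Carrier
      distinct    : Distinct support
      supported   : ∀ x → 0ᴿ <ᴿ weight x → x ∈ support
      total       : sumᴿ (map weight support) ≃ᴿ 1ᴿ

  -- The topology is that of the sup metric on barycentric coordinates.  For a
  -- finite poset, the only case used here, it is the usual topology of the
  -- (finite) order complex.
  ∣_∣ᴳ : Space
  ∣_∣ᴳ = record
    { Pt   = RealizationPoint
    ; Near = λ ε p q → ∀ x →
        Within ε (RealizationPoint.weight p x) (RealizationPoint.weight q x)
    }

------------------------------------------------------------------------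
-- Matroids

-- Decidable subsets.
Sub : Set → Set
Sub E = E → Bool

infix 4 _∈ₛ_ _⊆ₛ_
_∈ₛ_ : {E : Set} → E → Sub E → Set
e ∈ₛ X = T (X e)

_⊆ₛ_ : {E : Set} → Sub E → Sub E → Set
X ⊆ₛ Y = ∀ e → e ∈ₛ X → e ∈ₛ Y

infixl 6 _∖_
_∖_ : {E : Set} → Sub E → Sub E → Sub E
(X ∖ Y) e = X e ∧ not (Y e)

-- A matroid given by its independent sets.  `Indep J` says that the list J
-- has distinct entries, all in the ground set, and that they form an
-- independent set.  The matroid axioms are not recorded: every instance below
-- is obtained from vectors over 𝔽₂ by operations that preserve them.
record Matroid : Set₁ where
  field
    E      : Set
    ground : Sub E
    Indep  : List E → Set

open Matroid public

Ground : Matroid → Set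
Ground M = Σ[ e ∈ E M ] e ∈ₛ ground M

-- B is a basis of (the restriction of M to) the subset C.
record IsBasisOf (M : Matroid) (C : Sub (E M)) (B : List (E M)) : Set where
  field
    inside  : All (_∈ₛ C) B
    indep   : Indep M B
    maximal : ∀ e → e ∈ₛ C → ¬ Indep M (e ∷ B)

IsBasis : (M : Matroid) → List (E M) → Set
IsBasis M = IsBasisOf M (ground M)

HasRank : Matroid → ℕ → Set
HasRank M k = ∃[ B ] (IsBasis M B × length B ≡ k)

infixl 7 _/ᴹ_ _∖ᴹ_

_∖ᴹ_ : (M : Matroid) → Sub (E M) → Matroid
M ∖ᴹ D = record
  { E      = E M
  ; ground = ground M ∖ D
  ; Indep  = λ J → All (_∈ₛ (ground M ∖ D)) J × Indep M J
  }

-- J is independent in M / C iff J ∪ B is independent in M for some basis B of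
-- C (equivalently, for every such basis).
_/ᴹ_ : (M : Matroid) → Sub (E M) → Matroid
M /ᴹ C = record
  { E      = E M
  ; ground = ground M ∖ C
  ; Indep  = λ J → All (_∈ₛ (ground M ∖ C)) J ×
                   ∃[ B ] (IsBasisOf M C B × Indep M (J ++ B))
  }

-- The bases of the dual are the complements of the bases of M.
dual : Matroid → Matroid
dual M = record
  { E      = E M
  ; ground = ground M
  ; Indep  = λ J → Unique J × All (_∈ₛ ground M) J ×
                   ∃[ B ] (IsBasis M B × Disjoint J B)
  }

record _≅_ (M N : Matroid) : Set where
  field
    bijection : Ground M ↔ Ground N
    indep     : ∀ (J : List (Ground M)) →
                Indep M (map proj₁ J) ⇔ Indep N (map (proj₁ ∘ Inverse.to bijection) J)

HasMinor : Matroid → Matroid → Set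
HasMinor M N =
  Σ[ C ∈ Sub (E M) ] Σ[ D ∈ Sub (E M) ]
    (C ⊆ₛ ground M × D ⊆ₛ ground M ∖ C × ((M /ᴹ C) ∖ᴹ D) ≅ N)

------------------------------------------------------------------------
-- Linear matroids over 𝔽₂

-- Bool is the field 𝔽₂, with addition _xor_ and multiplication _∧_.
𝔽₂^ : ℕ → Set
𝔽₂^ r = Vec Bool r

0ᵥ : ∀ {r} → 𝔽₂^ r
0ᵥ = replicate _ false

linearCombination : ∀ {r} (vs : List (𝔽₂^ r)) → Vec Bool (length vs) → 𝔽₂^ r
linearCombination []       []       = 0ᵥ
linearCombination (v ∷ vs) (c ∷ cs) =
  zipWith _xor_ (Vec.map (c ∧_) v) (linearCombination vs cs)

LinearlyIndependent : ∀ {r} → List (𝔽₂^ r) → Set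
LinearlyIndependent vs = ∀ cs → linearCombination vs cs ≡ 0ᵥ → cs ≡ 0ᵥ

linearMatroid : ∀ {r} → Sub (𝔽₂^ r) → Matroid
linearMatroid {r} X = record
  { E      = 𝔽₂^ r
  ; ground = X
  ; Indep  = λ J → All (_∈ₛ X) J × LinearlyIndependent J
  }

nonzero : ∀ {r} → Sub (𝔽₂^ r)
nonzero []           = false
nonzero (true  ∷ _)  = true
nonzero (false ∷ v)  = nonzero v

F₇ : Matroid
F₇ = linearMatroid (nonzero {3})

-- Regularity of a binary matroid, by excluded minors.
IsRegular : Matroid → Set
IsRegular M = ¬ HasMinor M F₇ × ¬ HasMinor M (dual F₇)

------------------------------------------------------------------------
-- The poset IR(r, 𝔽₂)

record RegularSubset (r : ℕ) : Set where
  field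
    set        : Sub (𝔽₂^ r)
    nonzeroSet : set ⊆ₛ nonzero
    regular    : IsRegular (linearMatroid set)
    rank       : HasRank (linearMatroid set) r

open RegularSubset public

private
  T-antisym : ∀ {a b} → (T a → T b) → (T b → T a) → a ≡ b
  T-antisym {false} {false} _ _ = refl
  T-antisym {true}  {true}  _ _ = refl
  T-antisym {false} {true}  _ g with () ← g _
  T-antisym {true}  {false} f _ with () ← f _

IR : ℕ → Poset 0ℓ 0ℓ 0ℓ
IR r = record
  { Carrier        = RegularSubset r
  ; _≈_            = λ X Y → ∀ v → set X v ≡ set Y v
  ; _≤_            = λ X Y → set X ⊆ₛ set Y
  ; isPartialOrder = record
    { isPreorder = record
      { isEquivalence = record
        { refl  = λ _ → refl
        ; sym   = λ p v → sym (p v)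
        ; trans = λ p q v → trans (p v) (q v)
        }
      ; reflexive = λ p v → subst T (p v)
      ; trans     = λ p q v → q v ∘ p v
      }
    ; antisym = λ p q v → T-antisym (p v) (q v)
    }
  }

{-# OPTIONS --safe #-}

-- A set consisting of a basis and at most two further vectors is regular: in an
-- F₇- or F₇*-minor three elements lie in the span of the others, and deleting
-- them would leave a spanning set of fewer than r vectors.  These small sets are
-- enough to fill any loop.  By uniform continuity a loop in the realization is
-- homotopic to a loop of pairwise comparable vertices.  Replace every vertex by
-- a basis inside it, joining consecutive bases by exchanges; then, for a fixed
-- basis e₁ , … , eᵣ, push e₁ , e₂ , … successively into all bases of the loop.
-- Every push stays among the small sets, and in the end all bases coincide.
-- Realizing the resulting grid of vertices by iterated linear interpolation gives
-- the null-homotopy.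
module Submission where

-- Nullity explains the numbers. `F₇` has nullity 4 and its dual nullity 3, and passing to a minor
-- never raises the nullity; a basis with two further vectors has nullity at most 2. Walking between
-- two bases costs one further vector, pushing a vector into such a set costs a second one, so only
-- one vector can be pushed per round. The base of the loop is the main obstacle. It is an arbitrary
-- point `p`, not a vertex, and the exchanges also change the sets at the two ends. The pushed basis
-- is therefore chosen inside a vertex `z` charged by `p`: the end columns then move, but always
-- below `z`. A collar from `p` to the vertex `z` and on to the grid closes the gap. Positivity of a
-- real weight is undecidable. A vertex is picked by a lower bound on its weight, one bound serving
-- all points because the poset is finite. Comparability of two points is demanded only strictly
-- between the ends of an interpolation, so that no boundary case has to be decided.

-- Linear algebra over the field with two elements: dimension by counting, spans, basis exchange.

module LinearAlgebra where
  open import Defs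
  open import Data.Bool using (Bool; true; false; not; _∧_; _xor_)
  import Data.Bool.Properties as Bool
  open import Data.Empty using (⊥-elim)
  open import Data.Fin as Fin using (Fin; zero; suc; toℕ; fromℕ<)
  import Data.Fin.Properties as Fin
  open import Data.List using (List; []; _∷_; length; tabulate)
  import Data.List.Properties as List
  open import Data.List.Membership.Propositional using (_∈_)
  open import Data.List.Membership.Propositional.Properties using (∈-tabulate⁺)
  open import Data.List.Relation.Unary.Any using (here; there)
  open import Data.Nat using (ℕ; zero; suc; _≤_; _<_; z≤n; s≤s; _^_)
  import Data.Nat.Properties as ℕ
  open import Data.Product using (∃; ∃-syntax; _×_; _,_; proj₁; proj₂)
  open import Data.Sum using (_⊎_; inj₁; inj₂)
  open import Data.Vec as Vec using (Vec; []; _∷_; zipWith)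
  import Data.Vec.Properties as Vec
  open import Function using (_∘_)
  open import Relation.Binary.PropositionalEquality
  open import Relation.Nullary using (¬_; Dec; yes; no; contradiction)
  open import Relation.Nullary.Decidable using (map′; _⊎-dec_; _×-dec_)

  variable
    r m n : ℕ

  infixl 6 _⊕_
  _⊕_ : 𝔽₂^ r → 𝔽₂^ r → 𝔽₂^ r
  _⊕_ = zipWith _xor_

  ⊕-assoc : (u v w : 𝔽₂^ r) → (u ⊕ v) ⊕ w ≡ u ⊕ (v ⊕ w)
  ⊕-assoc = Vec.zipWith-assoc Bool.xor-assoc

  ⊕-comm : (u v : 𝔽₂^ r) → u ⊕ v ≡ v ⊕ u
  ⊕-comm = Vec.zipWith-comm Bool.xor-comm

  ⊕-identityˡ : (v : 𝔽₂^ r) → 0ᵥ ⊕ v ≡ v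
  ⊕-identityˡ = Vec.zipWith-identityˡ Bool.xor-identityˡ

  ⊕-identityʳ : (v : 𝔽₂^ r) → v ⊕ 0ᵥ ≡ v
  ⊕-identityʳ = Vec.zipWith-identityʳ Bool.xor-identityʳ

  ⊕-self : (v : 𝔽₂^ r) → v ⊕ v ≡ 0ᵥ
  ⊕-self []      = refl
  ⊕-self (b ∷ v) = cong₂ _∷_ (Bool.xor-same b) (⊕-self v)

  ⊕-cancel : (u v : 𝔽₂^ r) → u ⊕ (u ⊕ v) ≡ v
  ⊕-cancel u v = trans (sym (⊕-assoc u u v)) (trans (cong (_⊕ v) (⊕-self u)) (⊕-identityˡ v))

  ⊕-swap : (u v w : 𝔽₂^ r) → u ⊕ (v ⊕ w) ≡ v ⊕ (u ⊕ w)
  ⊕-swap u v w = trans (sym (⊕-assoc u v w)) (trans (cong (_⊕ w) (⊕-comm u v)) (⊕-assoc v u w))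

  ⊕≡0⇒≡ : (u v : 𝔽₂^ r) → u ⊕ v ≡ 0ᵥ → u ≡ v
  ⊕≡0⇒≡ u v eq = trans (sym (⊕-identityʳ u)) (trans (cong (u ⊕_) (sym eq)) (⊕-cancel u v))

  _≟ᵥ_ : (u v : 𝔽₂^ r) → Dec (u ≡ v)
  _≟ᵥ_ = Vec.≡-dec Bool._≟_

  ∃-vec? : ∀ n {P : Vec Bool n → Set} → (∀ v → Dec (P v)) → Dec (∃ P)
  ∃-vec? zero    P? = map′ ([] ,_) (λ { ([] , p) → p }) (P? [])
  ∃-vec? (suc n) P? = map′
    (λ { (inj₁ (v , p)) → true ∷ v , p ; (inj₂ (v , p)) → false ∷ v , p })
    (λ { (true ∷ v , p) → inj₁ (v , p) ; (false ∷ v , p) → inj₂ (v , p) })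
    (∃-vec? n (P? ∘ (true ∷_)) ⊎-dec ∃-vec? n (P? ∘ (false ∷_)))

  bit : Bool → Fin 2
  bit false = zero
  bit true  = suc zero

  bit-injective : ∀ a b → bit a ≡ bit b → a ≡ b
  bit-injective false false _ = refl
  bit-injective true  true  _ = refl

  encode : Vec Bool n → Fin (2 ^ n)
  encode []      = zero
  encode (b ∷ v) = Fin.combine (bit b) (encode v)

  encode-injective : (u v : Vec Bool n) → encode u ≡ encode v → u ≡ v
  encode-injective []      []      _  = refl
  encode-injective (a ∷ u) (b ∷ v) eq = cong₂ _∷_
    (bit-injective a b (Fin.combine-injectiveˡ (bit a) (encode u) (bit b) (encode v) eq))
    (encode-injective u v (Fin.combine-injectiveʳ (bit a) (encode u) (bit b) (encode v) eq))

  unbit : Fin 2 → Bool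
  unbit zero    = false
  unbit (suc _) = true

  bit-unbit : ∀ i → bit (unbit i) ≡ i
  bit-unbit zero       = refl
  bit-unbit (suc zero) = refl

  decode : ∀ n → Fin (2 ^ n) → Vec Bool n
  decode zero    _ = []
  decode (suc n) i = unbit (proj₁ qr) ∷ decode n (proj₂ qr)
    where qr = Fin.remQuot {2} (2 ^ n) i

  encode-decode : ∀ n i → encode (decode n i) ≡ i
  encode-decode zero    zero = refl
  encode-decode (suc n) i    = trans
    (cong₂ Fin.combine (bit-unbit (proj₁ qr)) (encode-decode n (proj₂ qr)))
    (Fin.combine-remQuot {2} (2 ^ n) i)
    where qr = Fin.remQuot {2} (2 ^ n) i

  decode-injective : ∀ n {i j} → decode n i ≡ decode n j → i ≡ j
  decode-injective n {i} {j} eq =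
    trans (sym (encode-decode n i)) (trans (cong encode eq) (encode-decode n j))

  -- Pigeonhole: for `m > n` the codes would give an injection of `2 ^ m` elements into the smaller
  -- number `2 ^ n`. The dimension bounds below all rest on this count.
  injective⇒≤ : (f : Vec Bool m → Vec Bool n) → (∀ u v → f u ≡ f v → u ≡ v) → m ≤ n
  injective⇒≤ {m} {n} f inj with m ℕ.≤? n
  ... | yes m≤n = m≤n
  ... | no  m≰n = contradiction
    (Fin.injective⇒≤ {f = encode ∘ f ∘ decode m}
      (λ eq → decode-injective m (inj _ _ (encode-injective _ _ eq))))
    (ℕ.<⇒≱ (ℕ.^-monoʳ-< 2 (s≤s (s≤s z≤n)) (ℕ.≰⇒> m≰n)))

  -- A missed value `w` could be added to the image, giving an injection of `1 + 2 ^ m` elements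
  -- into `2 ^ n`, which is at most `2 ^ m`.
  injective⇒surjective : (f : Vec Bool m → Vec Bool n) → (∀ u v → f u ≡ f v → u ≡ v) →
    n ≤ m → ∀ w → ∃[ u ] f u ≡ w
  injective⇒surjective {m} {n} f inj n≤m w with ∃-vec? m (λ u → f u ≟ᵥ w)
  ... | yes p = p
  ... | no ¬p = contradiction (ℕ.≤-trans (Fin.injective⇒≤ {f = g} g-inj) (ℕ.^-monoʳ-≤ 2 n≤m)) ℕ.1+n≰n
    where
    g : Fin (suc (2 ^ m)) → Fin (2 ^ n)
    g zero    = encode w
    g (suc i) = encode (f (decode m i))

    g-inj : ∀ {i j} → g i ≡ g j → i ≡ j
    g-inj {zero}  {zero}  _  = refl
    g-inj {zero}  {suc j} eq = contradiction (decode m j , sym (encode-injective _ _ eq)) ¬p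
    g-inj {suc i} {zero}  eq = contradiction (decode m i , encode-injective _ _ eq) ¬p
    g-inj {suc i} {suc j} eq = cong suc (decode-injective m (inj _ _ (encode-injective _ _ eq)))

  -- Over this field a linear combination is just a sum of generators, so no scalars occur. The
  -- generators form a predicate, so that families, lists and subfamilies can be compared through
  -- `span-bind`.
  data Span (S : 𝔽₂^ r → Set) : 𝔽₂^ r → Set where
    zeroˢ : Span S 0ᵥ
    addˢ  : ∀ {s v} → S s → Span S v → Span S (s ⊕ v)

  span-⊕ : ∀ {S : 𝔽₂^ r → Set} {u v} → Span S u → Span S v → Span S (u ⊕ v)
  span-⊕ {S = S} {v = v} zeroˢ q = subst (Span S) (sym (⊕-identityˡ v)) q
  span-⊕ {S = S} {v = v} (addˢ {s} {w} p ps) q =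
    subst (Span S) (sym (⊕-assoc s w v)) (addˢ p (span-⊕ ps q))

  span-η : ∀ {S : 𝔽₂^ r → Set} {v} → S v → Span S v
  span-η {S = S} {v} p = subst (Span S) (⊕-identityʳ v) (addˢ p zeroˢ)

  span-bind : ∀ {S S′ : 𝔽₂^ r → Set} → (∀ {v} → S v → Span S′ v) → ∀ {v} → Span S v → Span S′ v
  span-bind f zeroˢ       = zeroˢ
  span-bind f (addˢ p ps) = span-⊕ (f p) (span-bind f ps)

  span-mono : ∀ {S S′ : 𝔽₂^ r → Set} → (∀ {v} → S v → S′ v) → ∀ {v} → Span S v → Span S′ v
  span-mono f = span-bind (span-η ∘ f)

  Spans : List (𝔽₂^ r) → Set
  Spans vs = ∀ v → Span (_∈ vs) v

  infixr 7 _·_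
  _·_ : Bool → 𝔽₂^ r → 𝔽₂^ r
  c · v = Vec.map (c ∧_) v

  true-· : (v : 𝔽₂^ r) → true · v ≡ v
  true-· = Vec.map-id

  false-· : (v : 𝔽₂^ r) → false · v ≡ 0ᵥ
  false-· v = Vec.map-const v false

  true-·-⊕ : (v w : 𝔽₂^ r) → true · v ⊕ w ≡ v ⊕ w
  true-·-⊕ v w = cong (_⊕ w) (true-· v)

  false-·-⊕ : (v w : 𝔽₂^ r) → false · v ⊕ w ≡ w
  false-·-⊕ v w = trans (cong (_⊕ w) (false-· v)) (⊕-identityˡ w)

  xor-· : ∀ a b (v : 𝔽₂^ r) → (a xor b) · v ≡ a · v ⊕ b · v
  xor-· a b []      = refl
  xor-· a b (x ∷ v) = cong₂ _∷_ (Bool.∧-distribʳ-xor x a b) (xor-· a b v)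

  lc-⊕ : (vs : List (𝔽₂^ r)) (cs ds : Vec Bool (length vs)) →
    linearCombination vs (cs ⊕ ds) ≡ linearCombination vs cs ⊕ linearCombination vs ds
  lc-⊕ []       []       []       = sym (⊕-identityˡ 0ᵥ)
  lc-⊕ (v ∷ vs) (c ∷ cs) (d ∷ ds) = begin
    (c xor d) · v ⊕ linearCombination vs (cs ⊕ ds)
      ≡⟨ cong₂ _⊕_ (xor-· c d v) (lc-⊕ vs cs ds) ⟩
    (c · v ⊕ d · v) ⊕ (C ⊕ D)
      ≡⟨ ⊕-assoc (c · v) (d · v) (C ⊕ D) ⟩
    c · v ⊕ (d · v ⊕ (C ⊕ D))
      ≡⟨ cong (c · v ⊕_) (⊕-swap (d · v) C D) ⟩
    c · v ⊕ (C ⊕ (d · v ⊕ D))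
      ≡⟨ sym (⊕-assoc (c · v) C (d · v ⊕ D)) ⟩
    (c · v ⊕ C) ⊕ (d · v ⊕ D) ∎
    where
    open ≡-Reasoning
    C = linearCombination vs cs
    D = linearCombination vs ds

  lc-0 : (vs : List (𝔽₂^ r)) → linearCombination vs 0ᵥ ≡ 0ᵥ
  lc-0 []       = refl
  lc-0 (v ∷ vs) = trans (false-·-⊕ v _) (lc-0 vs)

  lc-∈ : ∀ {vs : List (𝔽₂^ r)} {v} → v ∈ vs → ∃[ cs ] linearCombination vs cs ≡ v
  lc-∈ {vs = v ∷ vs} (here refl) =
    true ∷ 0ᵥ , trans (cong₂ _⊕_ (true-· v) (lc-0 vs)) (⊕-identityʳ v)
  lc-∈ {vs = u ∷ vs} (there p) with cs , eq ← lc-∈ p =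
    false ∷ cs , trans (false-·-⊕ u _) eq

  span⇒lc : ∀ {vs : List (𝔽₂^ r)} {v} → Span (_∈ vs) v → ∃[ cs ] linearCombination vs cs ≡ v
  span⇒lc {vs = vs} zeroˢ = 0ᵥ , lc-0 vs
  span⇒lc {vs = vs} (addˢ p ps) with cs , refl ← lc-∈ p | ds , refl ← span⇒lc ps =
    cs ⊕ ds , lc-⊕ vs cs ds

  lc⇒span : (vs : List (𝔽₂^ r)) (cs : Vec Bool (length vs)) → Span (_∈ vs) (linearCombination vs cs)
  lc⇒span []       []           = zeroˢ
  lc⇒span (v ∷ vs) (true ∷ cs)  = subst (Span (_∈ v ∷ vs)) (sym (true-·-⊕ v _))
    (addˢ (here refl) (span-mono there (lc⇒span vs cs)))
  lc⇒span (v ∷ vs) (false ∷ cs) = subst (Span (_∈ v ∷ vs)) (sym (false-·-⊕ v _))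
    (span-mono there (lc⇒span vs cs))

  span? : (vs : List (𝔽₂^ r)) (v : 𝔽₂^ r) → Dec (Span (_∈ vs) v)
  span? vs v = map′ (λ { (cs , refl) → lc⇒span vs cs }) span⇒lc
    (∃-vec? (length vs) (λ cs → linearCombination vs cs ≟ᵥ v))

  lc-injective : (vs : List (𝔽₂^ r)) → LinearlyIndependent vs →
    ∀ cs ds → linearCombination vs cs ≡ linearCombination vs ds → cs ≡ ds
  lc-injective vs li cs ds eq = ⊕≡0⇒≡ cs ds (li (cs ⊕ ds)
    (trans (lc-⊕ vs cs ds) (trans (cong (_⊕ linearCombination vs ds) eq) (⊕-self _))))

  independent-length : (vs : List (𝔽₂^ r)) → LinearlyIndependent vs → length vs ≤ r
  independent-length vs li = injective⇒≤ _ (lc-injective vs li)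

  independent-spans : (vs : List (𝔽₂^ r)) → LinearlyIndependent vs → r ≤ length vs → Spans vs
  independent-spans vs li r≤ v
    with cs , refl ← injective⇒surjective _ (lc-injective vs li) r≤ v = lc⇒span vs cs

  module _ (vs : List (𝔽₂^ r)) (sp : Spans vs) where
    coefficients : 𝔽₂^ r → Vec Bool (length vs)
    coefficients v = proj₁ (span⇒lc (sp v))

    lc-coefficients : ∀ v → linearCombination vs (coefficients v) ≡ v
    lc-coefficients v = proj₂ (span⇒lc (sp v))

    coefficients-injective : ∀ u v → coefficients u ≡ coefficients v → u ≡ v
    coefficients-injective u v eq =
      trans (sym (lc-coefficients u)) (trans (cong (linearCombination vs) eq) (lc-coefficients v))

    spans-length : r ≤ length vs
    spans-length = injective⇒≤ coefficients coefficients-injective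

    -- Choosing coefficients is injective, hence surjective by counting. So `cs` and the zero tuple
    -- are both chosen coefficients, and of the same vector, namely zero.
    spans-independent : length vs ≤ r → LinearlyIndependent vs
    spans-independent ≤r cs eq
      with v , refl ← injective⇒surjective coefficients coefficients-injective ≤r cs
      with w , eq′ ← injective⇒surjective coefficients coefficients-injective ≤r 0ᵥ =
      trans (cong coefficients (trans (sym (lc-coefficients v)) (trans eq (sym w≡0)))) eq′
      where
      w≡0 : w ≡ 0ᵥ
      w≡0 = trans (sym (lc-coefficients w)) (trans (cong (linearCombination vs) eq′) (lc-0 vs))

  independent-∷ : ∀ (vs : List (𝔽₂^ r)) {v} → LinearlyIndependent vs → ¬ Span (_∈ vs) v →
    LinearlyIndependent (v ∷ vs)
  independent-∷ vs {v} li ∉ (false ∷ cs) eq = cong (false ∷_) (li cs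
    (trans (sym (false-·-⊕ v _)) eq))
  independent-∷ vs {v} li ∉ (true ∷ cs) eq = ⊥-elim (∉ (subst (Span (_∈ vs))
    (sym (⊕≡0⇒≡ v (linearCombination vs cs)
      (trans (sym (true-·-⊕ v _)) eq))) (lc⇒span vs cs)))

  -- An ordered basis: `r` spanning vectors are independent by counting. The order serves to
  -- measure, through `Agree`, how far an exchange process has come.
  record Frame (r : ℕ) : Set where
    field
      vec   : Fin r → 𝔽₂^ r
      spans : ∀ v → Span (λ u → ∃[ i ] vec i ≡ u) v

  open Frame

  frameList : Frame r → List (𝔽₂^ r)
  frameList β = tabulate (vec β)

  frameList-spans : (β : Frame r) → Spans (frameList β)
  frameList-spans β v = span-mono (λ { (i , refl) → ∈-tabulate⁺ i }) (spans β v)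

  Agree : ℕ → Frame r → Frame r → Set
  Agree K β β′ = ∀ i → toℕ i < K → vec β i ≡ vec β′ i

  sumF : (Fin n → Bool) → (Fin n → 𝔽₂^ r) → 𝔽₂^ r
  sumF {zero}  c f = 0ᵥ
  sumF {suc n} c f = c zero · f zero ⊕ sumF (c ∘ suc) (f ∘ suc)

  toggle : Fin n → (Fin n → Bool) → Fin n → Bool
  toggle zero    c zero    = not (c zero)
  toggle zero    c (suc j) = c (suc j)
  toggle (suc i) c zero    = c zero
  toggle (suc i) c (suc j) = toggle i (c ∘ suc) j

  toggle-self : ∀ (i : Fin n) c → toggle i c i ≡ not (c i)
  toggle-self zero    c = refl
  toggle-self (suc i) c = toggle-self i (c ∘ suc)

  -- In characteristic 2, adding `f i` flips its coefficient, whichever value it had.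
  sumF-toggle : ∀ i c (f : Fin n → 𝔽₂^ r) → sumF (toggle i c) f ≡ f i ⊕ sumF c f
  sumF-toggle zero c f = trans
    (cong (_⊕ rest) (trans (xor-· true (c zero) (f zero)) (true-·-⊕ (f zero) (c zero · f zero))))
    (⊕-assoc (f zero) (c zero · f zero) rest)
    where rest = sumF (c ∘ suc) (f ∘ suc)
  sumF-toggle (suc i) c f = trans (cong (c zero · f zero ⊕_) (sumF-toggle i (c ∘ suc) (f ∘ suc)))
    (⊕-swap (c zero · f zero) (f (suc i)) _)

  sumF-0 : (f : Fin n → 𝔽₂^ r) → sumF (λ _ → false) f ≡ 0ᵥ
  sumF-0 {zero}  f = refl
  sumF-0 {suc n} f = trans (false-·-⊕ (f zero) _) (sumF-0 (f ∘ suc))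

  span⇒sumF : (f : Fin n → 𝔽₂^ r) → ∀ {v} → Span (λ u → ∃[ i ] f i ≡ u) v → ∃[ c ] sumF c f ≡ v
  span⇒sumF f zeroˢ = (λ _ → false) , sumF-0 f
  span⇒sumF f (addˢ (i , refl) p) with c , refl ← span⇒sumF f p = toggle i c , sumF-toggle i c f

  sumF⇒span : ∀ {S : 𝔽₂^ r → Set} (c : Fin n → Bool) f → (∀ i → c i ≡ true → S (f i)) → Span S (sumF c f)
  sumF⇒span {n = zero}  c f h = zeroˢ
  sumF⇒span {n = suc n} {S = S} c f h with c zero in eq
  ... | true  = subst (Span S) (sym (true-·-⊕ (f zero) _)) (addˢ (h zero eq) (sumF⇒span (c ∘ suc) (f ∘ suc) (h ∘ suc)))
  ... | false = subst (Span S) (sym (false-·-⊕ (f zero) _))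
    (sumF⇒span (c ∘ suc) (f ∘ suc) (h ∘ suc))

  -- Otherwise the other vectors, one fewer than the dimension, would still span.
  frame-minimal : (β : Frame r) (k : Fin r) → ¬ Span (λ u → ∃[ i ] (i ≢ k × vec β i ≡ u)) (vec β k)
  frame-minimal {suc r} β k p = ℕ.1+n≰n
    (subst (suc r ≤_) (List.length-tabulate others) (spans-length _ others-span))
    where
    others : Fin r → 𝔽₂^ (suc r)
    others = vec β ∘ Fin.punchIn k

    other∈ : ∀ i → i ≢ k → vec β i ∈ tabulate others
    other∈ i i≢k = subst (λ j → vec β j ∈ tabulate others)
      (Fin.punchIn-punchOut (i≢k ∘ sym)) (∈-tabulate⁺ (Fin.punchOut (i≢k ∘ sym)))

    others-span : Spans (tabulate others)
    others-span v = span-bind (λ { (i , refl) → go i }) (spans β v)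
      where
      go : ∀ i → Span (_∈ tabulate others) (vec β i)
      go i with i Fin.≟ k
      ... | yes refl = span-mono (λ { (j , j≢ , refl) → other∈ j j≢ }) p
      ... | no  i≢k  = span-η (other∈ i i≢k)

  -- Past the last position nothing is added and the frame is kept, so that walks can be given a
  -- length independent of `K`.
  added : ∀ {K} → Frame r → Dec (K < r) → List (𝔽₂^ r)
  added β′ (yes K<r) = vec β′ (fromℕ< K<r) ∷ []
  added β′ (no  _)   = []

  added-short : ∀ {K} (β′ : Frame r) (d : Dec (K < r)) → length (added β′ d) ≤ 1
  added-short β′ (yes _) = s≤s z≤n
  added-short β′ (no  _) = z≤n

  added⊆ : ∀ {K} (β′ : Frame r) (d : Dec (K < r)) {v} → v ∈ added β′ d → ∃[ i ] vec β′ i ≡ v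
  added⊆ β′ (yes K<r) (here refl) = fromℕ< K<r , refl

  record Exchange (K : ℕ) (β β′ : Frame r) (es : List (𝔽₂^ r)) : Set where
    field
      frame   : Frame r
      agree   : Agree (suc K) frame β′
      frame⊆  : ∀ i → vec frame i ∈ es ⊎ (∃[ j ] vec β j ≡ vec frame i)

  -- Steinitz exchange. The vector thrown out stands at a position `≥ K`, so the first `K`
  -- positions, already equal to those of `β′`, survive.
  exchange : ∀ K (β β′ : Frame r) → Agree K β β′ → (d : Dec (K < r)) → Exchange K β β′ (added β′ d)
  exchange {r} K β β′ agr (no K≮r) = record
    { frame = β
    ; agree = λ i _ → agr i (ℕ.<-≤-trans (Fin.toℕ<n i) (ℕ.≮⇒≥ K≮r))
    ; frame⊆ = λ i → inj₂ (i , refl)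
    }
  exchange {r} K β β′ agr (yes K<r) = record
    { frame = record { vec = vec″ ; spans = λ v → span-bind (λ { (i , refl) → old i }) (spans β v) }
    ; agree = agree″
    ; frame⊆ = ⊆″
    }
    where
    k = fromℕ< K<r
    e = vec β′ k
    cs = span⇒sumF (vec β) (spans β e)
    c = proj₁ cs

    -- Without such a `j`, `e` would be a sum of the first `K` vectors of `β`, which are also
    -- vectors of `β′` other than `e`; this contradicts the minimality of `β′`.
    pivot : ∃[ j ] (K ≤ toℕ j × c j ≡ true)
    pivot with Fin.any? (λ j → K ℕ.≤? toℕ j ×-dec c j Bool.≟ true)
    ... | yes p = p
    ... | no ¬p = ⊥-elim (frame-minimal β′ k (subst (Span _) (proj₂ cs)
          (sumF⇒span c (vec β) λ i ci → i , i≢k i ci , sym (agr i (i<K i ci)))))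
      where
      i<K : ∀ i → c i ≡ true → toℕ i < K
      i<K i ci = ℕ.≰⇒> λ K≤i → ¬p (i , K≤i , ci)
      i≢k : ∀ i → c i ≡ true → i ≢ k
      i≢k i ci refl = ℕ.<-irrefl (Fin.toℕ-fromℕ< K<r) (i<K i ci)

    j = proj₁ pivot

    -- `e` has to stand at position `k`, so `vec β k` moves to the place `j` of the discarded
    -- vector. If `j` is `k`, it is itself the discarded vector.
    vec″ : Fin r → 𝔽₂^ r
    vec″ i with i Fin.≟ k
    ... | yes _ = e
    ... | no  _ with i Fin.≟ j
    ...   | yes _ = vec β k
    ...   | no  _ = vec β i

    In : 𝔽₂^ r → Set
    In u = ∃[ i ] vec″ i ≡ u

    at-k : vec″ k ≡ e
    at-k with k Fin.≟ k
    ... | yes _ = refl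
    ... | no k≢k = ⊥-elim (k≢k refl)

    other : ∀ i → i ≢ j → In (vec β i)
    other i i≢j with i Fin.≟ k
    ... | yes refl = j , at-j
      where
      at-j : vec″ j ≡ vec β k
      at-j with j Fin.≟ k
      ... | yes j≡k = ⊥-elim (i≢j (sym j≡k))
      ... | no _ with j Fin.≟ j
      ...   | yes _ = refl
      ...   | no j≢j = ⊥-elim (j≢j refl)
    ... | no i≢k = i , at-i
      where
      at-i : vec″ i ≡ vec β i
      at-i with i Fin.≟ k
      ... | yes i≡k = ⊥-elim (i≢k i≡k)
      ... | no _ with i Fin.≟ j
      ...   | yes i≡j = ⊥-elim (i≢j i≡j)
      ...   | no _ = refl

    -- The expansion of `e` is solved for `vec β j`: toggling `j` removes this summand, and the
    -- remaining ones are in the new frame.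
    pivot-span : Span In (vec β j)
    pivot-span = subst (Span In) eq (addˢ (k , at-k) (sumF⇒span (toggle j c) (vec β) λ i ci → other i λ { refl →
        contradiction (trans (sym ci) (trans (toggle-self j c) (cong not (proj₂ (proj₂ pivot))))) λ () }))
      where
      eq : e ⊕ sumF (toggle j c) (vec β) ≡ vec β j
      eq = trans (cong (e ⊕_) (trans (sumF-toggle j c (vec β))
             (trans (cong (vec β j ⊕_) (proj₂ cs)) (⊕-comm (vec β j) e)))) (⊕-cancel e (vec β j))

    old : ∀ i → Span In (vec β i)
    old i with i Fin.≟ j
    ... | yes refl = pivot-span
    ... | no  i≢j  = span-η (other i i≢j)

    agree″ : ∀ i → toℕ i < suc K → vec″ i ≡ vec β′ i
    agree″ i (s≤s i≤K) with i Fin.≟ k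
    ... | yes refl = refl
    ... | no i≢k with i Fin.≟ j
    ...   | yes refl = ⊥-elim (i≢k (Fin.toℕ-injective (trans (ℕ.≤-antisym i≤K (proj₁ (proj₂ pivot)))
                         (sym (Fin.toℕ-fromℕ< K<r)))))
    ...   | no _ = agr i (ℕ.≤∧≢⇒< i≤K λ i≡K → i≢k (Fin.toℕ-injective (trans i≡K (sym (Fin.toℕ-fromℕ< K<r)))))

    ⊆″ : ∀ i → vec″ i ∈ (e ∷ []) ⊎ (∃[ j ] vec β j ≡ vec″ i)
    ⊆″ i with i Fin.≟ k
    ... | yes _ = inj₁ (here refl)
    ... | no _ with i Fin.≟ j
    ...   | yes _ = inj₂ (k , refl)
    ...   | no _ = inj₂ (i , refl)

-- Regularity of small sets: excluding both minors by nullity.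

module Regularity where
  open import Defs
  open import Data.Bool using (Bool; true; false; T; T?; _xor_)
  import Data.Bool.Properties as Bool
  open import Data.Empty using (⊥-elim)
  open import Data.Fin as Fin using (Fin; zero; suc)
  import Data.Fin.Properties as Fin
  open import Data.List as List using (List; []; _∷_; _++_; length; tabulate; filter)
  import Data.List.Properties as List
  open import Data.List.Membership.Propositional using (_∈_; _∉_)
  open import Data.List.Membership.Propositional.Properties
  open import Data.List.Relation.Unary.All as All using (All; []; _∷_)
  import Data.List.Relation.Unary.All.Properties as All
  open import Data.List.Relation.Unary.Any.Properties using (lookup-index)
  import Data.List.Relation.Unary.Any as Any
  open import Data.Nat using (ℕ; zero; suc; _≤_; _<_; s≤s; _+_)
  import Data.Nat.Properties as ℕ
  open import Data.Product using (∃; ∃-syntax; _×_; _,_; proj₁; proj₂)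
  open import Data.Sum using (_⊎_; inj₁; inj₂)
  open import Data.Unit using (tt)
  open import Data.Vec as Vec using (Vec; []; _∷_; lookup)
  import Data.Vec.Properties as Vec
  open import Data.List.Relation.Unary.Unique.DecPropositional using (unique?)
  import Data.List.Membership.DecPropositional as DecMembership
  open import Function using (_∘_; Inverse; Equivalence)
  open import Relation.Binary.PropositionalEquality
  open import Relation.Nullary using (¬_; Dec; yes; no; contradiction; ¬?; _⊎-dec_)
  open import Relation.Nullary.Decidable using (from-yes; from-no; decidable-stable; isYes; toWitness; fromWitness)
  open LinearAlgebra

  module _ {r : ℕ} where
    open DecMembership (_≟ᵥ_ {r}) public using (_∈?_)

  -- A certificate of nullity at least 3: three elements outside an independent set, each of them
  -- dependent on it.
  record CircuitWitness (N : Matroid) : Set where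
    field
      basis   : List (Ground N)
      indep   : Indep N (List.map proj₁ basis)
      g₁ g₂ g₃ : Ground N
      g₁≢g₂   : proj₁ g₁ ≢ proj₁ g₂
      g₁≢g₃   : proj₁ g₁ ≢ proj₁ g₃
      g₂≢g₃   : proj₁ g₂ ≢ proj₁ g₃
      outside : All (λ g → proj₁ g ∉ List.map proj₁ basis × ¬ Indep N (proj₁ g ∷ List.map proj₁ basis))
                    (g₁ ∷ g₂ ∷ g₃ ∷ [])

  ∖⁻ˡ : {E : Set} (X Y : Sub E) {e : E} → e ∈ₛ X ∖ Y → e ∈ₛ X
  ∖⁻ˡ X Y {e} p with X e
  ... | true = tt

  ∖⁻ʳ : {E : Set} (X Y : Sub E) {e : E} → e ∈ₛ X ∖ Y → ¬ e ∈ₛ Y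
  ∖⁻ʳ X Y {e} p q with X e | Y e
  ∖⁻ʳ X Y {e} () q | true | true

  ground-≡ : (N : Matroid) {g h : Ground N} → proj₁ g ≡ proj₁ h → g ≡ h
  ground-≡ N {e , p} {.e , q} refl = cong (e ,_) (Bool.T-irrelevant p q)

  -- All copies go, because an extra vector may repeat a vector of the frame and the deletion has to
  -- remove it from the set.
  remove : 𝔽₂^ r → List (𝔽₂^ r) → List (𝔽₂^ r)
  remove g = filter (λ v → ¬? (v ≟ᵥ g))

  remove-length : ∀ {g : 𝔽₂^ r} {vs} → g ∈ vs → length (remove g vs) < length vs
  remove-length {g = g} {vs} p = List.filter-notAll (λ v → ¬? (v ≟ᵥ g)) vs
    (Any.map (λ { refl v≢g → v≢g refl }) p)

  ∈-remove : ∀ {g v : 𝔽₂^ r} {vs} → v ∈ vs → v ≢ g → v ∈ remove g vs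
  ∈-remove {g = g} = ∈-filter⁺ (λ v → ¬? (v ≟ᵥ g))

  -- With at most r + 2 elements, a spanning set cannot stay spanning after three deletions.
  no-minor : (X : Sub (𝔽₂^ r)) (vs : List (𝔽₂^ r)) → (∀ v → v ∈ₛ X → v ∈ vs) → Spans vs →
    length vs ≤ 2 + r → ∀ N → CircuitWitness N → ¬ HasMinor (linearMatroid X) N
  no-minor {r} X vs X⊆ sp len N cw (C , D , C⊆ , D⊆ , iso) = ℕ.<⇒≱ short (spans-length vs₃ vs₃-spans)
    where
    open CircuitWitness cw
    open _≅_ iso using (bijection) renaming (indep to indep⇔)
    M = linearMatroid X
    M′ = (M /ᴹ C) ∖ᴹ D
    from = Inverse.from bijection
    to∘from : ∀ g → Inverse.to bijection (from g) ≡ g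
    to∘from = Inverse.strictlyInverseˡ bijection

    transport : (J : List (Ground N)) →
      List.map (proj₁ ∘ Inverse.to bijection) (List.map from J) ≡ List.map proj₁ J
    transport J = trans (sym (List.map-∘ J)) (List.map-cong (cong proj₁ ∘ to∘from) J)

    Jᵐ = List.map proj₁ (List.map from basis)

    indepJ : Indep M′ Jᵐ
    indepJ = Equivalence.from (indep⇔ (List.map from basis)) (subst (Indep N) (sym (transport basis)) indep)

    -- Independence in the contraction supplies a basis `B` of `C` that completes the lifted set
    -- `Jᵐ` to a set `W` independent in the original matroid.
    B = proj₁ (proj₂ (proj₂ indepJ))
    B-basis = proj₁ (proj₂ (proj₂ (proj₂ indepJ)))
    J++B-indep = proj₂ (proj₂ (proj₂ (proj₂ indepJ)))
    W = Jᵐ ++ B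

    elt : Ground N → 𝔽₂^ r
    elt g = proj₁ (from g)

    elt-injective : ∀ g h → elt g ≡ elt h → proj₁ g ≡ proj₁ h
    elt-injective g h eq = cong proj₁
      (trans (sym (to∘from g)) (trans (cong (Inverse.to bijection) (ground-≡ M′ eq)) (to∘from h)))

    elt-contr : ∀ g → elt g ∈ₛ X ∖ C
    elt-contr g = ∖⁻ˡ (X ∖ C) D (proj₂ (from g))

    elt-X : ∀ g → elt g ∈ₛ X
    elt-X g = ∖⁻ˡ X C (elt-contr g)

    elt∉W : ∀ g → proj₁ g ∉ List.map proj₁ basis → elt g ∉ W
    elt∉W g g∉ p with ∈-++⁻ Jᵐ p
    ... | inj₁ q with _ , h∈ , eq ← ∈-map⁻ proj₁ q with h , h∈′ , refl ← ∈-map⁻ from h∈ =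
      g∉ (subst (_∈ _) (elt-injective h g (sym eq)) (∈-map⁺ proj₁ h∈′))
    ... | inj₂ q = ∖⁻ʳ X C (elt-contr g) (All.lookup (IsBasisOf.inside B-basis) q)

    -- Were `elt g` outside the span of `W`, it could be added to `W`, and then `g` together with
    -- `basis` would be independent in `N`.
    elt-span : ∀ g → ¬ Indep N (proj₁ g ∷ List.map proj₁ basis) → Span (_∈ W) (elt g)
    elt-span g dep with span? W (elt g)
    ... | yes p = p
    ... | no ¬p = ⊥-elim (dep (subst (Indep N) (transport (g ∷ basis))
          (Equivalence.to (indep⇔ (List.map from (g ∷ basis)))
            ( proj₂ (from g) ∷ proj₁ indepJ
            , elt-contr g ∷ proj₁ (proj₂ indepJ)
            , B , B-basis
            , elt-X g ∷ proj₁ J++B-indep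
            , independent-∷ W (proj₂ J++B-indep) ¬p))))

    h₁ = elt g₁
    h₂ = elt g₂
    h₃ = elt g₃
    h₁≢h₂ : h₁ ≢ h₂
    h₁≢h₂ = g₁≢g₂ ∘ elt-injective g₁ g₂
    h₁≢h₃ : h₁ ≢ h₃
    h₁≢h₃ = g₁≢g₃ ∘ elt-injective g₁ g₃
    h₂≢h₃ : h₂ ≢ h₃
    h₂≢h₃ = g₂≢g₃ ∘ elt-injective g₂ g₃

    vs₁ = remove h₁ vs
    vs₂ = remove h₂ vs₁
    vs₃ = remove h₃ vs₂

    short : length vs₃ < r
    short = ℕ.≤-pred (ℕ.≤-pred (ℕ.≤-trans (s≤s (ℕ.≤-trans (s≤s
        (remove-length (∈-remove (∈-remove (X⊆ h₃ (elt-X g₃)) (h₁≢h₃ ∘ sym)) (h₂≢h₃ ∘ sym))))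
        (remove-length (∈-remove (X⊆ h₂ (elt-X g₂)) (h₁≢h₂ ∘ sym)))))
      (ℕ.≤-trans (remove-length (X⊆ h₁ (elt-X g₁))) len)))

    survives : ∀ {v} → v ∈ vs → v ≢ h₁ → v ≢ h₂ → v ≢ h₃ → v ∈ vs₃
    survives p n₁ n₂ n₃ = ∈-remove (∈-remove (∈-remove p n₁) n₂) n₃

    W⊆vs₃ : ∀ {v} → v ∈ W → v ∈ vs₃
    W⊆vs₃ {v} p with out₁ ∷ out₂ ∷ out₃ ∷ [] ← outside =
      survives (X⊆ v (All.lookup (proj₁ J++B-indep) p))
        (λ { refl → elt∉W g₁ (proj₁ out₁) p })
        (λ { refl → elt∉W g₂ (proj₁ out₂) p })
        (λ { refl → elt∉W g₃ (proj₁ out₃) p })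

    -- The three deleted vectors depend on `W`, and `W` avoids them, so it survives the deletions.
    vs⊆span : ∀ {v} → v ∈ vs → Span (_∈ vs₃) v
    vs⊆span {v} p with out₁ ∷ out₂ ∷ out₃ ∷ [] ← outside with v ≟ᵥ h₁ | v ≟ᵥ h₂ | v ≟ᵥ h₃
    ... | yes refl | _ | _ = span-mono W⊆vs₃ (elt-span g₁ (proj₂ out₁))
    ... | no _ | yes refl | _ = span-mono W⊆vs₃ (elt-span g₂ (proj₂ out₂))
    ... | no _ | no _ | yes refl = span-mono W⊆vs₃ (elt-span g₃ (proj₂ out₃))
    ... | no n₁ | no n₂ | no n₃ = span-η (survives p n₁ n₂ n₃)

    vs₃-spans : Spans vs₃
    vs₃-spans v = span-bind vs⊆span (sp v)

  pattern v100 = true  ∷ false ∷ false ∷ []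
  pattern v010 = false ∷ true  ∷ false ∷ []
  pattern v001 = false ∷ false ∷ true  ∷ []
  pattern v110 = true  ∷ true  ∷ false ∷ []
  pattern v101 = true  ∷ false ∷ true  ∷ []
  pattern v011 = false ∷ true  ∷ true  ∷ []
  pattern v111 = true  ∷ true  ∷ true  ∷ []

  units : List (𝔽₂^ 3)
  units = v100 ∷ v010 ∷ v001 ∷ []

  units-independent : LinearlyIndependent units
  units-independent (false ∷ false ∷ false ∷ []) _ = refl
  units-independent (true  ∷ false ∷ false ∷ []) ()
  units-independent (true  ∷ true  ∷ false ∷ []) ()
  units-independent (true  ∷ false ∷ true  ∷ []) ()
  units-independent (true  ∷ true  ∷ true  ∷ []) ()
  units-independent (false ∷ true  ∷ false ∷ []) ()
  units-independent (false ∷ false ∷ true  ∷ []) ()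
  units-independent (false ∷ true  ∷ true  ∷ []) ()

  F₇-witness : CircuitWitness F₇
  F₇-witness = record
    { basis = (v100 , tt) ∷ (v010 , tt) ∷ (v001 , tt) ∷ []
    ; indep = tt ∷ tt ∷ tt ∷ [] , units-independent
    ; g₁ = v110 , tt ; g₂ = v101 , tt ; g₃ = v011 , tt
    ; g₁≢g₂ = λ () ; g₁≢g₃ = λ () ; g₂≢g₃ = λ ()
    ; outside = (from-no (v110 ∈? units) , λ (_ , li) → contradiction (li (true ∷ true ∷ true ∷ false ∷ []) refl) λ ())
              ∷ (from-no (v101 ∈? units) , λ (_ , li) → contradiction (li (true ∷ true ∷ false ∷ true ∷ []) refl) λ ())
              ∷ (from-no (v011 ∈? units) , λ (_ , li) → contradiction (li (true ∷ false ∷ true ∷ true ∷ []) refl) λ ())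
              ∷ []
    }

  others : List (𝔽₂^ 3)
  others = v110 ∷ v101 ∷ v011 ∷ v111 ∷ []

  span-lookup : ∀ {S : 𝔽₂^ r → Set} i → (∀ {v} → S v → lookup v i ≡ false) →
    ∀ {v} → Span S v → lookup v i ≡ false
  span-lookup i h zeroˢ = Vec.lookup-replicate i false
  span-lookup i h (addˢ {s} {v} p ps) = trans (Vec.lookup-zipWith _xor_ i s v)
    (cong₂ _xor_ (h p) (span-lookup i h ps))

  -- Dual independence would give a basis `B` disjoint from the list. By the hypothesis on vectors
  -- off the list, `B` lies in the hyperplane where coordinate `i` vanishes, so it does not span `e`
  -- and could be enlarged.
  unit-codependent : ∀ {e : 𝔽₂^ 3} i → e ∈ₛ nonzero → lookup e i ≡ true →
    (∀ v → v ∉ e ∷ others → v ∈ₛ nonzero → lookup v i ≡ false) →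
    ¬ Indep (dual F₇) (e ∷ others)
  unit-codependent {e} i nz ei off (_ , _ , B , isBasis , disjoint) =
    IsBasisOf.maximal isBasis e nz
      ( nz ∷ IsBasisOf.inside isBasis
      , independent-∷ B (proj₂ (IsBasisOf.indep isBasis)) λ p →
          contradiction (trans (sym ei) (span-lookup i B-off p)) λ ())
    where
    B-off : ∀ {v} → v ∈ B → lookup v i ≡ false
    B-off {v} p = off v (λ q → disjoint (q , p)) (All.lookup (IsBasisOf.inside isBasis) p)

  ∀-vec : ∀ n {P : Vec Bool n → Set} (P? : ∀ v → Dec (P v)) → ¬ ∃ (¬_ ∘ P) → ∀ v → P v
  ∀-vec n P? h v = decidable-stable (P? v) (λ ¬p → h (v , ¬p))

  off? : ∀ (e : 𝔽₂^ 3) i → ∀ v → Dec (v ∈ e ∷ others ⊎ nonzero v ≡ false ⊎ lookup v i ≡ false)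
  off? e i v = (v ∈? (e ∷ others)) ⊎-dec ((nonzero v Bool.≟ false) ⊎-dec (lookup v i Bool.≟ false))

  off : ∀ (e : 𝔽₂^ 3) i → ¬ ∃ (¬_ ∘ λ v → v ∈ e ∷ others ⊎ nonzero v ≡ false ⊎ lookup v i ≡ false) →
    ∀ v → v ∉ e ∷ others → v ∈ₛ nonzero → lookup v i ≡ false
  off e i h v v∉ nz with ∀-vec 3 (off? e i) h v
  ... | inj₁ p = contradiction p v∉
  ... | inj₂ (inj₁ q) = contradiction (subst T q nz) λ ()
  ... | inj₂ (inj₂ q) = q

  -- `others` is the complement of the basis `units` of the Fano matroid, hence a basis of the dual.
  -- Adding a unit vector completes the complement of a Fano line, which is a circuit of the dual.
  dualF₇-witness : CircuitWitness (dual F₇)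
  dualF₇-witness = record
    { basis = (v110 , tt) ∷ (v101 , tt) ∷ (v011 , tt) ∷ (v111 , tt) ∷ []
    ; indep = from-yes (unique? _≟ᵥ_ others) , tt ∷ tt ∷ tt ∷ tt ∷ [] , units
            , record
              { inside  = tt ∷ tt ∷ tt ∷ []
              ; indep   = tt ∷ tt ∷ tt ∷ [] , units-independent
              ; maximal = λ e _ (_ , li) → ℕ.1+n≰n (independent-length (e ∷ units) li)
              }
            , λ (p , q) → All.lookup others∉units p q
    ; g₁ = v100 , tt ; g₂ = v010 , tt ; g₃ = v001 , tt
    ; g₁≢g₂ = λ () ; g₁≢g₃ = λ () ; g₂≢g₃ = λ ()
    ; outside = (from-no (v100 ∈? others) , unit-codependent zero tt refl
                   (off v100 zero (from-no (∃-vec? 3 (¬? ∘ off? v100 zero)))))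
              ∷ (from-no (v010 ∈? others) , unit-codependent (suc zero) tt refl
                   (off v010 (suc zero) (from-no (∃-vec? 3 (¬? ∘ off? v010 (suc zero))))))
              ∷ (from-no (v001 ∈? others) , unit-codependent (suc (suc zero)) tt refl
                   (off v001 (suc (suc zero)) (from-no (∃-vec? 3 (¬? ∘ off? v001 (suc (suc zero)))))))
              ∷ []
    }
    where
    others∉units : All (_∉ units) others
    others∉units = from-yes (All.all? (λ v → ¬? (v ∈? units)) others)

  nonzero-0 : (v : 𝔽₂^ r) → ¬ v ∈ₛ nonzero → v ≡ 0ᵥ
  nonzero-0 []          _ = refl
  nonzero-0 (true ∷ v)  h = ⊥-elim (h tt)
  nonzero-0 (false ∷ v) h = cong (false ∷_) (nonzero-0 v h)

  frame-nonzero : (β : Frame r) → ∀ i → Frame.vec β i ∈ₛ nonzero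
  frame-nonzero β i with T? (nonzero (Frame.vec β i))
  ... | yes p = p
  ... | no ¬p = ⊥-elim (frame-minimal β i (subst (Span _) (sym (nonzero-0 _ ¬p)) zeroˢ))

  -- The chosen basis is kept apart from the extras because exchanges act on it; the set of vectors
  -- alone would not determine it.
  record Item (r : ℕ) : Set where
    constructor _⟨_⟩
    field
      frame  : Frame r
      extras : List (𝔽₂^ r)

  open Item

  itemList : Item r → List (𝔽₂^ r)
  itemList (β ⟨ ex ⟩) = frameList β ++ ex

  module _ (c : Item r) (len : length (extras c) ≤ 2) (nz : All (_∈ₛ nonzero) (extras c)) where
    private
      vs = itemList c
      β = frame c

      X : Sub (𝔽₂^ r)
      X v = isYes (v ∈? vs)

      regularX : ∀ N → CircuitWitness N → ¬ HasMinor (linearMatroid X) N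
      regularX = no-minor X vs (λ v → toWitness)
        (λ v → span-mono (∈-++⁺ˡ) (frameList-spans β v))
        (subst (_≤ 2 + r) (sym (trans (List.length-++ (frameList β)) (ℕ.+-comm _ (length (extras c)))))
          (subst (λ k → length (extras c) + k ≤ 2 + r) (sym (List.length-tabulate (Frame.vec β)))
            (ℕ.+-monoˡ-≤ r len)))

      frame⊆X : All (_∈ₛ X) (frameList β)
      frame⊆X = All.tabulate (λ p → fromWitness (∈-++⁺ˡ p))

      X-nonzero : ∀ {v} → v ∈ vs → v ∈ₛ nonzero
      X-nonzero p with ∈-++⁻ (frameList β) p
      ... | inj₁ q with i , refl ← ∈-tabulate⁻ q = frame-nonzero β i
      ... | inj₂ q = All.lookup nz q

    regularSubset : RegularSubset r
    regularSubset = record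
      { set        = X
      ; nonzeroSet = λ v → X-nonzero ∘ toWitness
      ; regular    = regularX F₇ F₇-witness , regularX (dual F₇) dualF₇-witness
      ; rank       = frameList β
                   , record
                     { inside  = frame⊆X
                     ; indep   = frame⊆X , spans-independent (frameList β) (frameList-spans β)
                                   (ℕ.≤-reflexive (List.length-tabulate (Frame.vec β)))
                     ; maximal = λ e _ (_ , li) → ℕ.1+n≰n (subst (λ k → suc k ≤ r)
                                   (List.length-tabulate (Frame.vec β)) (independent-length (e ∷ frameList β) li))
                     }
                   , List.length-tabulate (Frame.vec β)
      }

    ∈-regularSubset⁺ : ∀ {v} → v ∈ itemList c → v ∈ₛ set regularSubset
    ∈-regularSubset⁺ = fromWitness

    ∈-regularSubset⁻ : ∀ {v} → v ∈ₛ set regularSubset → v ∈ itemList c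
    ∈-regularSubset⁻ = toWitness

  lookup-frame : (vs : List (𝔽₂^ r)) → length vs ≡ r → Spans vs → Frame r
  lookup-frame {r} vs len sp = record
    { vec = List.lookup vs ∘ Fin.cast (sym len)
    ; spans = λ v → span-mono (λ p → Fin.cast len (Any.index p) ,
        trans (cong (List.lookup vs) (Fin.cast-involutive (sym len) len (Any.index p))) (sym (lookup-index p))) (sp v)
    }

  module _ (X : RegularSubset r) where
    private
      B = proj₁ (rank X)
      isBasis = proj₁ (proj₂ (rank X))
      len = proj₂ (proj₂ (rank X))

    basisFrame : Frame r
    basisFrame = lookup-frame B len
      (independent-spans B (proj₂ (IsBasisOf.indep isBasis)) (ℕ.≤-reflexive (sym len)))

    basisFrame⊆ : ∀ i → Frame.vec basisFrame i ∈ₛ set X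
    basisFrame⊆ i = All.lookup (IsBasisOf.inside isBasis) (∈-lookup (Fin.cast (sym len) i))

  standardFrame : ∀ r → Frame r
  standardFrame r = record
    { vec   = unit
    ; spans = λ v → sp v
    }
    where
    unit : ∀ {n} → Fin n → 𝔽₂^ n
    unit zero    = true ∷ 0ᵥ
    unit (suc i) = false ∷ unit i

    lift : ∀ {n} {v : 𝔽₂^ n} → Span (λ u → ∃[ i ] unit i ≡ u) v → Span (λ u → ∃[ i ] unit i ≡ u) (false ∷ v)
    lift zeroˢ = zeroˢ
    lift (addˢ (i , refl) p) = addˢ (suc i , refl) (lift p)

    sp : ∀ {n} (v : 𝔽₂^ n) → Span (λ u → ∃[ i ] unit i ≡ u) v
    sp []          = zeroˢ
    sp (false ∷ v) = lift (sp v)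
    sp (true ∷ v)  = subst (λ u → Span _ (true ∷ u)) (⊕-identityˡ v) (addˢ (zero , refl) (lift (sp v)))

-- Combinatorial homotopies between sequences of comparable elements.

module GridHomotopy where
  open import Data.Nat using (ℕ; zero; suc; _≤_; _<_; z≤n; s≤s; _+_; _*_; _<?_; >-nonZero)
  import Data.Nat.Properties as ℕ
  open import Data.Product using (∃-syntax; _×_; _,_; proj₁; proj₂)
  open import Data.Sum using (_⊎_; inj₁; inj₂; swap)
  open import Function using (_∘_; id)
  open import Level using (0ℓ)
  open import Relation.Binary.Bundles using (Poset)
  open import Relation.Binary.PropositionalEquality
  open import Relation.Nullary using (yes; no)

  -- A reparametrization making room for subdivision: the two bounds force `quot i` to be the
  -- integer quotient of `i` by `factor`, so each column is repeated `factor` times.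
  record Stretch : Set where
    field
      quot   : ℕ → ℕ
      factor : ℕ
      factor>0 : 0 < factor
      slow   : ∀ i → quot (suc i) ≡ quot i ⊎ quot (suc i) ≡ suc (quot i)
      lower  : ∀ i → quot i * factor ≤ i
      upper  : ∀ i → i < suc (quot i) * factor

    quot-* : ∀ q → quot (q * factor) ≡ q
    quot-* q = ℕ.≤-antisym
      (ℕ.*-cancelʳ-≤ _ q factor {{>-nonZero factor>0}} (lower (q * factor)))
      (ℕ.≤-pred (ℕ.*-cancelʳ-< factor q _ (upper (q * factor))))

  open Stretch

  _∘ˢ_ : Stretch → Stretch → Stretch
  g ∘ˢ h = record
    { quot     = quot g ∘ quot h
    ; factor   = factor g * factor h
    ; factor>0 = ℕ.*-mono-≤ (factor>0 g) (factor>0 h)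
    ; slow     = slow′
    ; lower    = λ i → ℕ.≤-trans (ℕ.≤-reflexive (sym (ℕ.*-assoc (quot g (quot h i)) (factor g) (factor h))))
                   (ℕ.≤-trans (ℕ.*-monoˡ-≤ (factor h) (lower g (quot h i))) (lower h i))
    ; upper    = λ i → ℕ.≤-trans (upper h i)
                   (ℕ.≤-trans (ℕ.*-monoˡ-≤ (factor h) (upper g (quot h i)))
                     (ℕ.≤-reflexive (ℕ.*-assoc (suc (quot g (quot h i))) (factor g) (factor h))))
    }
    where
    slow′ : ∀ i → quot g (quot h (suc i)) ≡ quot g (quot h i) ⊎ quot g (quot h (suc i)) ≡ suc (quot g (quot h i))
    slow′ i with quot h (suc i) | slow h i
    ... | _ | inj₁ refl = inj₁ refl
    ... | _ | inj₂ refl = slow g (quot h i)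

  idˢ : Stretch
  idˢ = record
    { quot = id ; factor = 1 ; factor>0 = s≤s z≤n ; slow = λ _ → inj₂ refl
    ; lower = λ i → ℕ.≤-reflexive (ℕ.*-identityʳ i)
    ; upper = λ i → ℕ.≤-reflexive (cong suc (sym (ℕ.*-identityʳ i)))
    }

  -- Division with remainder by w + 1
  module Block (w : ℕ) where
    next : ℕ × ℕ → ℕ × ℕ
    next (q , ρ) with ρ <? w
    ... | yes _ = q , suc ρ
    ... | no  _ = suc q , 0

    pos : ℕ → ℕ × ℕ
    pos zero    = 0 , 0
    pos (suc i) = next (pos i)

    Valid : ℕ → ℕ × ℕ → Set
    Valid i (q , ρ) = i ≡ ρ + q * suc w × ρ ≤ w

    next-valid : ∀ i p → Valid i p → Valid (suc i) (next p)
    next-valid i (q , ρ) (eq , ρ≤w) with ρ <? w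
    ... | yes ρ<w = cong suc eq , ρ<w
    ... | no  ρ≮w = trans (cong suc eq) (cong (λ k → suc k + q * suc w) (ℕ.≤-antisym ρ≤w (ℕ.≮⇒≥ ρ≮w))) , z≤n

    pos-valid : ∀ i → Valid i (pos i)
    pos-valid zero    = refl , z≤n
    pos-valid (suc i) = next-valid i (pos i) (pos-valid i)

    next-slow : ∀ p → proj₁ (next p) ≡ proj₁ p ⊎ proj₁ (next p) ≡ suc (proj₁ p)
    next-slow (q , ρ) with ρ <? w
    ... | yes _ = inj₁ refl
    ... | no  _ = inj₂ refl

    stretch : Stretch
    stretch = record
      { quot = proj₁ ∘ pos ; factor = suc w ; factor>0 = s≤s z≤n ; slow = next-slow ∘ pos
      ; lower = λ i → let eq , _ = pos-valid i in
          ℕ.≤-trans (ℕ.m≤n+m _ (proj₂ (pos i))) (ℕ.≤-reflexive (sym eq))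
      ; upper = λ i → let eq , ρ≤w = pos-valid i in
          s≤s (ℕ.≤-trans (ℕ.≤-reflexive eq) (ℕ.+-monoˡ-≤ _ ρ≤w))
      }

    pos-* : ∀ q → pos (q * suc w) ≡ (q , 0)
    pos-* q with pos (q * suc w) | pos-valid (q * suc w) | quot-* stretch q
    ... | .q , ρ | eq , _ | refl = cong (q ,_) (ℕ.+-cancelʳ-≡ (q * suc w) ρ 0 (sym eq))

  module Rows (P : Poset 0ℓ 0ℓ 0ℓ) where
    private module P = Poset P
    open P using (Carrier) renaming (_≤_ to _⊑_)

    infix 4 _~_
    _~_ : Carrier → Carrier → Set
    x ~ y = x ⊑ y ⊎ y ⊑ x

    ~-refl : ∀ {x} → x ~ x
    ~-refl = inj₁ P.refl

    Row : Set
    Row = ℕ → Carrier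

    -- Neighbours of the grid with rows R and S: vertical and diagonal ones.
    Adj : Row → Row → Set
    Adj R S = ∀ i → R i ~ S i × R i ~ S (suc i) × R (suc i) ~ S i

    path⇒Adj : (R : Row) → (∀ i → R i ~ R (suc i)) → Adj R R
    path⇒Adj R h i = ~-refl , h i , swap (h i)

    -- F marks the columns that have to stay below z.
    record IsRow (F : ℕ → Set) (z : Carrier) (R : Row) : Set where
      constructor isRow
      field
        path : ∀ i → R i ~ R (suc i)
        base : ∀ i → F i → R i ⊑ z

    infixr 5 _∷ʰ_
    data Homotopy (F : ℕ → Set) (z : Carrier) : Row → Row → Set where
      [_]ʰ : ∀ {R} → IsRow F z R → Homotopy F z R R
      _∷ʰ_ : ∀ {R S T} → IsRow F z R × Adj R S → Homotopy F z S T → Homotopy F z R T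

    _++ʰ_ : ∀ {F z R S T} → Homotopy F z R S → Homotopy F z S T → Homotopy F z R T
    [ _ ]ʰ  ++ʰ k = k
    (p ∷ʰ h) ++ʰ k = p ∷ʰ (h ++ʰ k)

    lastRow : ∀ {F z R S} → Homotopy F z R S → IsRow F z S
    lastRow [ p ]ʰ   = p
    lastRow (_ ∷ʰ h) = lastRow h

    remark : ∀ {F F′ z R S} → (∀ i → F′ i → F i) → Homotopy F z R S → Homotopy F′ z R S
    remark f [ isRow p b ]ʰ        = [ isRow p (λ i → b i ∘ f i) ]ʰ
    remark f ((isRow p b , a) ∷ʰ h) = (isRow p (λ i → b i ∘ f i) , a) ∷ʰ remark f h

    module _ {F F′ : ℕ → Set} {z : Carrier} (g : Stretch) (hyp : ∀ i → F′ i → F (quot g i)) where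
      pull-path : ∀ {R S} → Adj R S → Adj (R ∘ quot g) (S ∘ quot g)
      pull-path {R} {S} a i with quot g (suc i) | slow g i
      ... | _ | inj₁ refl = proj₁ (a _) , proj₁ (a _) , proj₁ (a _)
      ... | _ | inj₂ refl = a (quot g i)

      pull-row : ∀ {R} → IsRow F z R → IsRow F′ z (R ∘ quot g)
      pull-row {R} (isRow p b) = isRow (λ i → proj₁ (proj₂ (pull-path (path⇒Adj R p) i))) (λ i → b _ ∘ hyp i)

      pull : ∀ {R S} → Homotopy F z R S → Homotopy F′ z (R ∘ quot g) (S ∘ quot g)
      pull [ p ]ʰ        = [ pull-row p ]ʰ
      pull ((p , a) ∷ʰ h) = (pull-row p , pull-path a) ∷ʰ pull h

    -- The place of a distinguished column after stretching by `m`; of its `m` copies only the first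
    -- stays distinguished.
    Marked : (ℕ → Set) → ℕ → ℕ → Set
    Marked G m i = ∃[ q ] (G q × i ≡ q * m)

    -- The ends of a loop are not held fixed. The columns marked by `G` only have to stay below `z`,
    -- which leaves the freedom to exchange bases there too.
    record Contraction (c : Row) (G : ℕ → Set) (z : Carrier) : Set where
      field
        stretch  : Stretch
        homotopy : Homotopy (Marked G (factor stretch)) z (c ∘ quot stretch) (λ _ → z)

    -- `h` is stretched to the width that contracting `c′` requires. First copies of first copies
    -- are first copies in the composite stretch, so the marks match.
    extend : ∀ {c c′ : Row} {G z} (g : Stretch) → Homotopy (Marked G (factor g)) z (c ∘ quot g) c′ →
      Contraction c′ (Marked G (factor g)) z → Contraction c G z
    extend {G = G} g h rest = record
      { stretch  = g ∘ˢ stretch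
      ; homotopy = pull stretch outer h ++ʰ remark inner homotopy
      }
      where
      open Contraction rest
      m = factor g
      m′ = factor stretch
      inner : ∀ i → Marked G (m * m′) i → Marked (Marked G m) m′ i
      inner i (q , gq , refl) = q * m , (q , gq , refl) , sym (ℕ.*-assoc q m m′)
      outer : ∀ i → Marked G (m * m′) i → Marked G m (quot stretch i)
      outer i (q , gq , refl) = q , gq ,
        trans (cong (quot stretch) (sym (ℕ.*-assoc q m m′))) (quot-* stretch (q * m))

    height : ∀ {F z R S} → Homotopy F z R S → ℕ
    height [ _ ]ʰ   = 0
    height (_ ∷ʰ h) = suc (height h)

    grid : ∀ {F z R S} → Homotopy F z R S → ℕ → Row
    grid {R = R} [ _ ]ʰ   j       = R
    grid {R = R} (_ ∷ʰ h) zero    = R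
    grid         (_ ∷ʰ h) (suc j) = grid h j

    grid-row : ∀ {F z R S} (h : Homotopy F z R S) j → IsRow F z (grid h j)
    grid-row [ p ]ʰ   j       = p
    grid-row (p ∷ʰ h) zero    = proj₁ p
    grid-row (p ∷ʰ h) (suc j) = grid-row h j

    grid-first : ∀ {F z R S} (h : Homotopy F z R S) → grid h 0 ≡ R
    grid-first [ p ]ʰ   = refl
    grid-first (p ∷ʰ h) = refl

    grid-last : ∀ {F z R S} (h : Homotopy F z R S) → grid h (height h) ≡ S
    grid-last [ p ]ʰ   = refl
    grid-last (p ∷ʰ h) = grid-last h

    grid-Adj : ∀ {F z R S} (h : Homotopy F z R S) j → Adj (grid h j) (grid h (suc j))
    grid-Adj [ p ]ʰ j = path⇒Adj _ (IsRow.path p)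
    grid-Adj (p ∷ʰ h) zero i rewrite grid-first h = proj₂ p i
    grid-Adj (p ∷ʰ h) (suc j) = grid-Adj h j

    module BlockRows (w : ℕ) (V : Row) (G : ℕ → Set) (z : Carrier) where
      open Block w

      blockRow : (ℕ → Row) → Row
      blockRow f i = f (proj₁ (pos i)) (proj₂ (pos i))

      -- The neighbour relations of `Adj`, sorted into those inside a block and those from its last
      -- position `w` to the start of the next block.
      record BlockAdj (f g : ℕ → Row) : Set where
        field
          same   : ∀ q ρ → f q ρ ~ g q ρ
          fwd    : ∀ q ρ → f q ρ ~ g q (suc ρ)
          bwd    : ∀ q ρ → f q (suc ρ) ~ g q ρ
          cross⁺ : ∀ q → f q w ~ g (suc q) 0
          cross⁻ : ∀ q → f (suc q) 0 ~ g q w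

      blockAdj : ∀ f g → BlockAdj f g → Adj (blockRow f) (blockRow g)
      blockAdj f g a i with pos i | pos-valid i
      ... | q , ρ | _ , ρ≤w with ρ <? w
      ...   | yes _ = same q ρ , fwd q ρ , bwd q ρ
        where open BlockAdj a
      ...   | no ρ≮w with refl ← ℕ.≤-antisym ρ≤w (ℕ.≮⇒≥ ρ≮w) = same q ρ , cross⁺ q , cross⁻ q
        where open BlockAdj a

      Mk : ℕ → Set
      Mk = Marked G (suc w)

      blockIsRow : ∀ f → BlockAdj f f → (∀ q → G q → f q 0 ⊑ z) → IsRow Mk z (blockRow f)
      blockIsRow f a b = isRow (λ i → proj₁ (proj₂ (blockAdj f f a i)))
        λ { i (q , gq , refl) → subst (λ p → f (proj₁ p) (proj₂ p) ⊑ z) (sym (pos-* q)) (b q gq) }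

      lead : Row → ℕ → Row
      lead a q zero    = a q
      lead a q (suc ρ) = V q

    -- A path c whose consecutive members lie below V is replaced, block by
    -- block, by the paths d q 0 , … , d q (w + 2) = d (q + 1) 0 below V q.
    module Subdivide
      (w : ℕ) (c ĉ V : Row) (d : ℕ → Row) (G : ℕ → Set) (z : Carrier)
      (c-path : ∀ q → c q ~ c (suc q))
      (c⊑ĉ : ∀ q → c q ⊑ ĉ q) (ĉ⊑V : ∀ q → ĉ q ⊑ V q) (ĉ⊑V′ : ∀ q → ĉ (suc q) ⊑ V q)
      (d⊑ĉ : ∀ q → d q 0 ⊑ ĉ q) (d⊑V : ∀ q ρ → d q ρ ⊑ V q)
      (d-path : ∀ q ρ → d q ρ ~ d q (suc ρ))
      (d-end : ∀ q → d q (suc w) ~ d (suc q) 0)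
      (ĉ-base : ∀ q → G q → ĉ q ⊑ z)
      where

      open BlockRows (suc w) V G z public

      leadAdj : ∀ a b → (∀ q → a q ⊑ V q) → (∀ q → b q ⊑ V q) → (∀ q → a (suc q) ⊑ V q) →
        (∀ q → b (suc q) ⊑ V q) → (∀ q → a q ~ b q) → BlockAdj (lead a) (lead b)
      leadAdj a b a⊑ b⊑ a⊑′ b⊑′ ab = record
        { same   = λ { q zero → ab q ; q (suc ρ) → ~-refl }
        ; fwd    = λ { q zero → inj₁ (a⊑ q) ; q (suc ρ) → ~-refl }
        ; bwd    = λ { q zero → inj₂ (b⊑ q) ; q (suc ρ) → ~-refl }
        ; cross⁺ = λ q → inj₂ (b⊑′ q)
        ; cross⁻ = λ q → inj₁ (a⊑′ q)
        }

      c⊑V = λ q → P.trans (c⊑ĉ q) (ĉ⊑V q)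
      c⊑V′ = λ q → P.trans (c⊑ĉ (suc q)) (ĉ⊑V′ q)
      d⊑V′ = λ q → P.trans (d⊑ĉ (suc q)) (ĉ⊑V′ q)
      c-base = λ q gq → P.trans (c⊑ĉ q) (ĉ-base q gq)
      d-base = λ q gq → P.trans (d⊑ĉ q) (ĉ-base q gq)

      -- `c q` and `d q 0` need not be comparable, but `ĉ q` lies above both. Once the interior of
      -- block `q` is raised to `V q`, its first position can move from `c` through `ĉ` to `d`,
      -- always below the neighbouring `V`; then the interior descends to `d`. The marked columns
      -- are first positions of blocks and stay below `ĉ`, hence below `z`.
      subdivision : Homotopy Mk z (blockRow (λ q _ → c q)) (blockRow d)
      subdivision =
           ( blockIsRow (λ q _ → c q) (record
               { same = λ _ _ → ~-refl ; fwd = λ _ _ → ~-refl ; bwd = λ _ _ → ~-refl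
               ; cross⁺ = c-path ; cross⁻ = swap ∘ c-path }) c-base
           , blockAdj (λ q _ → c q) (lead c) (record
               { same   = λ { q zero → ~-refl ; q (suc ρ) → inj₁ (c⊑V q) }
               ; fwd    = λ q ρ → inj₁ (c⊑V q)
               ; bwd    = λ { q zero → ~-refl ; q (suc ρ) → inj₁ (c⊑V q) }
               ; cross⁺ = c-path
               ; cross⁻ = λ q → inj₁ (c⊑V′ q) }))
        ∷ʰ ( blockIsRow (lead c) (leadAdj c c c⊑V c⊑V c⊑V′ c⊑V′ (λ _ → ~-refl)) c-base
           , blockAdj (lead c) (lead ĉ) (leadAdj c ĉ c⊑V ĉ⊑V c⊑V′ ĉ⊑V′ (inj₁ ∘ c⊑ĉ)))
        ∷ʰ ( blockIsRow (lead ĉ) (leadAdj ĉ ĉ ĉ⊑V ĉ⊑V ĉ⊑V′ ĉ⊑V′ (λ _ → ~-refl)) ĉ-base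
           , blockAdj (lead ĉ) (lead d₀) (leadAdj ĉ d₀ ĉ⊑V d₀⊑V ĉ⊑V′ d⊑V′ (inj₂ ∘ d⊑ĉ)))
        ∷ʰ ( blockIsRow (lead d₀) (leadAdj d₀ d₀ d₀⊑V d₀⊑V d⊑V′ d⊑V′ (λ _ → ~-refl)) d-base
           , blockAdj (lead d₀) d (record
               { same   = λ { q zero → ~-refl ; q (suc ρ) → inj₂ (d⊑V q (suc ρ)) }
               ; fwd    = λ { q zero → d-path q 0 ; q (suc ρ) → inj₂ (d⊑V q (suc (suc ρ))) }
               ; bwd    = λ q ρ → inj₂ (d⊑V q ρ)
               ; cross⁺ = λ q → inj₂ (d⊑V′ q)
               ; cross⁻ = λ q → swap (d-end q) }))
        ∷ʰ [ blockIsRow d (record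
               { same = λ _ _ → ~-refl ; fwd = d-path ; bwd = λ q ρ → swap (d-path q ρ)
               ; cross⁺ = d-end ; cross⁻ = swap ∘ d-end }) d-base ]ʰ
        where
        d₀ : Row
        d₀ q = d q 0
        d₀⊑V : ∀ q → d₀ q ⊑ V q
        d₀⊑V q = d⊑V q 0

-- Contracting sequences of regular sets by pushing in a fixed basis.

module BasisExchange where
  open import Defs
  open import Data.Empty using (⊥; ⊥-elim)
  open import Data.Fin as Fin using (Fin)
  import Data.Fin.Properties as Fin
  open import Data.List as List using (List; []; _++_; length)
  import Data.List.Properties as List
  open import Data.List.Membership.Propositional using (_∈_)
  open import Data.List.Membership.Propositional.Properties
  open import Data.List.Relation.Unary.All as All using (All; [])
  import Data.List.Relation.Unary.All.Properties as All
  open import Data.Nat using (ℕ; zero; suc; _≤_; z≤n; _+_; _*_)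
  import Data.Nat.Properties as ℕ
  open import Data.Product using (∃; ∃-syntax; _×_; _,_; proj₁; proj₂)
  open import Data.Sum using (_⊎_; inj₁; inj₂; [_,_]′)
  open import Function using (_∘_; id)
  open import Relation.Binary.PropositionalEquality
  open LinearAlgebra
  open Regularity
  open GridHomotopy

  module Contract {r : ℕ} where
    open Rows (IR r)
    open Frame
    open Stretch

    -- Between rounds every set has at most one extra vector; a second one appears only while the
    -- next vector is being pushed in.
    record Sized (b : ℕ) : Set where
      field
        item   : Item r
        short  : length (Item.extras item) ≤ b
        nzero  : All (_∈ₛ nonzero) (Item.extras item)

    open Sized

    El : (c : Sized 2) → RegularSubset r
    El c = regularSubset (item c) (short c) (nzero c)

    weaken : Sized 1 → Sized 2
    weaken c = record { item = item c ; short = ℕ.m≤n⇒m≤1+n (short c) ; nzero = nzero c }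

    El₁ : Sized 1 → RegularSubset r
    El₁ = El ∘ weaken

    infix 4 _⊑_
    _⊑_ : RegularSubset r → RegularSubset r → Set
    X ⊑ Y = set X ⊆ₛ set Y

    _∈ᶠ_ : 𝔽₂^ r → Frame r → Set
    v ∈ᶠ β = ∃[ i ] vec β i ≡ v

    El-⊑ : ∀ c {Y} → (∀ {v} → v ∈ᶠ Item.frame (item c) → v ∈ₛ set Y) →
      (∀ {v} → v ∈ Item.extras (item c) → v ∈ₛ set Y) → El c ⊑ Y
    El-⊑ c f g v v∈ with ∈-++⁻ (frameList (Item.frame (item c))) (∈-regularSubset⁻ (item c) (short c) (nzero c) v∈)
    ... | inj₂ q = g q
    ... | inj₁ q with i , refl ← ∈-tabulate⁻ q = f (i , refl)

    frame-∈ : ∀ c {v} → v ∈ᶠ Item.frame (item c) → v ∈ₛ set (El c)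
    frame-∈ c (i , refl) = ∈-regularSubset⁺ (item c) (short c) (nzero c) (∈-++⁺ˡ (∈-tabulate⁺ i))

    extra-∈ : ∀ c {v} → v ∈ Item.extras (item c) → v ∈ₛ set (El c)
    extra-∈ c p = ∈-regularSubset⁺ (item c) (short c) (nzero c) (∈-++⁺ʳ (frameList (Item.frame (item c))) p)

    bare : Frame r → Sized 1
    bare β = record { item = β ⟨ [] ⟩ ; short = z≤n ; nzero = [] }

    bare-⊑ : ∀ β {Y} → (∀ {v} → v ∈ᶠ β → v ∈ₛ set Y) → El₁ (bare β) ⊑ Y
    bare-⊑ β {Y} f = El-⊑ (weaken (bare β)) {Y} f λ ()

    addedAt : ℕ → Frame r → List (𝔽₂^ r)
    addedAt K β′ = added β′ (K ℕ.<? r)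

    exchangeAt : ∀ K (β β′ : Frame r) → Agree K β β′ → Exchange K β β′ (addedAt K β′)
    exchangeAt K β β′ a = exchange K β β′ a (K ℕ.<? r)

    added-∈ : ∀ K (β′ : Frame r) {v} → v ∈ addedAt K β′ → v ∈ᶠ β′
    added-∈ K β′ = added⊆ β′ (K ℕ.<? r)

    added-nonzero : ∀ K (β′ : Frame r) → All (_∈ₛ nonzero) (addedAt K β′)
    added-nonzero K β′ = All.tabulate λ p →
      let i , eq = added-∈ K β′ p in subst (_∈ₛ nonzero) eq (frame-nonzero β′ i)

    frame-⊆ : ∀ {K es} {β β′ : Frame r} (ex : Exchange K β β′ es) {v} → v ∈ᶠ Exchange.frame ex →
      v ∈ es ⊎ v ∈ᶠ β
    frame-⊆ ex (i , refl) with Exchange.frame⊆ ex i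
    ... | inj₁ p       = inj₁ p
    ... | inj₂ (j , eq) = inj₂ (j , eq)

    -- Even members are bases. Odd members add the vector about to enter, and so contain both
    -- neighbouring bases.
    walk : ∀ K (β β′ : Frame r) → Agree K β β′ → ℕ → Sized 1
    walk K β β′ a zero          = bare β
    walk K β β′ a (suc zero)    = record
      { item = β ⟨ addedAt K β′ ⟩ ; short = added-short β′ (K ℕ.<? r) ; nzero = added-nonzero K β′ }
    walk K β β′ a (suc (suc n)) = walk (suc K) (Exchange.frame ex) β′ (Exchange.agree ex) n
      where ex = exchangeAt K β β′ a

    walk-⊑ : ∀ K β β′ a n {Y} → (∀ {v} → v ∈ᶠ β → v ∈ₛ set Y) → (∀ {v} → v ∈ᶠ β′ → v ∈ₛ set Y) →
      El₁ (walk K β β′ a n) ⊑ Y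
    walk-⊑ K β β′ a zero {Y} f g = bare-⊑ β {Y} f
    walk-⊑ K β β′ a (suc zero) {Y} f g = El-⊑ (weaken (walk K β β′ a 1)) {Y} f (g ∘ added-∈ K β′)
    walk-⊑ K β β′ a (suc (suc n)) {Y} f g = walk-⊑ (suc K) (Exchange.frame ex) β′ (Exchange.agree ex) n {Y}
      (λ p → [ g ∘ added-∈ K β′ , f ]′ (frame-⊆ ex p)) g
      where ex = exchangeAt K β β′ a

    walk-path : ∀ K β β′ a n → El₁ (walk K β β′ a n) ~ El₁ (walk K β β′ a (suc n))
    walk-path K β β′ a zero = inj₁ (bare-⊑ β {El₁ (walk K β β′ a 1)} (frame-∈ (weaken (walk K β β′ a 1))))
    walk-path K β β′ a (suc zero) = inj₂ (bare-⊑ (Exchange.frame ex) {El₁ (walk K β β′ a 1)}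
      λ p → [ extra-∈ (weaken (walk K β β′ a 1)) , frame-∈ (weaken (walk K β β′ a 1)) ]′ (frame-⊆ ex p))
      where ex = exchangeAt K β β′ a
    walk-path K β β′ a (suc (suc n)) = walk-path (suc K) (Exchange.frame ex) β′ (Exchange.agree ex) n
      where ex = exchangeAt K β β′ a

    agree-trans : ∀ {K L} {β β′ β″ : Frame r} → K ≤ L → Agree L β β′ → Agree K β′ β″ → Agree K β β″
    agree-trans K≤L a b i i<K = trans (a i (ℕ.<-≤-trans i<K K≤L)) (b i i<K)

    -- Exchanges starting at `K` leave the first `K` positions alone, so a walk does not undo the
    -- pushes of earlier rounds.
    walk-agree : ∀ K β β′ a n {k β₀} → k ≤ K → Agree k β′ β₀ → Agree k (Item.frame (item (walk K β β′ a n))) β₀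
    walk-agree K β β′ a zero {β₀ = β₀} k≤K b = agree-trans {β = β} {β′} {β₀} k≤K a b
    walk-agree K β β′ a (suc zero) {β₀ = β₀} k≤K b = agree-trans {β = β} {β′} {β₀} k≤K a b
    walk-agree K β β′ a (suc (suc n)) {k} {β₀} k≤K b =
      walk-agree (suc K) _ β′ (Exchange.agree (exchangeAt K β β′ a)) n {k} {β₀} (ℕ.m≤n⇒m≤1+n k≤K) b

    -- A finished walk reaches `β′` only entrywise, as frames contain functions and proofs.
    -- Entrywise agreement suffices for inclusion both ways between the sets.
    Same : Sized 1 → Frame r → Set
    Same c β = Item.extras (item c) ≡ [] × (∀ i → vec (Item.frame (item c)) i ≡ vec β i)

    walk-end : ∀ K β β′ a n → r ≤ n + K → Same (walk K β β′ a (n * 2)) β′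
    walk-end K β β′ a zero r≤ = refl , λ i → a i (ℕ.<-≤-trans (Fin.toℕ<n i) r≤)
    walk-end K β β′ a (suc n) r≤ = walk-end (suc K) _ β′ (Exchange.agree (exchangeAt K β β′ a)) n
      (ℕ.≤-trans r≤ (ℕ.≤-reflexive (sym (ℕ.+-suc n K))))

    Same-⊑ : ∀ {c β} → Same c β → El₁ c ⊑ El₁ (bare β)
    Same-⊑ {c} {β} (eq , eqs) = El-⊑ (weaken c) {El₁ (bare β)}
      (λ { (i , refl) → frame-∈ (weaken (bare β)) (i , sym (eqs i)) })
      (λ p → ⊥-elim (absurd (subst (_ ∈_) eq p)))
      where
      absurd : ∀ {v : 𝔽₂^ r} → v ∈ [] → ⊥
      absurd ()

    ⊑-Same : ∀ {c β} → Same c β → El₁ (bare β) ⊑ El₁ c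
    ⊑-Same {c} {β} (_ , eqs) = bare-⊑ β {El₁ c} λ { (i , refl) → frame-∈ (weaken c) (i , eqs i) }

    -- A block has `r * 2 + 2` positions, so its last member is odd. The next member of the walk
    -- would be the basis after `r + 1` exchanges, already `β′` entrywise, and the next block starts
    -- with `β′` itself.
    walk-last : ∀ K β β′ a → El₁ (walk K β β′ a (suc (r * 2))) ~ El₁ (bare β′)
    walk-last K β β′ a with walk-path K β β′ a (suc (r * 2))
                          | walk-end K β β′ a (suc r) (ℕ.≤-trans (ℕ.n≤1+n r) (ℕ.m≤m+n (suc r) K))
    ... | inj₁ p | s = inj₁ (λ v → Same-⊑ {last} {β′} s v ∘ p v)
      where last = walk K β β′ a (suc r * 2)
    ... | inj₂ p | s = inj₂ (λ v → p v ∘ ⊑-Same {last} {β′} s v)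
      where last = walk K β β′ a (suc r * 2)

    module _ (z : RegularSubset r) where
      β₀ : Frame r
      β₀ = basisFrame z

      β₀⊆z : ∀ {v} → v ∈ᶠ β₀ → v ∈ₛ set z
      β₀⊆z (i , refl) = basisFrame⊆ z i

      AgreeItem : ℕ → Sized 1 → Set
      AgreeItem k c = Agree k (Item.frame (item c)) β₀

      -- One round of replacement. It is used with `K = 0` to pass from the given elements to bases
      -- inside them, and with `K = k + 1` to connect the bases after the vector at position `k` has
      -- been pushed in.
      module Walks (K : ℕ) (c ĉ V : ℕ → RegularSubset r) (β : ℕ → Frame r)
        (agree-β : ∀ q → Agree K (β q) (β (suc q))) (c-path : ∀ q → c q ~ c (suc q))
        (c⊑ĉ : ∀ q → c q ⊑ ĉ q) (ĉ⊑V : ∀ q → ĉ q ⊑ V q) (ĉ⊑V′ : ∀ q → ĉ (suc q) ⊑ V q)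
        (β⊆ĉ : ∀ q {v} → v ∈ᶠ β q → v ∈ₛ set (ĉ q))
        (G : ℕ → Set) (ĉ-base : ∀ q → G q → ĉ q ⊑ z)
        (β-agree : ∀ q → Agree K (β q) β₀)
        where

        d : ℕ → ℕ → Sized 1
        d q = walk K (β q) (β (suc q)) (agree-β q)

        open Subdivide (r * 2) c ĉ V (λ q ρ → El₁ (d q ρ)) G z c-path c⊑ĉ ĉ⊑V ĉ⊑V′
          (λ q → bare-⊑ (β q) {ĉ q} (β⊆ĉ q))
          (λ q ρ → walk-⊑ K (β q) (β (suc q)) (agree-β q) ρ {V q} (ĉ⊑V q _ ∘ β⊆ĉ q) (ĉ⊑V′ q _ ∘ β⊆ĉ (suc q)))
          (λ q → walk-path K (β q) (β (suc q)) (agree-β q))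
          (λ q → walk-last K (β q) (β (suc q)) (agree-β q))
          ĉ-base
        open Block (suc (r * 2))

        c′ : ℕ → Sized 1
        c′ i = d (proj₁ (pos i)) (proj₂ (pos i))

        c′-agree : ∀ i → AgreeItem K (c′ i)
        c′-agree i = walk-agree K (β q) (β (suc q)) (agree-β q) (proj₂ (pos i)) {K} {β₀} ℕ.≤-refl (β-agree (suc q))
          where q = proj₁ (pos i)

        contract-via : (Contraction (El₁ ∘ c′) (Marked G (factor stretch)) z) → Contraction c G z
        contract-via = extend stretch subdivision

        c′-path = IsRow.path (lastRow subdivision)
        c′-base = IsRow.base (lastRow subdivision)

      -- The first k vectors of β₀ have already been pushed into all bases.
      contract : ∀ n k → r ≤ n + k → (c : ℕ → Sized 1) → (∀ q → AgreeItem k (c q)) →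
        (∀ q → El₁ (c q) ~ El₁ (c (suc q))) → (G : ℕ → Set) → (∀ q → G q → El₁ (c q) ⊑ z) →
        Contraction (El₁ ∘ c) G z
      contract zero k r≤ c agr c-path G c-base = record
        { stretch  = idˢ
        -- Every `c q` now contains all of `β₀`, and so does `z`: the row descends to the constant
        -- row `β₀` and then ascends to `z`.
        ; homotopy =
            (isRow c-path (λ { i (q , g , refl) → subst (λ j → El₁ (c j) ⊑ z) (sym (ℕ.*-identityʳ q)) (c-base q g) })
              , λ i → inj₂ (top i) , inj₂ (top i) , inj₂ (top (suc i)))
          ∷ʰ (constant (El₁ (bare β₀)) bare⊑z , to-z)
          ∷ʰ [ constant z (λ _ p → p) ]ʰ
        }
        where
        constant : ∀ X → X ⊑ z → IsRow (Marked G 1) z (λ _ → X)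
        constant X X⊑z = isRow (λ _ → ~-refl {X}) (λ _ _ → X⊑z)
        bare⊑z : El₁ (bare β₀) ⊑ z
        bare⊑z = bare-⊑ β₀ {z} β₀⊆z
        to-z : Adj (λ _ → El₁ (bare β₀)) (λ _ → z)
        to-z _ = inj₁ bare⊑z , inj₁ bare⊑z , inj₁ bare⊑z
        top : ∀ q → El₁ (bare β₀) ⊑ El₁ (c q)
        top q = bare-⊑ β₀ {El₁ (c q)} λ { (i , refl) →
          frame-∈ (weaken (c q)) (i , agr q i (ℕ.<-≤-trans (Fin.toℕ<n i) r≤)) }
      contract (suc n) k r≤ c agr c-path G c-base =
        contract-via (contract n (suc k) (ℕ.≤-trans r≤ (ℕ.≤-reflexive (sym (ℕ.+-suc n k)))) c′ c′-agree c′-path _ c′-base)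
        where
        es : List (𝔽₂^ r)
        es = addedAt k β₀

        ex : ∀ q → Exchange k (Item.frame (item (c q))) β₀ es
        ex q = exchangeAt k _ β₀ (agr q)

        -- One old extra and one pushed vector exhaust the bound 2. This set contains the old basis
        -- as well as the new basis `β q`.
        ĉˢ : ℕ → Sized 2
        ĉˢ q = record
          { item  = Item.frame (item (c q)) ⟨ es ++ Item.extras (item (c q)) ⟩
          ; short = ℕ.≤-trans (ℕ.≤-reflexive (List.length-++ es))
                      (ℕ.+-mono-≤ (added-short β₀ (k ℕ.<? r)) (short (c q)))
          ; nzero = All.++⁺ (added-nonzero k β₀) (nzero (c q))
          }

        ĉ : ℕ → RegularSubset r
        ĉ = El ∘ ĉˢ

        es∈ĉ : ∀ q {v} → v ∈ es → v ∈ₛ set (ĉ q)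
        es∈ĉ q p = extra-∈ (ĉˢ q) (∈-++⁺ˡ p)

        c⊑ĉ : ∀ q → El₁ (c q) ⊑ ĉ q
        c⊑ĉ q = El-⊑ (weaken (c q)) {ĉ q} (frame-∈ (ĉˢ q)) (λ p → extra-∈ (ĉˢ q) (∈-++⁺ʳ es p))

        ĉ-⊑ : ∀ q {Y} → El₁ (c q) ⊑ Y → (∀ {v} → v ∈ es → v ∈ₛ set Y) → ĉ q ⊑ Y
        ĉ-⊑ q {Y} le f = El-⊑ (ĉˢ q) {Y} (λ p → le _ (frame-∈ (weaken (c q)) p))
          (λ p → [ f , (λ p′ → le _ (extra-∈ (weaken (c q)) p′)) ]′ (∈-++⁻ es p))

        β : ℕ → Frame r
        β q = Exchange.frame (ex q)

        β⊆ĉ : ∀ q {v} → v ∈ᶠ β q → v ∈ₛ set (ĉ q)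
        β⊆ĉ q p = [ es∈ĉ q , frame-∈ (ĉˢ q) ]′ (frame-⊆ (ex q) p)

        -- The same vector is pushed into both neighbours, so the larger neighbour stays the larger
        -- one and can serve as the common upper bound.
        V-data : ∀ q → ∃[ V ] (ĉ q ⊑ V × ĉ (suc q) ⊑ V)
        V-data q with c-path q
        ... | inj₁ le = ĉ (suc q) , ĉ-⊑ q {ĉ (suc q)} (λ v → c⊑ĉ (suc q) v ∘ le v) (es∈ĉ (suc q)) , (λ _ → id)
        ... | inj₂ ge = ĉ q , (λ _ → id) , ĉ-⊑ (suc q) {ĉ q} (λ v → c⊑ĉ q v ∘ ge v) (es∈ĉ q)

        V : ℕ → RegularSubset r
        V = proj₁ ∘ V-data

        agree-β : ∀ q → Agree (suc k) (β q) (β (suc q))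
        agree-β q i i< = trans (Exchange.agree (ex q) i i<) (sym (Exchange.agree (ex (suc q)) i i<))

        -- Here it matters that `β₀` was chosen inside `z`: the pushed vector belongs to `z` as
        -- well.
        ĉ-base : ∀ q → G q → ĉ q ⊑ z
        ĉ-base q g = ĉ-⊑ q {z} (c-base q g) (β₀⊆z ∘ added-∈ k β₀)

        open Walks (suc k) (El₁ ∘ c) ĉ V β agree-β c-path c⊑ĉ (proj₁ ∘ proj₂ ∘ V-data) (proj₂ ∘ proj₂ ∘ V-data)
          β⊆ĉ G ĉ-base (Exchange.agree ∘ ex)

      -- The initial round takes `ĉ = x`, since each `x q` contains its own chosen basis. The larger
      -- of two neighbours contains the whole walk between their bases.
      contraction : (x : ℕ → RegularSubset r) → (∀ q → x q ~ x (suc q)) → Contraction x (λ q → x q ≡ z) z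
      contraction x x-path = contract-via (contract r 0 (ℕ.m≤m+n r 0) c′ c′-agree c′-path _ c′-base)
        where
        V-data : ∀ q → ∃[ V ] (x q ⊑ V × x (suc q) ⊑ V)
        V-data q with x-path q
        ... | inj₁ le = x (suc q) , le , (λ _ → id)
        ... | inj₂ ge = x q , (λ _ → id) , ge

        basis⊆ : ∀ q {v} → v ∈ᶠ basisFrame (x q) → v ∈ₛ set (x q)
        basis⊆ q (i , refl) = basisFrame⊆ (x q) i

        x-base : ∀ q → x q ≡ z → x q ⊑ z
        x-base q refl v = id

        open Walks 0 x x (proj₁ ∘ V-data) (basisFrame ∘ x) (λ q i ()) x-path (λ q v → id)
          (proj₁ ∘ proj₂ ∘ V-data) (proj₂ ∘ proj₂ ∘ V-data) basis⊆ (λ q → x q ≡ z) x-base (λ q i ())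

    connect : ∀ X Y → ∃[ n ] ∃ λ (via : ℕ → RegularSubset r) → ((∀ i → via i ~ via (suc i)) × via 0 ⊑ X × via n ⊑ Y)
    connect X Y = suc r * 2 , (λ i → El₁ (steps i)) , walk-path 0 β β′ (λ i ())
      , bare-⊑ β {X} (λ { (i , refl) → basisFrame⊆ X i })
      , (λ v → bare-⊑ β′ {Y} (λ { (i , refl) → basisFrame⊆ Y i }) v
          ∘ Same-⊑ {steps (suc r * 2)} {β′} (walk-end 0 β β′ (λ i ()) (suc r) (ℕ.≤-trans (ℕ.n≤1+n r) (ℕ.m≤m+n (suc r) 0))) v)
      where
      β β′ : Frame r
      β = basisFrame X
      β′ = basisFrame Y
      steps : ℕ → Sized 1
      steps = walk 0 β β′ (λ i ())

    standard : RegularSubset r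
    standard = El₁ (bare (standardFrame r))

-- Rational estimates for truncation and linear interpolation.

module Rationals where
  open import Data.Empty using (⊥)
  open import Data.Rational
  open import Data.Sum using (inj₁; inj₂)
  open import Data.Rational.Properties
  open import Data.Rational.Solver using (module +-*-Solver)
  open import Relation.Binary.PropositionalEquality hiding ([_])
  open +-*-Solver using (solve; _:+_; _:*_; _:-_; _:=_; con; :-_)

  <⇒≱ : ∀ {a b} → a < b → b ≤ a → ⊥
  <⇒≱ p q = <-irrefl refl (<-≤-trans p q)

  ≤⇒0≤ : ∀ {a b} → a ≤ b → 0ℚ ≤ b - a
  ≤⇒0≤ {a} {b} h = ≤-trans (≤-reflexive (sym (+-inverseʳ a))) (+-monoˡ-≤ (- a) h)

  0≤⇒≤ : ∀ {a b} → 0ℚ ≤ b - a → a ≤ b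
  0≤⇒≤ {a} {b} h = ≤-trans (≤-reflexive (sym (+-identityʳ a)))
    (≤-trans (+-monoʳ-≤ a h) (≤-reflexive (solve 2 (λ a b → a :+ (b :- a) := b) refl a b)))

  ≤-from : ∀ {a b d} → 0ℚ ≤ d → d ≡ b - a → a ≤ b
  ≤-from h refl = 0≤⇒≤ h

  0≤+ : ∀ {p q} → 0ℚ ≤ p → 0ℚ ≤ q → 0ℚ ≤ p + q
  0≤+ hp hq = +-mono-≤ hp hq

  0≤* : ∀ {p q} → 0ℚ ≤ p → 0ℚ ≤ q → 0ℚ ≤ p * q
  0≤* {p} {q} hp hq = ≤-trans (≤-reflexive (sym (*-zeroʳ p)))
    (*-monoˡ-≤-nonNeg p {{nonNegative hp}} hq)

  half-pos : ∀ {ε} → 0ℚ < ε → 0ℚ < ½ * ε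
  half-pos h = *-monoʳ-<-pos ½ h

  +-halves : ∀ ε → ½ * ε + ½ * ε ≡ ε
  +-halves = solve 1 (λ ε → con ½ :* ε :+ con ½ :* ε := ε) refl

  ⅓ : ℚ
  ⅓ = Data.Rational._/_ (ℤ.+ 1) 3
    where import Data.Integer as ℤ

  third-pos : ∀ {ε} → 0ℚ < ε → 0ℚ < ⅓ * ε
  third-pos h = *-monoʳ-<-pos ⅓ h

  +-thirds : ∀ ε → ⅓ * ε + ⅓ * ε + ⅓ * ε ≡ ε
  +-thirds = solve 1 (λ ε → con ⅓ :* ε :+ con ⅓ :* ε :+ con ⅓ :* ε := ε) refl

  -- The absolute value is split into two linear inequalities, so that an estimate reduces to a ring
  -- identity with nonnegative summands.
  record Close (e x y : ℚ) : Set where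
    constructor _,_
    field
      upper : x ≤ y + e
      lower : y ≤ x + e

  abs⇒close : ∀ {e x y} → ∣ x - y ∣ ≤ e → Close e x y
  abs⇒close {e} {x} {y} h =
      ≤-from (≤⇒0≤ (≤-trans (p≤∣p∣ (x - y)) h)) (solve 3 (λ e x y → e :- (x :- y) := (y :+ e) :- x) refl e x y)
    , ≤-from (≤⇒0≤ (≤-trans (-p≤∣p∣ (x - y)) h)) (solve 3 (λ e x y → e :- (:- (x :- y)) := (x :+ e) :- y) refl e x y)
    where
    p≤∣p∣ : ∀ p → p ≤ ∣ p ∣
    p≤∣p∣ p with ≤-total 0ℚ p
    ... | inj₁ 0≤p = ≤-reflexive (sym (0≤p⇒∣p∣≡p 0≤p))
    ... | inj₂ p≤0 = ≤-trans p≤0 (0≤∣p∣ p)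
    -p≤∣p∣ : ∀ p → - p ≤ ∣ p ∣
    -p≤∣p∣ p = ≤-trans (p≤∣p∣ (- p)) (≤-reflexive (∣-p∣≡∣p∣ p))

  close⇒abs : ∀ {e x y} → Close e x y → ∣ x - y ∣ ≤ e
  close⇒abs {e} {x} {y} (h , k) with ∣p∣≡p∨∣p∣≡-p (x - y)
  ... | inj₁ eq = ≤-trans (≤-reflexive eq)
    (≤-from (≤⇒0≤ h) (solve 3 (λ e x y → (y :+ e) :- x := e :- (x :- y)) refl e x y))
  ... | inj₂ eq = ≤-trans (≤-reflexive eq)
    (≤-from (≤⇒0≤ k) (solve 3 (λ e x y → (x :+ e) :- y := e :- (:- (x :- y))) refl e x y))

  close-sym : ∀ {e x y} → Close e x y → Close e y x
  close-sym (h , k) = k , h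

  ≤-+ : ∀ {x y e} → 0ℚ ≤ e → x ≤ y → x ≤ y + e
  ≤-+ {y = y} 0≤e h = ≤-trans h (≤-trans (≤-reflexive (sym (+-identityʳ y))) (+-monoʳ-≤ y 0≤e))

  ≤-shift : ∀ {x y z d e} → x ≤ y + d → y ≤ z + e → x ≤ z + (d + e)
  ≤-shift {x} {y} {z} {d} {e} h k = ≤-from (0≤+ (≤⇒0≤ h) (≤⇒0≤ k))
    (solve 5 (λ x y z d e → (y :+ d :- x) :+ (z :+ e :- y) := z :+ (d :+ e) :- x) refl x y z d e)

  ≤-minus : ∀ x y {e} → x ≤ y + e → x - e ≤ y
  ≤-minus x y {e} h = ≤-from (≤⇒0≤ h) (solve 3 (λ x y e → y :+ e :- x := y :- (x :- e)) refl x y e)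

  minus-≤ : ∀ x y {e} → x - e ≤ y → x ≤ y + e
  minus-≤ x y {e} h = ≤-from (≤⇒0≤ h) (solve 3 (λ x y e → y :- (x :- e) := y :+ e :- x) refl x y e)

  close-refl : ∀ {e x} → 0ℚ ≤ e → Close e x x
  close-refl 0≤e = ≤-+ 0≤e ≤-refl , ≤-+ 0≤e ≤-refl

  close-trans : ∀ {d e x y z} → Close d x y → Close e y z → Close (d + e) x z
  close-trans {d} {e} {x} {y} {z} (a , b) (a′ , b′) =
    ≤-shift {x} {y} {z} {d} {e} a a′ , ≤-trans (≤-shift {z} {y} {x} {e} {d} b′ b) (≤-reflexive (cong (x +_) (+-comm e d)))

  close-mono : ∀ {d e x y} → d ≤ e → Close d x y → Close e x y
  close-mono {x = x} {y} le (a , b) = ≤-trans a (+-monoʳ-≤ y le) , ≤-trans b (+-monoʳ-≤ x le)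

  close-+ : ∀ {d e x y x′ y′} → Close d x y → Close e x′ y′ → Close (d + e) (x + x′) (y + y′)
  close-+ {d} {e} {x} {y} {x′} {y′} (a , b) (a′ , b′) =
      ≤-trans (+-mono-≤ a a′) (≤-reflexive (rearrange y y′))
    , ≤-trans (+-mono-≤ b b′) (≤-reflexive (rearrange x x′))
    where
    rearrange : ∀ u v → (u + d) + (v + e) ≡ (u + v) + (d + e)
    rearrange u v = solve 4 (λ u v d e → (u :+ d) :+ (v :+ e) := (u :+ v) :+ (d :+ e)) refl u v d e

  0≤1 : 0ℚ ≤ 1ℚ
  0≤1 = nonNegative⁻¹ 1ℚ

  2ℚ : ℚ
  2ℚ = 1ℚ + 1ℚ

  -- Approximations to a real in the unit interval may leave it, but eventually by at most `½`. Two
  -- such numbers differ by at most 2, the constant in the Lipschitz bounds below.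
  record Bounded (a : ℚ) : Set where
    constructor _,_
    field
      below : 0ℚ ≤ a + ½
      above : a ≤ 1ℚ + ½

  -- clamp and mix are abstract, since unfolding them slows unification down considerably.
  abstract
    clamp : ℚ → ℚ
    clamp x = 0ℚ ⊔ (x ⊓ 1ℚ)

    clamp≥0 : ∀ x → 0ℚ ≤ clamp x
    clamp≥0 x = p≤p⊔q 0ℚ (x ⊓ 1ℚ)

    clamp≤1 : ∀ x → clamp x ≤ 1ℚ
    clamp≤1 x = ⊔-lub 0≤1 (p⊓q≤q x 1ℚ)

    clamp-≤ : ∀ {x e} → 0ℚ ≤ e → x ≤ e → clamp x ≤ e
    clamp-≤ {x} 0≤e h = ⊔-lub 0≤e (≤-trans (p⊓q≤p x 1ℚ) h)

    clamp-≥ : ∀ {x e} → e ≤ 1ℚ → e ≤ x → e ≤ clamp x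
    clamp-≥ {x} h k = ≤-trans (⊓-glb k h) (p≤q⊔p 0ℚ (x ⊓ 1ℚ))

    clamp-near-1 : ∀ {x e} → 0ℚ ≤ e → 1ℚ ≤ x + e → 1ℚ ≤ clamp x + e
    clamp-near-1 {x} {e} 0≤e h = minus-≤ 1ℚ (clamp x) (clamp-≥ {x} {1ℚ - e} (≤-minus 1ℚ 1ℚ {e} (≤-+ 0≤e ≤-refl)) (≤-minus 1ℚ x h))

    clamp-shift : ∀ {e x y} → 0ℚ ≤ e → x ≤ y + e → clamp x ≤ clamp y + e
    clamp-shift {e} {x} {y} 0≤e h = ⊔-lub (0≤+ (clamp≥0 y) 0≤e)
      (minus-≤ (x ⊓ 1ℚ) (clamp y) (≤-trans (⊓-glb (≤-minus (x ⊓ 1ℚ) y (≤-trans (p⊓q≤p x 1ℚ) h)) (≤-minus (x ⊓ 1ℚ) 1ℚ (≤-trans (p⊓q≤q x 1ℚ) (≤-+ 0≤e ≤-refl))))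
        (p≤q⊔p 0ℚ (y ⊓ 1ℚ))))

    close-clamp : ∀ {e x y} → 0ℚ ≤ e → Close e x y → Close e (clamp x) (clamp y)
    close-clamp {e} {x} {y} 0≤e (a , b) = clamp-shift {e} {x} {y} 0≤e a , clamp-shift {e} {y} {x} 0≤e b

    mix : ℚ → ℚ → ℚ → ℚ
    mix κ a b = a + κ * (b - a)

    mix-≥ : ∀ {κ} → 0ℚ ≤ κ → κ ≤ 1ℚ → ∀ {a b c} → c ≤ a → c ≤ b → c ≤ mix κ a b
    mix-≥ {κ} 0≤κ κ≤1 {a} {b} {c} h k = ≤-from (0≤+ (0≤* (≤⇒0≤ κ≤1) (≤⇒0≤ h)) (0≤* 0≤κ (≤⇒0≤ k)))
      (solve 4 (λ κ a b c → (con 1ℚ :- κ) :* (a :- c) :+ κ :* (b :- c) := (a :+ κ :* (b :- a)) :- c) refl κ a b c)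

    mix-≤ : ∀ {κ} → 0ℚ ≤ κ → κ ≤ 1ℚ → ∀ {a b c} → a ≤ c → b ≤ c → mix κ a b ≤ c
    mix-≤ {κ} 0≤κ κ≤1 {a} {b} {c} h k = ≤-from (0≤+ (0≤* (≤⇒0≤ κ≤1) (≤⇒0≤ h)) (0≤* 0≤κ (≤⇒0≤ k)))
      (solve 4 (λ κ a b c → (con 1ℚ :- κ) :* (c :- a) :+ κ :* (c :- b) := c :- (a :+ κ :* (b :- a))) refl κ a b c)

    -- Moving the two ends costs at most `e`. Moving `κ` to `κ′` changes the value by the product of
    -- `κ′ - κ` and `b′ - a′`, at most `2 * e` in size because the second factor lies between -2 and
    -- 2.
    mix-shift : ∀ {e κ κ′ a a′ b b′} → 0ℚ ≤ κ → κ ≤ 1ℚ → Close e κ κ′ → a ≤ a′ + e → b ≤ b′ + e →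
      Bounded a′ → Bounded b′ → mix κ a b ≤ mix κ′ a′ b′ + (e + e + e)
    mix-shift {e} {κ} {κ′} {a} {a′} {b} {b′} 0≤κ κ≤1 (κ≤ , κ≥) ha hb (a≥ , a≤) (b≥ , b≤) =
      ≤-from (0≤+ (0≤+ (0≤* (≤⇒0≤ κ≤1) (≤⇒0≤ ha)) (0≤* 0≤κ (≤⇒0≤ hb)))
        (0≤* (nonNegative⁻¹ ½) (0≤+ (0≤* (≤⇒0≤ κ≤) (0≤+ b≥ (≤⇒0≤ a≤))) (0≤* (≤⇒0≤ κ≥) (0≤+ a≥ (≤⇒0≤ b≤))))))
        (solve 7 (λ e κ κ′ a a′ b b′ →
          (con 1ℚ :- κ) :* (a′ :+ e :- a) :+ κ :* (b′ :+ e :- b)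
            :+ con ½ :* ((κ′ :+ e :- κ) :* (b′ :+ con ½ :+ (con 1ℚ :+ con ½ :- a′))
                         :+ (κ :+ e :- κ′) :* (a′ :+ con ½ :+ (con 1ℚ :+ con ½ :- b′)))
          := (a′ :+ κ′ :* (b′ :- a′)) :+ (e :+ e :+ e) :- (a :+ κ :* (b :- a))) refl e κ κ′ a a′ b b′)

    close-mix : ∀ {e κ κ′ a a′ b b′} → 0ℚ ≤ κ → κ ≤ 1ℚ → 0ℚ ≤ κ′ → κ′ ≤ 1ℚ → Close e κ κ′ →
      Close e a a′ → Close e b b′ → Bounded a → Bounded b → Bounded a′ → Bounded b′ →
      Close (e + e + e) (mix κ a b) (mix κ′ a′ b′)
    close-mix {e} {κ} {κ′} {a} {a′} {b} {b′} k₁ k₂ k₃ k₄ ck ca cb ba bb ba′ bb′ =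
        mix-shift {e} {κ} {κ′} {a} {a′} {b} {b′} k₁ k₂ ck (Close.upper ca) (Close.upper cb) ba′ bb′
      , mix-shift {e} {κ′} {κ} {a′} {a} {b′} {b} k₃ k₄ (close-sym ck) (Close.lower ca) (Close.lower cb) ba bb

    mix-near-right : ∀ {e κ a b} → 0ℚ ≤ κ → κ ≤ 1ℚ → Bounded a → Bounded b → 1ℚ ≤ κ + e → Close (e + e) (mix κ a b) b
    mix-near-right {e} {κ} {a} {b} 0≤κ κ≤1 (a≥ , a≤) (b≥ , b≤) h =
        ≤-from (0≤+ (0≤* (≤⇒0≤ κ≤1) (0≤+ b≥ (≤⇒0≤ a≤))) (0≤* (0≤+ 0≤1 0≤1) (≤⇒0≤ h)))
          (solve 4 (λ e κ a b → (con 1ℚ :- κ) :* (b :+ con ½ :+ (con 1ℚ :+ con ½ :- a)) :+ con 2ℚ :* (κ :+ e :- con 1ℚ)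
            := b :+ (e :+ e) :- (a :+ κ :* (b :- a))) refl e κ a b)
      , ≤-from (0≤+ (0≤* (≤⇒0≤ κ≤1) (0≤+ a≥ (≤⇒0≤ b≤))) (0≤* (0≤+ 0≤1 0≤1) (≤⇒0≤ h)))
          (solve 4 (λ e κ a b → (con 1ℚ :- κ) :* (a :+ con ½ :+ (con 1ℚ :+ con ½ :- b)) :+ con 2ℚ :* (κ :+ e :- con 1ℚ)
            := (a :+ κ :* (b :- a)) :+ (e :+ e) :- b) refl e κ a b)

    mix-near-left : ∀ {e κ a b} → 0ℚ ≤ κ → κ ≤ 1ℚ → Bounded a → Bounded b → κ ≤ e → Close (e + e) (mix κ a b) a
    mix-near-left {e} {κ} {a} {b} 0≤κ κ≤1 (a≥ , a≤) (b≥ , b≤) h =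
        ≤-from (0≤+ (0≤* 0≤κ (0≤+ a≥ (≤⇒0≤ b≤))) (0≤* (0≤+ 0≤1 0≤1) (≤⇒0≤ h)))
          (solve 4 (λ e κ a b → κ :* (a :+ con ½ :+ (con 1ℚ :+ con ½ :- b)) :+ con 2ℚ :* (e :- κ)
            := a :+ (e :+ e) :- (a :+ κ :* (b :- a))) refl e κ a b)
      , ≤-from (0≤+ (0≤* 0≤κ (0≤+ b≥ (≤⇒0≤ a≤))) (0≤* (0≤+ 0≤1 0≤1) (≤⇒0≤ h)))
          (solve 4 (λ e κ a b → κ :* (b :+ con ½ :+ (con 1ℚ :+ con ½ :- a)) :+ con 2ℚ :* (e :- κ)
            := (a :+ κ :* (b :- a)) :+ (e :+ e) :- a) refl e κ a b)

    mix-close-right : ∀ {e κ a b} → 0ℚ ≤ κ → κ ≤ 1ℚ → 0ℚ ≤ e → Close e a b → Close e (mix κ a b) b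
    mix-close-right {e} {κ} {a} {b} 0≤κ κ≤1 0≤e (h , k) =
        mix-≤ 0≤κ κ≤1 {a} {b} h (≤-+ 0≤e ≤-refl)
      , minus-≤ b (mix κ a b) (mix-≥ 0≤κ κ≤1 {a} {b} {b - e} (≤-minus b a k) (≤-minus b b (≤-+ 0≤e ≤-refl)))

    mix-close-left : ∀ {e κ a b} → 0ℚ ≤ κ → κ ≤ 1ℚ → 0ℚ ≤ e → Close e a b → Close e (mix κ a b) a
    mix-close-left {e} {κ} {a} {b} 0≤κ κ≤1 0≤e (h , k) =
        mix-≤ 0≤κ κ≤1 {a} {b} (≤-+ 0≤e ≤-refl) k
      , minus-≤ a (mix κ a b) (mix-≥ 0≤κ κ≤1 {a} {b} {a - e} (≤-minus a a (≤-+ 0≤e ≤-refl)) (≤-minus a b h))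

    mix-+ : ∀ κ a b a′ b′ → mix κ a b + mix κ a′ b′ ≡ mix κ (a + a′) (b + b′)
    mix-+ = solve 5 (λ κ a b a′ b′ → (a :+ κ :* (b :- a)) :+ (a′ :+ κ :* (b′ :- a′)) := (a :+ a′) :+ κ :* (b :+ b′ :- (a :+ a′))) refl

    mix-0 : ∀ κ → 0ℚ ≡ mix κ 0ℚ 0ℚ
    mix-0 = solve 1 (λ κ → con 0ℚ := con 0ℚ :+ κ :* (con 0ℚ :- con 0ℚ)) refl

-- Cauchy reals: approximate comparison, affine maps, interpolation.

module Reals where
  open import Defs hiding (_⊗_)
  open import Data.Empty using (⊥; ⊥-elim)
  open import Data.Nat as ℕ using (ℕ; zero; suc)
  import Data.Nat.Properties as ℕ
  open import Data.Product using (∃-syntax; _×_; _,_; proj₁; proj₂)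
  open import Data.Rational
  open import Data.Rational.Properties
  open import Data.Rational.Solver using (module +-*-Solver)
  open import Data.Sum using (_⊎_; inj₁; inj₂)
  open import Relation.Binary.PropositionalEquality hiding ([_])
  open import Relation.Nullary using (¬_; Dec; yes; no)
  open Rationals
  open +-*-Solver using (solve; _:+_; _:*_; _:-_; _:=_; con; :-_)

  ev-map : {P Q : ℕ → Set} → (∀ n → P n → Q n) → Eventually P → Eventually Q
  ev-map f (N , h) = N , λ n N≤n → f n (h n N≤n)

  ev-map₂ : {P Q R : ℕ → Set} → (∀ n → P n → Q n → R n) → Eventually P → Eventually Q → Eventually R
  ev-map₂ f (M , h) (N , k) = M ℕ.⊔ N , λ n ≤n →
    f n (h n (ℕ.≤-trans (ℕ.m≤m⊔n M N) ≤n)) (k n (ℕ.≤-trans (ℕ.m≤n⊔m M N) ≤n))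

  ev-× : {P Q : ℕ → Set} → Eventually P → Eventually Q → Eventually (λ n → P n × Q n)
  ev-× = ev-map₂ (λ _ p q → p , q)

  ev-pure : {P : ℕ → Set} → (∀ n → P n) → Eventually P
  ev-pure h = 0 , λ n _ → h n

  Tail : (ℕ → ℕ → Set) → Set
  Tail R = ∃[ N ] (∀ m n → N ℕ.≤ m → N ℕ.≤ n → R m n)

  tails : {R S T : ℕ → ℕ → Set} → (∀ m n → R m n → S m n → T m n) → Tail R → Tail S → Tail T
  tails f (M , h) (N , k) = M ℕ.⊔ N , λ m n m≥ n≥ → f m n
    (h m n (ℕ.≤-trans (ℕ.m≤m⊔n M N) m≥) (ℕ.≤-trans (ℕ.m≤m⊔n M N) n≥))
    (k m n (ℕ.≤-trans (ℕ.m≤n⊔m M N) m≥) (ℕ.≤-trans (ℕ.m≤n⊔m M N) n≥))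

  tail-× : {R S : ℕ → ℕ → Set} → Tail R → Tail S → Tail (λ m n → R m n × S m n)
  tail-× = tails (λ _ _ r s → r , s)

  tail² : {P : ℕ → Set} → Eventually P → Tail (λ m n → P m × P n)
  tail² (N , h) = N , λ m n m≥ n≥ → h m m≥ , h n n≥

  ev-⊥ : {A : Set} → Eventually (λ _ → A) → A
  ev-⊥ (N , h) = h N ℕ.≤-refl

  -- The relations on ℝ as records, so that Agda can infer the numbers compared
  record W (ε : ℚ) (x y : ℝ) : Set where
    constructor mkW
    field ev : ∀ η → 0ℚ < η → Eventually λ n → Close (ε + η) (seq x n) (seq y n)

  record _⋖_ (x y : ℝ) : Set where
    constructor mk⋖
    field
      gap   : ℚ
      gap>0 : 0ℚ < gap
      ev    : Eventually λ n → seq x n + gap ≤ seq y n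

  record _≼_ (x y : ℝ) : Set where
    constructor mk≼
    field ev : ∀ η → 0ℚ < η → Eventually λ n → seq x n ≤ seq y n + η

  infix 4 _⋖_ _≼_ _≋_
  _≋_ : ℝ → ℝ → Set
  x ≋ y = W 0ℚ x y

  toW : ∀ {ε x y} → Within ε x y → W ε x y
  toW h = mkW λ η 0<η → ev-map (λ _ → abs⇒close) (h η 0<η)

  fromW : ∀ {ε x y} → W ε x y → Within ε x y
  fromW (mkW h) η 0<η = ev-map (λ _ → close⇒abs) (h η 0<η)

  to⋖ : ∀ {x y} → x <ᴿ y → x ⋖ y
  to⋖ (g , p , h) = mk⋖ g p h

  from⋖ : ∀ {x y} → x ⋖ y → x <ᴿ y
  from⋖ (mk⋖ g p h) = g , p , h

  ≋-from-close : ∀ {x y} → (∀ η → 0ℚ < η → Eventually λ n → Close η (seq x n) (seq y n)) → x ≋ y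
  ≋-from-close {x} {y} h = mkW λ η 0<η → ev-map (λ n → close-mono (≤-reflexive (sym (+-identityˡ η)))) (h η 0<η)

  ≋-close : ∀ {x y} → x ≋ y → ∀ η → 0ℚ < η → Eventually λ n → Close η (seq x n) (seq y n)
  ≋-close (mkW h) η 0<η = ev-map (λ n → close-mono (≤-reflexive (+-identityˡ η))) (h η 0<η)

  ≋-pointwise : ∀ {x y} → (∀ n → seq x n ≡ seq y n) → x ≋ y
  ≋-pointwise {x} {y} h = ≋-from-close λ η 0<η → ev-pure λ n →
    subst (Close η (seq x n)) (h n) (close-refl (<⇒≤ 0<η))

  ≋-refl : ∀ {x} → x ≋ x
  ≋-refl {x} = ≋-pointwise (λ _ → refl)

  W-sym : ∀ {ε x y} → W ε x y → W ε y x
  W-sym (mkW h) = mkW λ η 0<η → ev-map (λ _ → close-sym) (h η 0<η)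

  W-mono : ∀ {δ ε x y} → δ ≤ ε → W δ x y → W ε x y
  W-mono le (mkW h) = mkW λ η 0<η → ev-map (λ _ → close-mono (+-monoˡ-≤ η le)) (h η 0<η)

  W-trans : ∀ {δ ε x y z} → W δ x y → W ε y z → W (δ + ε) x z
  W-trans {δ} {ε} (mkW h) (mkW k) = mkW λ η 0<η → ev-map₂
    (λ _ c c′ → close-mono (≤-reflexive (solve 3 (λ d e η → (d :+ con ½ :* η) :+ (e :+ con ½ :* η) := d :+ e :+ η) refl δ ε η))
      (close-trans c c′))
    (h (½ * η) (half-pos 0<η)) (k (½ * η) (half-pos 0<η))

  ≋-trans : ∀ {x y z} → x ≋ y → y ≋ z → x ≋ z
  ≋-trans p q = W-mono ≤-refl (W-trans p q)

  W-≋ : ∀ {ε x x′ y y′} → W ε x y → x ≋ x′ → y ≋ y′ → W ε x′ y′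
  W-≋ {ε} w p q = W-mono (≤-reflexive (trans (+-identityʳ (0ℚ + ε)) (+-identityˡ ε))) (W-trans (W-trans (W-sym p) w) q)

  ≋⇒W : ∀ {ε x y} → 0ℚ ≤ ε → x ≋ y → W ε x y
  ≋⇒W le w = W-mono le w

  ≋⇒≼ : ∀ {x y} → x ≋ y → x ≼ y
  ≋⇒≼ p = mk≼ λ η 0<η → ev-map (λ _ → Close.upper) (≋-close p η 0<η)

  ≼-trans : ∀ {x y z} → x ≼ y → y ≼ z → x ≼ z
  ≼-trans {x} {y} {z} (mk≼ h) (mk≼ k) = mk≼ λ η 0<η → ev-map₂
    (λ n a b → ≤-trans (≤-shift {seq x n} {seq y n} {seq z n} a b) (≤-reflexive (cong (seq z n +_) (+-halves η))))
    (h (½ * η) (half-pos 0<η)) (k (½ * η) (half-pos 0<η))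

  ⋖-≼ : ∀ {x y z} → x ⋖ y → y ≼ z → x ⋖ z
  ⋖-≼ {x} {y} {z} (mk⋖ g 0<g h) (mk≼ k) = mk⋖ (½ * g) (half-pos 0<g) (ev-map₂
    (λ n a b → ≤-from (0≤+ (≤⇒0≤ a) (≤⇒0≤ b))
      (solve 4 (λ x y z g → (y :- (x :+ g)) :+ (z :+ con ½ :* g :- y) := z :- (x :+ con ½ :* g)) refl (seq x n) (seq y n) (seq z n) g))
    h (k (½ * g) (half-pos 0<g)))

  ⋖-irrefl : ∀ {x y} → x ⋖ y → y ≼ x → ⊥
  ⋖-irrefl {x} p q = ev-⊥ (ev-map contra (_⋖_.ev x⋖x))
    where
    x⋖x : x ⋖ x
    x⋖x = ⋖-≼ p q
    g = _⋖_.gap x⋖x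
    contra : ∀ n → seq x n + g ≤ seq x n → ⊥
    contra n a = <⇒≱ (_⋖_.gap>0 x⋖x) (≤-from (≤⇒0≤ a) (solve 2 (λ x g → x :- (x :+ g) := con 0ℚ :- g) refl (seq x n) g))

  -- The usable substitute for deciding `x < y` or `y ≤ x`. From index `K` on both sequences move by
  -- at most `η / 8`, so comparing two rationals with tolerance `η / 2` settles all later indices.
  ⋖-dichotomy : ∀ x y η → 0ℚ < η → x ⋖ y ⊎ Eventually λ n → seq y n ≤ seq x n + η
  ⋖-dichotomy x y η 0<η = decide (seq y K ≤? seq x K + ½ * η)
    where
    e = ½ * (½ * (½ * η))
    0<e = half-pos (half-pos (half-pos 0<η))
    M = proj₁ (cauchy x e 0<e)
    N = proj₁ (cauchy y e 0<e)
    hx = proj₂ (cauchy x e 0<e)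
    hy = proj₂ (cauchy y e 0<e)
    K = M ℕ.⊔ N
    cx : ∀ n → K ℕ.≤ n → Close e (seq x K) (seq x n)
    cx n K≤n = abs⇒close (hx K n (ℕ.m≤m⊔n M N) (ℕ.≤-trans (ℕ.m≤m⊔n M N) K≤n))
    cy : ∀ n → K ℕ.≤ n → Close e (seq y K) (seq y n)
    cy n K≤n = abs⇒close (hy K n (ℕ.m≤n⊔m M N) (ℕ.≤-trans (ℕ.m≤n⊔m M N) K≤n))
    decide : Dec (seq y K ≤ seq x K + ½ * η) → x ⋖ y ⊎ Eventually λ n → seq y n ≤ seq x n + η
    decide (yes p) = inj₂ (K , λ n K≤n → ≤-from
      (0≤+ (0≤+ (≤⇒0≤ (Close.lower (cy n K≤n))) (≤⇒0≤ (Close.upper (cx n K≤n)))) (0≤+ (≤⇒0≤ p) (0≤+ (<⇒≤ 0<e) (<⇒≤ 0<e))))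
      (solve 5 (λ yK yn xK xn η → let e = con ½ :* (con ½ :* (con ½ :* η)) in
         (yK :+ e :- yn) :+ (xn :+ e :- xK) :+ ((xK :+ con ½ :* η :- yK) :+ (e :+ e)) := xn :+ η :- yn)
         refl (seq y K) (seq y n) (seq x K) (seq x n) η))
    decide (no ¬p) = inj₁ (mk⋖ (½ * (½ * η)) (half-pos (half-pos 0<η)) (K , λ n K≤n → ≤-from
      (0≤+ (0≤+ (≤⇒0≤ (Close.upper (cy n K≤n))) (≤⇒0≤ (Close.lower (cx n K≤n)))) (≤⇒0≤ (<⇒≤ (≰⇒> ¬p))))
      (solve 5 (λ yK yn xK xn η → let e = con ½ :* (con ½ :* (con ½ :* η)) in
         (yn :+ e :- yK) :+ (xK :+ e :- xn) :+ (yK :- (xK :+ con ½ :* η)) := yn :- (xn :+ con ½ :* (con ½ :* η)))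
         refl (seq y K) (seq y n) (seq x K) (seq x n) η)))

  ¬⋖⇒≼ : ∀ {x y} → ¬ x ⋖ y → y ≼ x
  ¬⋖⇒≼ {x} {y} ¬p = mk≼ go
    where
    go : ∀ η → 0ℚ < η → Eventually λ n → seq y n ≤ seq x n + η
    go η 0<η with ⋖-dichotomy x y η 0<η
    ... | inj₁ p = ⊥-elim (¬p p)
    ... | inj₂ h = h

  ≼-antisym : ∀ {x y} → x ≼ y → y ≼ x → x ≋ y
  ≼-antisym (mk≼ h) (mk≼ k) = ≋-from-close λ η 0<η → ev-map₂ (λ _ a b → a , b) (h η 0<η) (k η 0<η)

  qℕ : ℕ → ℚ
  qℕ zero    = 0ℚ
  qℕ (suc k) = qℕ k + 1ℚ

  0≤qℕ : ∀ k → 0ℚ ≤ qℕ k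
  0≤qℕ zero    = ≤-refl
  0≤qℕ (suc k) = 0≤+ (0≤qℕ k) 0≤1

  qℕ-mono : ∀ {j k} → j ℕ.≤ k → qℕ j ≤ qℕ k
  qℕ-mono {k = k} ℕ.z≤n = 0≤qℕ k
  qℕ-mono (ℕ.s≤s le)    = +-monoˡ-≤ 1ℚ (qℕ-mono le)

  ⊓-pos : ∀ {δ ε} → 0ℚ < δ → 0ℚ < ε → 0ℚ < δ ⊓ ε
  ⊓-pos {δ} {ε} p q with ⊓-sel δ ε
  ... | inj₁ eq = subst (0ℚ <_) (sym eq) p
  ... | inj₂ eq = subst (0ℚ <_) (sym eq) q

  -- One half of `ε` is reserved for the first `k` multiples of `δ` and the other half for the last
  -- one.
  divide : ∀ k ε → 0ℚ < ε → ∃[ δ ] (0ℚ < δ × qℕ k * δ ≤ ε)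
  divide zero ε 0<ε = ε , 0<ε , ≤-trans (≤-reflexive (*-zeroˡ ε)) (<⇒≤ 0<ε)
  divide (suc k) ε 0<ε with δ , 0<δ , le ← divide k (½ * ε) (half-pos 0<ε) =
    μ , ⊓-pos 0<δ (half-pos 0<ε) , ≤-trans (≤-reflexive (solve 2 (λ k m → (k :+ con 1ℚ) :* m := k :* m :+ m) refl (qℕ k) μ))
      (≤-trans (+-mono-≤ (≤-trans (*-monoˡ-≤-nonNeg (qℕ k) {{nonNegative (0≤qℕ k)}} (p⊓q≤p δ (½ * ε))) le) (p⊓q≤q δ (½ * ε)))
        (≤-reflexive (+-halves ε)))
    where μ = δ ⊓ (½ * ε)

  affineℚ : ℕ → ℚ → ℚ → ℚ
  affineℚ k d x = qℕ k * x + d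

  close-affine : ∀ k d {e x y} → Close e x y → Close (qℕ k * e) (affineℚ k d x) (affineℚ k d y)
  close-affine k d {e} {x} {y} (a , b) = go {x} {y} a , go {y} {x} b
    where
    go : ∀ {x y} → x ≤ y + e → affineℚ k d x ≤ affineℚ k d y + qℕ k * e
    go {x} {y} h = ≤-from (0≤* (0≤qℕ k) (≤⇒0≤ h))
      (solve 5 (λ k d e x y → k :* (y :+ e :- x) := (k :* y :+ d) :+ k :* e :- (k :* x :+ d)) refl (qℕ k) d e x y)

  abstract
    affine : ℕ → ℚ → ℝ → ℝ
    affine k d x = mkℝ (λ n → affineℚ k d (seq x n)) λ ε 0<ε →
      let δ , 0<δ , le = divide k ε 0<ε
          N , h = cauchy x δ 0<δ
      in N , λ m n m≥ n≥ → close⇒abs (close-mono le (close-affine k d (abs⇒close (h m n m≥ n≥))))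

    seq-affine : ∀ k d x n → seq (affine k d x) n ≡ affineℚ k d (seq x n)
    seq-affine k d x n = refl

    W-affine : ∀ k d {δ ε x y} → qℕ k * δ ≤ ε → W δ x y → W ε (affine k d x) (affine k d y)
    W-affine k d {δ} {ε} le (mkW h) = mkW λ η 0<η →
      let μ , 0<μ , le′ = divide k η 0<η in
      ev-map (λ n c → close-mono (≤-trans (≤-reflexive (*-distribˡ-+ (qℕ k) δ μ)) (+-mono-≤ le le′)) (close-affine k d c)) (h μ 0<μ)

    shift : ℝ → ℕ → ℝ
    shift z j = mkℝ (λ n → seq z n - qℕ j) λ ε 0<ε →
      let N , h = cauchy z ε 0<ε in N , λ m n m≥ n≥ →
      ≤-trans (≤-reflexive (cong ∣_∣ (solve 3 (λ a b q → (a :- q) :- (b :- q) := a :- b) refl (seq z m) (seq z n) (qℕ j)))) (h m n m≥ n≥)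

    seq-shift : ∀ z j n → seq (shift z j) n ≡ seq z n - qℕ j
    seq-shift z j n = refl

    W-shift : ∀ {ε x y} j → W ε x y → W ε (shift x j) (shift y j)
    W-shift {ε} {x} {y} j (mkW h) = mkW λ η 0<η → ev-map (λ n → λ { (a , b) → go (ε + η) (seq x n) (seq y n) a , go (ε + η) (seq y n) (seq x n) b }) (h η 0<η)
      where
      go : ∀ e x y → x ≤ y + e → x - qℕ j ≤ y - qℕ j + e
      go e x y h = ≤-from (≤⇒0≤ h) (solve 4 (λ x y e q → y :+ e :- x := (y :- q) :+ e :- (x :- q)) refl x y e (qℕ j))

  bounded : (A : UnitInterval) → Eventually λ n → Bounded (seq (value A) n)
  bounded A = ev-map₂ (λ n a b → a , b) (lower A ½ 0<½) (upper A ½ 0<½)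
    where
    0<½ : 0ℚ < ½
    0<½ = positive⁻¹ ½

  abstract
    clampᴵ : ℝ → UnitInterval
    clampᴵ x = mkI
      (mkℝ (λ n → clamp (seq x n)) λ ε 0<ε → let N , h = cauchy x ε 0<ε in
        N , λ m n m≥ n≥ → close⇒abs (close-clamp (<⇒≤ 0<ε) (abs⇒close (h m n m≥ n≥))))
      (λ η 0<η → ev-pure λ n → ≤-+ (<⇒≤ 0<η) (clamp≥0 (seq x n)))
      (λ η 0<η → ev-pure λ n → ≤-+ (<⇒≤ 0<η) (clamp≤1 (seq x n)))

    seq-clamp : ∀ x n → seq (value (clampᴵ x)) n ≡ clamp (seq x n)
    seq-clamp x n = refl

    W-clamp : ∀ {ε x y} → 0ℚ ≤ ε → W ε x y → W ε (value (clampᴵ x)) (value (clampᴵ y))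
    W-clamp {ε} 0≤ε (mkW h) = mkW λ η 0<η → ev-map (λ n → close-clamp (0≤+ 0≤ε (<⇒≤ 0<η))) (h η 0<η)

    clamp-zero : ∀ {x} → x ≼ 0ᴿ → value (clampᴵ x) ≋ 0ᴿ
    clamp-zero {x} (mk≼ h) = ≋-from-close λ η 0<η → ev-map
      (λ n le → clamp-≤ (0≤+ ≤-refl (<⇒≤ 0<η)) le , ≤-+ (<⇒≤ 0<η) (clamp≥0 (seq x n))) (h η 0<η)

    clamp-one : ∀ {x} → 1ᴿ ≼ x → value (clampᴵ x) ≋ 1ᴿ
    clamp-one {x} (mk≼ h) = ≋-from-close λ η 0<η → ev-map
      (λ n le → ≤-+ (<⇒≤ 0<η) (clamp≤1 (seq x n)) , clamp-near-1 (<⇒≤ 0<η) le) (h η 0<η)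

  module _ (z : ℝ) (A B : UnitInterval) where
    private
      κ a b : ℕ → ℚ
      κ n = clamp (seq z n)
      a = seq (value A)
      b = seq (value B)

    abstract
      -- The parameter is truncated to the unit interval, so the result rests at one end outside it.
      -- Pieces of a polygon can thus be chained by shifting `z`.
      lerpᴿ : ℝ
      lerpᴿ = mkℝ (λ n → mix (κ n) (a n) (b n)) λ ε 0<ε →
        let e = ⅓ * ε
            0<e = third-pos 0<ε
        in tails (λ m n (cz , ca , cb) ((am , bm) , (an , bn)) → close⇒abs (close-mono (≤-reflexive (+-thirds ε))
             (close-mix (clamp≥0 _) (clamp≤1 _) (clamp≥0 _) (clamp≤1 _) (close-clamp (<⇒≤ 0<e) (abs⇒close cz))
               (abs⇒close ca) (abs⇒close cb) am bm an bn)))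
             (tail-× (cauchy z e 0<e) (tail-× (cauchy (value A) e 0<e) (cauchy (value B) e 0<e)))
             (tail² (ev-× (bounded A) (bounded B)))

      seq-lerp : ∀ n → seq lerpᴿ n ≡ mix (κ n) (a n) (b n)
      seq-lerp n = refl

      lerp : UnitInterval
      lerp = mkI lerpᴿ
        (λ η 0<η → ev-map₂ (λ n p q → minus-≤ 0ℚ (mix (κ n) (a n) (b n)) {η} (mix-≥ (clamp≥0 _) (clamp≤1 _)
            (≤-minus 0ℚ (a n) p) (≤-minus 0ℚ (b n) q))) (lower A η 0<η) (lower B η 0<η))
        (λ η 0<η → ev-map₂ (λ n p q → mix-≤ (clamp≥0 _) (clamp≤1 _) {a n} {b n} p q) (upper A η 0<η) (upper B η 0<η))

      value-lerp : value lerp ≡ lerpᴿ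
      value-lerp = refl

      -- For each tolerance `η`, either `z` is positive and the two ends agree, or `z` is at most
      -- `η / 2` and the value is within `η` of the left end. The sign of `z` is never decided.
      lerp-left : (0ᴿ ⋖ z → value A ≋ value B) → lerpᴿ ≋ value A
      lerp-left h = ≋-from-close go
        where
        go : ∀ η → 0ℚ < η → Eventually λ n → Close η (mix (κ n) (a n) (b n)) (a n)
        go η 0<η with ⋖-dichotomy 0ᴿ z (½ * η) (half-pos 0<η)
        ... | inj₁ p = ev-map (λ n → mix-close-left (clamp≥0 _) (clamp≤1 _) (<⇒≤ 0<η)) (≋-close (h p) η 0<η)
        ... | inj₂ q = ev-map₂ (λ n f g → f g) (ev-map₂ (λ n p q r → close-mono (≤-reflexive (+-halves η))
                         (mix-near-left (clamp≥0 _) (clamp≤1 _) p q r)) (bounded A) (bounded B))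
                       (ev-map (λ n le → clamp-≤ (<⇒≤ (half-pos 0<η)) (≤-trans le (≤-reflexive (+-identityˡ _)))) q)

      lerp-right : (z ⋖ 1ᴿ → value A ≋ value B) → lerpᴿ ≋ value B
      lerp-right h = ≋-from-close go
        where
        go : ∀ η → 0ℚ < η → Eventually λ n → Close η (mix (κ n) (a n) (b n)) (b n)
        go η 0<η with ⋖-dichotomy z 1ᴿ (½ * η) (half-pos 0<η)
        ... | inj₁ p = ev-map (λ n → mix-close-right (clamp≥0 _) (clamp≤1 _) (<⇒≤ 0<η)) (≋-close (h p) η 0<η)
        ... | inj₂ q = ev-map₂ (λ n f g → f g) (ev-map₂ (λ n p q r → close-mono (≤-reflexive (+-halves η))
                         (mix-near-right (clamp≥0 _) (clamp≤1 _) p q r)) (bounded A) (bounded B))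
                       (ev-map (λ n → clamp-near-1 (<⇒≤ (half-pos 0<η))) q)

      -- The four conditions are tested with tolerance `g / 4`, where `g` is the positive gap. If
      -- neither pair passes, the value is at most `3 * g / 4`, a contradiction.
      lerp-pos : 0ᴿ ⋖ lerpᴿ → (0ᴿ ⋖ value A × z ⋖ 1ᴿ) ⊎ (0ᴿ ⋖ value B × 0ᴿ ⋖ z)
      lerp-pos (mk⋖ g 0<g h) = go (⋖-dichotomy 0ᴿ (value A) η 0<η) (⋖-dichotomy z 1ᴿ η 0<η)
                                  (⋖-dichotomy 0ᴿ (value B) η 0<η) (⋖-dichotomy 0ᴿ z η 0<η)
        where
        η : ℚ
        η = ½ * (½ * g)
        0<η : 0ℚ < η
        0<η = half-pos (half-pos 0<g)
        Small : ℕ → Set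
        Small n = mix (κ n) (a n) (b n) ≤ η + (η + η)
        absurd : {C : Set} → Eventually Small → C
        absurd s = ⊥-elim (ev-⊥ (ev-map₂ (λ n p q → <⇒≱ 0<η (≤-from (≤⇒0≤ (≤-trans p q))
          (solve 1 (λ g → let η = con ½ :* (con ½ :* g) in η :+ (η :+ η) :- (con 0ℚ :+ g) := con 0ℚ :- η) refl g))) h s))
        low : ∀ {x} → x ≤ 0ℚ + η → x ≤ η
        low le = ≤-trans le (≤-reflexive (+-identityˡ η))
        κ-low : ∀ n → seq z n ≤ 0ℚ + η → κ n ≤ η
        κ-low n le = clamp-≤ (<⇒≤ 0<η) (low le)
        κ-high : ∀ n → 1ℚ ≤ seq z n + η → 1ℚ ≤ κ n + η
        κ-high n = clamp-near-1 (<⇒≤ 0<η)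
        η≤3η : η ≤ η + (η + η)
        η≤3η = ≤-+ (0≤+ (<⇒≤ 0<η) (<⇒≤ 0<η)) ≤-refl
        go : 0ᴿ ⋖ value A ⊎ Eventually (λ n → a n ≤ 0ℚ + η) → z ⋖ 1ᴿ ⊎ Eventually (λ n → 1ℚ ≤ seq z n + η) →
             0ᴿ ⋖ value B ⊎ Eventually (λ n → b n ≤ 0ℚ + η) → 0ᴿ ⋖ z ⊎ Eventually (λ n → seq z n ≤ 0ℚ + η) →
             (0ᴿ ⋖ value A × z ⋖ 1ᴿ) ⊎ (0ᴿ ⋖ value B × 0ᴿ ⋖ z)
        go (inj₁ p) (inj₁ q) _ _ = inj₁ (p , q)
        go _ _ (inj₁ p) (inj₁ q) = inj₂ (p , q)
        go (inj₂ p) _ (inj₂ q) _ = absurd (ev-map₂ (λ n p q → ≤-trans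
          (mix-≤ (clamp≥0 _) (clamp≤1 _) {a n} {b n} (low p) (low q)) η≤3η) p q)
        go (inj₂ p) _ _ (inj₂ q) = absurd (ev-map₂ (λ n f g → f g)
          (ev-map₂ (λ n p q (ba , bb) → ≤-trans (Close.upper (mix-near-left (clamp≥0 _) (clamp≤1 _) ba bb (κ-low n q)))
            (+-monoˡ-≤ (η + η) (low p))) p q)
          (ev-× (bounded A) (bounded B)))
        go _ (inj₂ p) (inj₂ q) _ = absurd (ev-map₂ (λ n f g → f g)
          (ev-map₂ (λ n p q (ba , bb) → ≤-trans (Close.upper (mix-near-right (clamp≥0 _) (clamp≤1 _) ba bb (κ-high n p)))
            (+-monoˡ-≤ (η + η) (low q))) p q)
          (ev-× (bounded A) (bounded B)))
        go _ (inj₂ p) _ (inj₂ q) = absurd (ev-map₂ (λ n f g → f g)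
          (ev-map₂ (λ n p q (ba , bb) → ≤-trans (mix-≤ (clamp≥0 _) (clamp≤1 _) {a n} {b n} (Bounded.above ba) (Bounded.above bb))
            (≤-from (0≤* (nonNegative⁻¹ (1ℚ + ½)) (0≤+ (≤⇒0≤ (κ-high n p)) (≤⇒0≤ (κ-low n q))))
              (solve 2 (λ κ η → con (1ℚ + ½) :* ((κ :+ η :- con 1ℚ) :+ (η :- κ)) := (η :+ (η :+ η)) :- con (1ℚ + ½)) refl (κ n) η))) p q)
          (ev-× (bounded A) (bounded B)))

  abstract
    W-lerp : ∀ {ε z z′ A A′ B B′} → W (⅓ * ε) z z′ → 0ℚ ≤ ε → W (⅓ * ε) (value A) (value A′) → W (⅓ * ε) (value B) (value B′) →
      W ε (lerpᴿ z A B) (lerpᴿ z′ A′ B′)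
    W-lerp {ε} {z} {z′} {A} {A′} {B} {B′} (mkW hz) 0≤ε (mkW hA) (mkW hB) = mkW λ η 0<η →
      let η′ = ⅓ * η ; 0<η′ = third-pos 0<η
          0≤e : 0ℚ ≤ ⅓ * ε + η′
          0≤e = 0≤+ (0≤* (nonNegative⁻¹ ⅓) 0≤ε) (<⇒≤ 0<η′)
      in ev-map₂ (λ n f g → f g)
        (ev-map₂ (λ n (p , q) (ba , bb) (r , ba′ , bb′) → close-mono
            (≤-reflexive (solve 2 (λ e η → let x = con ⅓ :* e :+ con ⅓ :* η in x :+ x :+ x := e :+ η) refl ε η))
            (close-mix (clamp≥0 _) (clamp≤1 _) (clamp≥0 _) (clamp≤1 _) (close-clamp 0≤e r) p q ba bb ba′ bb′))
          (ev-× (hA η′ 0<η′) (hB η′ 0<η′))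
          (ev-× (bounded A) (bounded B)))
        (ev-× (hz η′ 0<η′) (ev-× (bounded A′) (bounded B′)))

-- Points of the realization and polygons through compatible points.

module Polygons where
  open import Defs hiding (_⊗_)
  open import Data.Empty using (⊥; ⊥-elim)
  open import Data.List using (List; []; _∷_; _++_; map; deduplicate)
  open import Data.List.Relation.Unary.Any as Any using (here; there)
  open import Data.List.Relation.Unary.All as All using (All; []; _∷_)
  open import Data.List.Relation.Unary.AllPairs using ([]; _∷_)
  import Data.List.Membership.Setoid as SetoidMembership
  import Data.List.Membership.Setoid.Properties as SetoidMembershipₚ
  import Data.List.Relation.Unary.Unique.Setoid as SetoidUnique
  import Data.List.Relation.Unary.Unique.DecSetoid.Properties as UniqueDecSetoid
  open import Data.Nat as ℕ using (ℕ; zero; suc)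
  import Data.Nat.Properties as ℕ
  open import Data.Product as Product using (∃-syntax; _×_; _,_)
  open import Data.Rational
  open import Data.Rational.Properties
  open import Data.Rational.Solver using (module +-*-Solver)
  open import Data.Sum using (_⊎_; inj₁; inj₂; swap; map₁)
  open import Function using (_∘_)
  open import Level using (0ℓ)
  open import Relation.Binary.Bundles using (Poset; DecSetoid)
  open import Relation.Binary.PropositionalEquality hiding ([_])
  open import Relation.Nullary using (¬_; Dec; yes; no)
  open Rationals
  open Reals
  open GridHomotopy
  open +-*-Solver using (solve; _:+_; _:*_; _:-_; _:=_; con; :-_)

  abstract
    _⊞_ : ℝ → ℝ → ℝ
    _⊞_ = _+ᴿ_

    ⊞≡+ᴿ : ∀ x y → x ⊞ y ≡ x +ᴿ y
    ⊞≡+ᴿ x y = refl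

    seq-⊞ : ∀ x y n → seq (x ⊞ y) n ≡ seq x n + seq y n
    seq-⊞ x y n = refl

    W-⊞ : ∀ {d e x y x′ y′} → W d x y → W e x′ y′ → W (d + e) (x ⊞ x′) (y ⊞ y′)
    W-⊞ {d} {e} {x} {y} {x′} {y′} (mkW h) (mkW k) = mkW λ η 0<η → ev-map₂
      (λ n c c′ → close-mono (≤-reflexive (solve 3 (λ d e η → (d :+ con ½ :* η) :+ (e :+ con ½ :* η) := d :+ e :+ η) refl d e η))
        (close-+ c c′))
      (h (½ * η) (half-pos 0<η)) (k (½ * η) (half-pos 0<η))

  ≋-⊞ : ∀ {x y x′ y′} → x ≋ y → x′ ≋ y′ → x ⊞ x′ ≋ y ⊞ y′
  ≋-⊞ p q = W-mono ≤-refl (W-⊞ p q)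

  ⊞-identityˡ : ∀ x → 0ᴿ ⊞ x ≋ x
  ⊞-identityˡ x = ≋-pointwise λ n → trans (seq-⊞ 0ᴿ x n) (+-identityˡ (seq x n))

  ⊞-identityʳ : ∀ x → x ⊞ 0ᴿ ≋ x
  ⊞-identityʳ x = ≋-pointwise λ n → trans (seq-⊞ x 0ᴿ n) (+-identityʳ (seq x n))

  ⊞-interchange : ∀ w x y z → (w ⊞ x) ⊞ (y ⊞ z) ≋ (w ⊞ y) ⊞ (x ⊞ z)
  ⊞-interchange w x y z = ≋-pointwise λ n → begin
    seq ((w ⊞ x) ⊞ (y ⊞ z)) n                    ≡⟨ seq-⊞ _ _ n ⟩
    seq (w ⊞ x) n + seq (y ⊞ z) n                ≡⟨ cong₂ _+_ (seq-⊞ w x n) (seq-⊞ y z n) ⟩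
    (seq w n + seq x n) + (seq y n + seq z n)    ≡⟨ solve 4 (λ a b c d → (a :+ b) :+ (c :+ d) := (a :+ c) :+ (b :+ d)) refl
                                                      (seq w n) (seq x n) (seq y n) (seq z n) ⟩
    (seq w n + seq y n) + (seq x n + seq z n)    ≡⟨ cong₂ _+_ (seq-⊞ w y n) (seq-⊞ x z n) ⟨
    seq (w ⊞ y) n + seq (x ⊞ z) n                ≡⟨ seq-⊞ _ _ n ⟨
    seq ((w ⊞ y) ⊞ (x ⊞ z)) n                    ∎
    where open ≡-Reasoning

  ≼-⊞ˡ : ∀ x y → 0ᴿ ≼ y → x ≼ x ⊞ y
  ≼-⊞ˡ x y (mk≼ h) = mk≼ λ η 0<η → ev-map (λ n a → subst (λ s → seq x n ≤ s + η) (sym (seq-⊞ x y n)) (≤-from a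
    (solve 3 (λ x y η → y :+ η := x :+ y :+ η :- x) refl (seq x n) (seq y n) η))) (h η 0<η)

  ≼-⊞ʳ : ∀ x y → 0ᴿ ≼ x → y ≼ x ⊞ y
  ≼-⊞ʳ x y (mk≼ h) = mk≼ λ η 0<η → ev-map (λ n a → subst (λ s → seq y n ≤ s + η) (sym (seq-⊞ x y n)) (≤-from a
    (solve 3 (λ x y η → x :+ η := x :+ y :+ η :- y) refl (seq x n) (seq y n) η))) (h η 0<η)

  to≼ : ∀ x y → x ≤ᴿ y → x ≼ y
  to≼ _ _ = mk≼

  module _ {A : Set} where
    sumOf : (A → ℝ) → List A → ℝ
    sumOf f []      = 0ᴿ
    sumOf f (x ∷ l) = f x ⊞ sumOf f l

    sumOf≡sumᴿ : ∀ f l → sumOf f l ≡ sumᴿ (map f l)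
    sumOf≡sumᴿ f []      = refl
    sumOf≡sumᴿ f (x ∷ l) = trans (cong (f x ⊞_) (sumOf≡sumᴿ f l)) (⊞≡+ᴿ (f x) _)

    sum-cong : ∀ {f g : A → ℝ} l → (∀ x → f x ≋ g x) → sumOf f l ≋ sumOf g l
    sum-cong []      h = ≋-refl
    sum-cong (x ∷ l) h = ≋-⊞ (h x) (sum-cong l h)

    sum-zero : (l : List A) → sumOf (λ _ → 0ᴿ) l ≋ 0ᴿ
    sum-zero []      = ≋-refl
    sum-zero (x ∷ l) = ≋-trans (⊞-identityˡ _) (sum-zero l)

    sum-⊞ : ∀ (f g : A → ℝ) l → sumOf (λ x → f x ⊞ g x) l ≋ sumOf f l ⊞ sumOf g l
    sum-⊞ f g []      = W-sym (⊞-identityˡ 0ᴿ)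
    sum-⊞ f g (x ∷ l) = ≋-trans (≋-⊞ ≋-refl (sum-⊞ f g l)) (⊞-interchange (f x) (g x) (sumOf f l) (sumOf g l))

  sum-swap : ∀ {A B : Set} (f : A → B → ℝ) l l′ →
    sumOf (λ x → sumOf (f x) l′) l ≋ sumOf (λ y → sumOf (λ x → f x y) l) l′
  sum-swap f []      l′ = W-sym (sum-zero l′)
  sum-swap f (x ∷ l) l′ = ≋-trans (≋-⊞ ≋-refl (sum-swap f l l′)) (W-sym (sum-⊞ (f x) (λ y → sumOf (λ x → f x y) l) l′))

  gate : {A : Set} → Dec A → ℝ → ℝ
  gate (yes _) v = v
  gate (no  _) v = 0ᴿ

  -- The hypotheses would give `k < u < i + 1 ≤ k`.
  separated : ∀ u {i k} → i ℕ.< k → 0ᴿ ⋖ shift u k → shift u i ⋖ 1ᴿ → ⊥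
  separated u {i} {k} i<k (mk⋖ g 0<g h) (mk⋖ g′ 0<g′ h′) = ev-⊥ (ev-map₂ contra h h′)
    where
    contra : ∀ n → 0ℚ + g ≤ seq (shift u k) n → seq (shift u i) n + g′ ≤ 1ℚ → ⊥
    contra n a b = <⇒≱ 0<g (≤-from
      (0≤+ (0≤+ (≤⇒0≤ (≤-trans a (≤-reflexive (seq-shift u k n)))) (≤⇒0≤ (subst (λ s → s + g′ ≤ 1ℚ) (seq-shift u i n) b)))
        (0≤+ (≤⇒0≤ (qℕ-mono i<k)) (<⇒≤ 0<g′)))
      (solve 5 (λ z i k g g′ → (z :- k :- (con 0ℚ :+ g)) :+ (con 1ℚ :- (z :- i :+ g′)) :+ ((k :- (i :+ con 1ℚ)) :+ g′) := con 0ℚ :- g)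
        refl (seq u n) (qℕ i) (qℕ k) g g′))

  shift-≼ : ∀ z j → shift z j ≼ z
  shift-≼ z j = mk≼ λ η 0<η → ev-pure λ n → ≤-from (0≤+ (0≤qℕ j) (<⇒≤ 0<η))
    (trans (solve 3 (λ z q η → q :+ η := z :+ η :- (z :- q)) refl (seq z n) (qℕ j) η)
      (cong (λ s → seq z n + η - s) (sym (seq-shift z j n))))

  record Monotone (D : Space) : Set where
    field mono : ∀ {δ ε} p q → δ ≤ ε → Near D δ p q → Near D ε p q

  module Points (P : Poset 0ℓ 0ℓ 0ℓ) (_≈?_ : ∀ x y → Dec (Poset._≈_ P x y)) where
    private module P = Poset P
    open P using (Carrier; _≈_)
    open Rows P
    open SetoidMembership P.Eq.setoid using (_∈_)
    open SetoidUnique P.Eq.setoid using () renaming (Unique to Distinct)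

    carrierDecSetoid : DecSetoid 0ℓ 0ℓ
    carrierDecSetoid = record { isDecEquivalence = record { isEquivalence = P.isEquivalence ; _≟_ = _≈?_ } }

    Point : Set
    Point = RealizationPoint P

    module PointFields (p : Point) = RealizationPoint p
    open PointFields

    gate-sum-∉ : ∀ x v l → All (λ y → ¬ x ≈ y) l → sumOf (λ y → gate (x ≈? y) v) l ≋ 0ᴿ
    gate-sum-∉ x v []      []         = ≋-refl
    gate-sum-∉ x v (y ∷ l) (x≉y ∷ ps) with x ≈? y
    ... | yes x≈y = ⊥-elim (x≉y x≈y)
    ... | no  _   = ≋-trans (⊞-identityˡ _) (gate-sum-∉ x v l ps)

    gate-sum-∈ : ∀ x v l → Distinct l → x ∈ l → sumOf (λ y → gate (x ≈? y) v) l ≋ v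
    gate-sum-∈ x v (y ∷ l) (y≉ ∷ d) x∈ with x ≈? y | x∈
    ... | yes x≈y | _ = ≋-trans (≋-⊞ (≋-refl {v}) (gate-sum-∉ x v l (All.map (λ y≉w x≈w → y≉w (P.Eq.trans (P.Eq.sym x≈y) x≈w)) y≉)))
                          (⊞-identityʳ v)
    ... | no x≉y | here x≈y = ⊥-elim (x≉y x≈y)
    ... | no _ | there x∈l = ≋-trans (⊞-identityˡ _) (gate-sum-∈ x v l d x∈l)

    gate-sum : ∀ x v l → Distinct l → 0ᴿ ≼ v → (0ᴿ ⋖ v → x ∈ l) → sumOf (λ y → gate (x ≈? y) v) l ≋ v
    gate-sum x v l d 0≼v h with Any.any? (x ≈?_) l
    ... | yes x∈l = gate-sum-∈ x v l d x∈l
    ... | no  x∉l = ≋-trans (gate-sum-∉ x v l (All.tabulateₛ P.Eq.setoid λ {y} y∈l x≈y → x∉l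
                       (SetoidMembershipₚ.∈-resp-≈ P.Eq.setoid (P.Eq.sym x≈y) y∈l)))
                     (≼-antisym 0≼v (¬⋖⇒≼ (x∉l ∘ h)))

    Charges : Point → Carrier → Set
    Charges p x = 0ᴿ ⋖ weight p x

    0≼weight : ∀ p x → 0ᴿ ≼ weight p x
    0≼weight p x = to≼ 0ᴿ (weight p x) (nonneg p x)

    weight-≋ : ∀ p {x y} → x ≈ y → weight p x ≋ weight p y
    weight-≋ p {x} {y} x≈y = toW {0ℚ} {weight p x} {weight p y} (weight-cong p x≈y)

    Carries : Point → List Carrier → Set
    Carries p l = ∀ x → Charges p x → x ∈ l

    -- Both sums equal the double sum of [ x ≈ y ] weight p x.
    sums-agree : ∀ p l l′ → Distinct l → Distinct l′ → Carries p l → Carries p l′ →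
      sumOf (weight p) l ≋ sumOf (weight p) l′
    sums-agree p l l′ d d′ s s′ =
      ≋-trans (W-sym (sum-cong l (λ x → gate-sum x (weight p x) l′ d′ (0≼weight p x) (s′ x))))
        (≋-trans (sum-swap (λ x y → gate (x ≈? y) (weight p x)) l l′)
          (sum-cong l′ (λ y → ≋-trans (sum-cong l (λ x → flip-gate x y))
            (gate-sum y (weight p y) l d (0≼weight p y) (s y)))))
      where
      flip-gate : ∀ x y → gate (x ≈? y) (weight p x) ≋ gate (y ≈? x) (weight p y)
      flip-gate x y with x ≈? y | y ≈? x
      ... | yes x≈y | yes _   = weight-≋ p x≈y
      ... | yes x≈y | no y≉x  = ⊥-elim (y≉x (P.Eq.sym x≈y))
      ... | no x≉y  | yes y≈x = ⊥-elim (x≉y (P.Eq.sym y≈x))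
      ... | no _    | no _    = ≋-refl

    total-support : ∀ p → sumOf (weight p) (support p) ≋ 1ᴿ
    total-support p = subst (_≋ 1ᴿ) (sym (sumOf≡sumᴿ (weight p) (support p)))
      (toW {0ℚ} {sumᴿ (map (weight p) (support p))} {1ᴿ} (total p))

    -- When two points are mixed, their weights must be summed over a common list; the total does
    -- not depend on the list that carries the support.
    total-over : ∀ p l → Distinct l → Carries p l → sumOf (weight p) l ≋ 1ᴿ
    total-over p l d s = ≋-trans
      (sums-agree p l (support p) d (distinct p) s (λ x q → supported p x (from⋖ q)))
      (total-support p)

    0≼sum : ∀ p l → 0ᴿ ≼ sumOf (weight p) l
    0≼sum p []      = ≋⇒≼ {0ᴿ} ≋-refl
    0≼sum p (x ∷ l) = ≼-trans (0≼sum p l) (≼-⊞ʳ (weight p x) (sumOf (weight p) l) (0≼weight p x))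

    weight-≼-sum : ∀ p {x} l → x ∈ l → weight p x ≼ sumOf (weight p) l
    weight-≼-sum p (y ∷ l) (here x≈y) = ≼-trans (≋⇒≼ (weight-≋ p x≈y)) (≼-⊞ˡ (weight p y) (sumOf (weight p) l) (0≼sum p l))
    weight-≼-sum p (y ∷ l) (there q)  = ≼-trans (weight-≼-sum p l q) (≼-⊞ʳ (weight p y) (sumOf (weight p) l) (0≼weight p y))

    weight-≼-1 : ∀ p x → weight p x ≼ 1ᴿ
    weight-≼-1 p x with Any.any? (x ≈?_) (support p)
    ... | yes x∈ = ≼-trans (weight-≼-sum p (support p) x∈) (≋⇒≼ (total-support p))
    ... | no  x∉ = ≼-trans (¬⋖⇒≼ {0ᴿ} (λ q → x∉ (supported p x (from⋖ q)))) (mk≼ λ η 0<η → ev-pure λ n → ≤-+ (<⇒≤ 0<η) 0≤1)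

    weightᴵ : Point → Carrier → UnitInterval
    weightᴵ p x = mkI (weight p x) (nonneg p x) (_≼_.ev (weight-≼-1 p x))

    -- Together with the chain condition of each point, this says that `p` and `q` lie in a common
    -- simplex.
    record Compatible (p q : Point) : Set where
      constructor compatible
      field comparable : ∀ x y → Charges p x → Charges q y → x ~ y

    open Compatible

    lerp-cong : ∀ z {A A′ B B′} → value A ≋ value A′ → value B ≋ value B′ → lerpᴿ z A B ≋ lerpᴿ z A′ B′
    lerp-cong z a b = W-lerp (≋⇒W le (≋-refl {z})) ≤-refl (≋⇒W le a) (≋⇒W le b)
      where
      le : 0ℚ ≤ ⅓ * 0ℚ
      le = ≤-reflexive (sym (*-zeroʳ ⅓))

    module _ (z : ℝ) (A B : Point) where
      mixWeight : Carrier → ℝ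
      mixWeight x = lerpᴿ z (weightᴵ A x) (weightᴵ B x)

      sum-mix : ∀ l n → seq (sumOf mixWeight l) n ≡
        mix (clamp (seq z n)) (seq (sumOf (weight A) l) n) (seq (sumOf (weight B) l) n)
      sum-mix []      n = mix-0 (clamp (seq z n))
      sum-mix (x ∷ l) n = trans (seq-⊞ (mixWeight x) (sumOf mixWeight l) n) (trans
        (cong₂ _+_ (seq-lerp z (weightᴵ A x) (weightᴵ B x) n) (sum-mix l n))
        (trans (mix-+ (clamp (seq z n)) (seq (weight A x) n) (seq (weight B x) n) _ _)
          (sym (cong₂ (mix (clamp (seq z n))) (seq-⊞ (weight A x) _ n) (seq-⊞ (weight B x) _ n)))))

      -- Compatibility is needed only when both points contribute, and `lerp-pos` then provides
      -- `0 < z < 1`. This conditional form lets points be joined that share a simplex only during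
      -- their own piece.
      mixPoint′ : (0ᴿ ⋖ z → z ⋖ 1ᴿ → Compatible A B) → Point
      mixPoint′ compat = record
        { weight      = mixWeight
        ; weight-cong = λ {x} {y} x≈y → fromW {0ℚ} {mixWeight x} {mixWeight y}
            (lerp-cong z {weightᴵ A x} {weightᴵ A y} {weightᴵ B x} {weightᴵ B y} (weight-≋ A x≈y) (weight-≋ B x≈y))
        ; nonneg      = λ x → subst (0ᴿ ≤ᴿ_) (value-lerp z (weightᴵ A x) (weightᴵ B x)) (UnitInterval.lower (lerp z (weightᴵ A x) (weightᴵ B x)))
        ; chain       = λ x y px py → go x y (charged x px) (charged y py)
        ; support     = supp
        ; distinct    = supp-distinct
        ; supported   = λ x px → carried x (charged x px)
        ; total       = fromW {0ℚ} {sumᴿ (map mixWeight supp)} {1ᴿ} (subst (_≋ 1ᴿ) (sumOf≡sumᴿ mixWeight supp) (≋-from-close λ η 0<η → ev-map₂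
            (λ n a b → subst (λ s → Close η s 1ℚ) (sym (sum-mix supp n)) (close-1 n (<⇒≤ 0<η) a b))
            (≋-close totalA η 0<η) (≋-close totalB η 0<η)))
        }
        where
        Charged : Carrier → Set
        Charged x = (Charges A x × z ⋖ 1ᴿ) ⊎ (Charges B x × 0ᴿ ⋖ z)

        charged : ∀ x → 0ᴿ <ᴿ mixWeight x → Charged x
        charged x p = lerp-pos z (weightᴵ A x) (weightᴵ B x) (to⋖ {0ᴿ} {mixWeight x} p)

        go : ∀ x y → Charged x → Charged y → x ~ y
        go x y (inj₁ (p , _)) (inj₁ (q , _))   = chain A x y (from⋖ p) (from⋖ q)
        go x y (inj₂ (p , _)) (inj₂ (q , _))   = chain B x y (from⋖ p) (from⋖ q)
        go x y (inj₁ (p , z<1)) (inj₂ (q , 0<z)) = comparable (compat 0<z z<1) x y p q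
        go x y (inj₂ (p , 0<z)) (inj₁ (q , z<1)) = swap (comparable (compat 0<z z<1) y x q p)

        supp = deduplicate _≈?_ (support A ++ support B)
        supp-distinct = UniqueDecSetoid.deduplicate-! carrierDecSetoid (support A ++ support B)

        dedup : ∀ {x} → x ∈ (support A ++ support B) → x ∈ supp
        dedup = SetoidMembershipₚ.∈-deduplicate⁺ P.Eq.setoid _≈?_ (λ y≈w x≈w → P.Eq.trans x≈w (P.Eq.sym y≈w))

        carriesA : Carries A supp
        carriesA x p = dedup (SetoidMembershipₚ.∈-++⁺ˡ P.Eq.setoid (supported A x (from⋖ p)))

        carriesB : Carries B supp
        carriesB x p = dedup (SetoidMembershipₚ.∈-++⁺ʳ P.Eq.setoid (support A) (supported B x (from⋖ p)))

        carried : ∀ x → Charged x → x ∈ supp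
        carried x (inj₁ (p , _)) = carriesA x p
        carried x (inj₂ (p , _)) = carriesB x p

        totalA = total-over A supp supp-distinct carriesA
        totalB = total-over B supp supp-distinct carriesB

        close-1 : ∀ n {η} → 0ℚ ≤ η → Close η (seq (sumOf (weight A) supp) n) 1ℚ → Close η (seq (sumOf (weight B) supp) n) 1ℚ →
          Close η (mix (clamp (seq z n)) (seq (sumOf (weight A) supp) n) (seq (sumOf (weight B) supp) n)) 1ℚ
        close-1 n {η} 0≤η (a≤ , a≥) (b≤ , b≥) =
            mix-≤ (clamp≥0 _) (clamp≤1 _) a≤ b≤
          , minus-≤ 1ℚ _ (mix-≥ (clamp≥0 (seq z n)) (clamp≤1 (seq z n)) (≤-minus 1ℚ _ a≥) (≤-minus 1ℚ _ b≥))

    module _ (z : ℝ) (A B : Point) where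
      abstract
        mixPoint : (0ᴿ ⋖ z → z ⋖ 1ᴿ → Compatible A B) → Point
        mixPoint = mixPoint′ z A B

        weight-mix : ∀ c x → weight (mixPoint c) x ≡ lerpᴿ z (weightᴵ A x) (weightᴵ B x)
        weight-mix c x = refl

      mix-charges : ∀ c x → Charges (mixPoint c) x → (Charges A x × z ⋖ 1ᴿ) ⊎ (Charges B x × 0ᴿ ⋖ z)
      mix-charges c x p = lerp-pos z (weightᴵ A x) (weightᴵ B x) (subst (0ᴿ ⋖_) (weight-mix c x) p)

      mix-left : ∀ c x → (0ᴿ ⋖ z → weight A x ≋ weight B x) → weight (mixPoint c) x ≋ weight A x
      mix-left c x h = subst (_≋ weight A x) (sym (weight-mix c x)) (lerp-left z (weightᴵ A x) (weightᴵ B x) h)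

      mix-right : ∀ c x → (z ⋖ 1ᴿ → weight A x ≋ weight B x) → weight (mixPoint c) x ≋ weight B x
      mix-right c x h = subst (_≋ weight B x) (sym (weight-mix c x)) (lerp-right z (weightᴵ A x) (weightᴵ B x) h)

    CompatAt : ℝ → (ℕ → Point) → ℕ → Set
    CompatAt z Q j = 0ᴿ ⋖ shift z j → shift z j ⋖ 1ᴿ → Compatible (Q j) (Q (suc j))

    -- The parameter is within distance 1 of `index`, without a lower bound at index 0 and without
    -- an upper bound at the last index `J`. It records which corner of the polygon contributes the
    -- vertex `x`.
    record Located (z : ℝ) (Q : ℕ → Point) (J : ℕ) (x : Carrier) : Set where
      field
        index    : ℕ
        index≤   : index ℕ.≤ J
        charges : Charges (Q index) x
        below    : index ℕ.< J → shift z index ⋖ 1ᴿ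
        above    : ∀ k → suc k ≡ index → 0ᴿ ⋖ shift z k

    -- During the piece after `J` an earlier corner is impossible by `separated`, so `x` is charged
    -- by `Q J`, and the compatibility of two consecutive corners is enough.
    located-compat : ∀ {z Q J x y} → Located z Q J x → 0ᴿ ⋖ shift z J → shift z J ⋖ 1ᴿ → CompatAt z Q J →
      Charges (Q (suc J)) y → x ~ y
    located-compat {z} {x = x} {y} loc 0<z z<1 c py with ℕ.m≤n⇒m<n∨m≡n (Located.index≤ loc)
    ... | inj₁ j<J  = ⊥-elim (separated z j<J 0<z (Located.below loc j<J))
    ... | inj₂ refl = comparable (c 0<z z<1) x y (Located.charges loc) py

    located-suc : ∀ {z Q J x} → (Located z Q J x × shift z J ⋖ 1ᴿ) ⊎ (Charges (Q (suc J)) x × 0ᴿ ⋖ shift z J) →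
      Located z Q (suc J) x
    located-suc {z} {Q} {J} {x} (inj₂ (q , 0<z)) = record
      { index = suc J ; index≤ = ℕ.≤-refl ; charges = q
      ; below = λ lt → ⊥-elim (ℕ.<-irrefl refl lt) ; above = λ { k refl → 0<z } }
    located-suc {z} {Q} {J} {x} (inj₁ (loc , z<1)) = record
      { index = index ; index≤ = ℕ.m≤n⇒m≤1+n index≤ ; charges = charges ; below = below′ ; above = above }
      where
      open Located loc
      below′ : index ℕ.< suc J → shift z index ⋖ 1ᴿ
      below′ lt with ℕ.m≤n⇒m<n∨m≡n index≤
      ... | inj₁ j<J  = below j<J
      ... | inj₂ refl = z<1

    init : ∀ {J} {R : ℕ → Set} → (∀ j → j ℕ.< suc J → R j) → ∀ j → j ℕ.< J → R j
    init c j = c j ∘ ℕ.m<n⇒m<1+n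

    module _ (z : ℝ) (Q : ℕ → Point) where
      -- While z runs from j to j + 1 the point moves from Q j to Q (j + 1).
      poly : ∀ J → (∀ j → j ℕ.< J → CompatAt z Q j) → Point
      locate : ∀ J c x → Charges (poly J c) x → Located z Q J x

      poly zero    c = Q 0
      -- Forming this point requires knowing what the partial polygon charges, which is why `poly`
      -- and `locate` are defined together.
      poly (suc J) c = mixPoint (shift z J) (poly J (init c)) (Q (suc J))
        (λ 0<z z<1 → compatible λ x y px py → located-compat (locate J (init c) x px) 0<z z<1 (c J ℕ.≤-refl) py)

      locate zero    c x p = record { index = 0 ; index≤ = ℕ.z≤n ; charges = p ; below = λ () ; above = λ _ () }
      locate (suc J) c x p = located-suc (map₁ (Product.map₁ (locate J (init c) x))
        (mix-charges (shift z J) (poly J (init c)) (Q (suc J)) _ x p))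

      poly-first : ∀ J c → z ≼ 0ᴿ → ∀ x → weight (poly J c) x ≋ weight (Q 0) x
      poly-first zero    c z≼0 x = ≋-refl
      poly-first (suc J) c z≼0 x = ≋-trans
        (mix-left (shift z J) prev (Q (suc J)) _ x (λ 0<z → ⊥-elim (⋖-irrefl 0<z shifted)))
        (poly-first J (init c) z≼0 x)
        where
        prev = poly J (init c)
        shifted : shift z J ≼ 0ᴿ
        shifted = ≼-trans (shift-≼ z J) z≼0

      poly-last : ∀ J c → 1ᴿ ≼ shift z J → ∀ x → weight (poly (suc J) c) x ≋ weight (Q (suc J)) x
      poly-last J c 1≼z x = mix-right (shift z J) (poly J (init c)) (Q (suc J)) _ x
        (λ z<1 → ⊥-elim (⋖-irrefl z<1 1≼z))

      poly-constant : ∀ J c x v → (∀ j → j ℕ.≤ J → weight (Q j) x ≋ v) → weight (poly J c) x ≋ v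
      poly-constant zero    c x v h = h 0 ℕ.≤-refl
      poly-constant (suc J) c x v h = ≋-trans
        (mix-left (shift z J) (poly J (init c)) (Q (suc J)) _ x
          (λ _ → ≋-trans prev (W-sym (h (suc J) ℕ.≤-refl)))) prev
        where
        prev : weight (poly J (init c)) x ≋ v
        prev = poly-constant J _ x v (λ j → h j ∘ ℕ.m≤n⇒m≤1+n)

    module Continuity (D : Space) (monotone : Monotone D) where
      open Monotone monotone
      Continuousᴿ : (Pt D → ℝ) → Set
      Continuousᴿ f = ∀ ε → 0ℚ < ε → ∃[ δ ] (0ℚ < δ × (∀ p q → Near D δ p q → W ε (f p) (f q)))

      Continuousᴾ : (Pt D → Point) → Set
      Continuousᴾ f = ∀ ε → 0ℚ < ε → ∃[ δ ] (0ℚ < δ × (∀ p q → Near D δ p q → ∀ x → W ε (weight (f p) x) (weight (f q) x)))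

      mix-continuous : ∀ {z : Pt D → ℝ} {A B : Pt D → Point} (c : ∀ d → 0ᴿ ⋖ z d → z d ⋖ 1ᴿ → Compatible (A d) (B d)) →
        Continuousᴿ z → Continuousᴾ A → Continuousᴾ B → Continuousᴾ (λ d → mixPoint (z d) (A d) (B d) (c d))
      mix-continuous {z} {A} {B} c hz hA hB ε 0<ε
        with δ₁ , 0<δ₁ , k₁ ← hz (⅓ * ε) (third-pos 0<ε)
           | δ₂ , 0<δ₂ , k₂ ← hA (⅓ * ε) (third-pos 0<ε)
           | δ₃ , 0<δ₃ , k₃ ← hB (⅓ * ε) (third-pos 0<ε) =
        δ₁ ⊓ (δ₂ ⊓ δ₃) , ⊓-pos 0<δ₁ (⊓-pos 0<δ₂ 0<δ₃) , λ p q near x →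
          subst₂ (W ε) (sym (weight-mix (z p) (A p) (B p) (c p) x)) (sym (weight-mix (z q) (A q) (B q) (c q) x))
            (W-lerp {A = weightᴵ (A p) x} {weightᴵ (A q) x} {weightᴵ (B p) x} {weightᴵ (B q) x}
              (k₁ p q (mono p q (p⊓q≤p δ₁ (δ₂ ⊓ δ₃)) near)) (<⇒≤ 0<ε)
              (k₂ p q (mono p q (≤-trans (p⊓q≤q δ₁ (δ₂ ⊓ δ₃)) (p⊓q≤p δ₂ δ₃)) near) x)
              (k₃ p q (mono p q (≤-trans (p⊓q≤q δ₁ (δ₂ ⊓ δ₃)) (p⊓q≤q δ₂ δ₃)) near) x))

      shift-continuous : ∀ {z : Pt D → ℝ} j → Continuousᴿ z → Continuousᴿ (λ d → shift (z d) j)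
      shift-continuous j hz ε 0<ε = let δ , 0<δ , k = hz ε 0<ε in δ , 0<δ , λ p q near → W-shift j (k p q near)

      poly-continuous : ∀ {z : Pt D → ℝ} {Q : Pt D → ℕ → Point} J (c : ∀ d j → j ℕ.< J → CompatAt (z d) (Q d) j) →
        Continuousᴿ z → (∀ j → j ℕ.≤ J → Continuousᴾ (λ d → Q d j)) →
        Continuousᴾ (λ d → poly (z d) (Q d) J (c d))
      poly-continuous zero    c hz hQ = hQ 0 ℕ.z≤n
      poly-continuous {z} {Q} (suc J) c hz hQ = mix-continuous
        {z = λ d → shift (z d) J} {λ d → poly (z d) (Q d) J (init (c d))} {λ d → Q d (suc J)}
        (λ d 0<z z<1 → compatible λ x y px py → located-compat (locate (z d) (Q d) J (init (c d)) x px) 0<z z<1 (c d J ℕ.≤-refl) py)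
        (shift-continuous {z} J hz)
        (poly-continuous {z} {Q} J (init ∘ c) hz (λ j → hQ j ∘ ℕ.m≤n⇒m≤1+n))
        (hQ (suc J) ℕ.≤-refl)

    abstract
      vertex : Carrier → Point
      vertex v = record
        { weight      = w
        ; weight-cong = λ {x} {y} x≈y → fromW {0ℚ} {w x} {w y} (cong-w x y x≈y)
        ; nonneg      = λ x → _≼_.ev (w≥0 x)
        ; chain       = λ x y px py → inj₁ (P.reflexive (P.Eq.trans (w-pos x (to⋖ {0ᴿ} {w x} px)) (P.Eq.sym (w-pos y (to⋖ {0ᴿ} {w y} py)))))
        ; support     = v ∷ []
        ; distinct    = [] ∷ []
        ; supported   = λ x px → here (w-pos x (to⋖ {0ᴿ} {w x} px))
        ; total       = fromW {0ℚ} {w v +ᴿ 0ᴿ} {1ᴿ} (≋-trans (≋-pointwise (λ n → +-identityʳ (seq (w v) n))) (w-v v P.Eq.refl))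
        }
        where
        w : Carrier → ℝ
        w x = gate (x ≈? v) 1ᴿ
        w-v : ∀ x → x ≈ v → w x ≋ 1ᴿ
        w-v x x≈v with x ≈? v
        ... | yes _  = ≋-refl
        ... | no x≉v = ⊥-elim (x≉v x≈v)
        cong-w : ∀ x y → x ≈ y → w x ≋ w y
        cong-w x y x≈y with x ≈? v | y ≈? v
        ... | yes _   | yes _   = ≋-refl
        ... | no _    | no _    = ≋-refl
        ... | yes x≈v | no y≉v  = ⊥-elim (y≉v (P.Eq.trans (P.Eq.sym x≈y) x≈v))
        ... | no x≉v  | yes y≈v = ⊥-elim (x≉v (P.Eq.trans x≈y y≈v))
        w≥0 : ∀ x → 0ᴿ ≼ w x
        w≥0 x with x ≈? v
        ... | yes _ = mk≼ λ η 0<η → ev-pure λ n → ≤-+ (<⇒≤ 0<η) 0≤1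
        ... | no  _ = ≋⇒≼ ≋-refl
        w-pos : ∀ x → 0ᴿ ⋖ w x → x ≈ v
        w-pos x p with x ≈? v
        ... | yes x≈v = x≈v
        ... | no  _   = ⊥-elim (⋖-irrefl p (≋⇒≼ ≋-refl))

      vertex-pos : ∀ v x → Charges (vertex v) x → x ≈ v
      vertex-pos v x p with x ≈? v
      ... | yes x≈v = x≈v
      ... | no  _   = ⊥-elim (⋖-irrefl p (≋⇒≼ ≋-refl))

-- Archimedean estimates and gluing of sequences.

module Estimates where
  open import Defs hiding (_⊗_)
  open import Data.Empty using (⊥-elim)
  open import Data.Integer as ℤ using (ℤ)
  import Data.Integer.Properties as ℤ
  open import Data.Nat as ℕ using (ℕ; zero; suc)
  import Data.Nat.Properties as ℕ
  open import Data.Product using (∃-syntax; _×_; _,_)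
  open import Data.Rational
  open import Data.Rational.Properties
  import Data.Rational.Unnormalised as ℚᵘ
  import Data.Rational.Unnormalised.Properties as ℚᵘ
  open import Data.Rational.Solver using (module +-*-Solver)
  open import Function using (_∘_)
  open import Relation.Binary.PropositionalEquality hiding ([_])
  open Rationals
  open Reals
  open GridHomotopy
  open Polygons
  open +-*-Solver using (solve; _:+_; _:*_; _:-_; _:=_; con; :-_)

  qℕ-+ : ∀ j k → qℕ (j ℕ.+ k) ≡ qℕ j + qℕ k
  qℕ-+ zero    k = sym (+-identityˡ (qℕ k))
  qℕ-+ (suc j) k = trans (cong (_+ 1ℚ) (qℕ-+ j k))
    (solve 2 (λ j k → j :+ k :+ con 1ℚ := j :+ con 1ℚ :+ k) refl (qℕ j) (qℕ k))

  qℕ-* : ∀ j k → qℕ (j ℕ.* k) ≡ qℕ j * qℕ k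
  qℕ-* zero    k = sym (*-zeroˡ (qℕ k))
  qℕ-* (suc j) k = trans (qℕ-+ k (j ℕ.* k)) (trans (cong (qℕ k +_) (qℕ-* j k))
    (solve 2 (λ j k → k :+ j :* k := (j :+ con 1ℚ) :* k) refl (qℕ j) (qℕ k)))

  qℕ-toℚᵘ : ∀ k → toℚᵘ (qℕ k) ℚᵘ.≃ ℚᵘ.mkℚᵘ (ℤ.+ k) 0
  qℕ-toℚᵘ zero    = ℚᵘ.≃-refl
  qℕ-toℚᵘ (suc k) = ℚᵘ.≃-trans (toℚᵘ-homo-+ (qℕ k) 1ℚ) (ℚᵘ.≃-trans
    (ℚᵘ.+-congˡ (toℚᵘ 1ℚ) (qℕ-toℚᵘ k))
    (ℚᵘ.*≡* (cong (ℤ._* ℤ.1ℤ) (trans (cong₂ ℤ._+_ (ℤ.*-identityʳ (ℤ.+ k)) refl) (cong ℤ.+_ (ℕ.+-comm k 1))))))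

  -- The witness is the denominator: multiplied by it, a positive fraction becomes its numerator,
  -- which is at least 1.
  archimedean : ∀ δ → 0ℚ < δ → ∃[ k ] 1ℚ ≤ qℕ k * δ
  archimedean δ@(mkℚ (ℤ.+ zero) d-1 _) p = ⊥-elim (<⇒≱ p (*≤* ℤ.≤-refl))
  archimedean δ@(mkℚ ℤ.-[1+ n ] d-1 _) (*<* ())
  archimedean δ@(mkℚ (ℤ.+ suc n) d-1 _) p = suc d-1 , toℚᵘ-cancel-≤
    (ℚᵘ.≤-respʳ-≃ (ℚᵘ.≃-sym (ℚᵘ.≃-trans (toℚᵘ-homo-* (qℕ (suc d-1)) δ) (ℚᵘ.*-congʳ (qℕ-toℚᵘ (suc d-1)))))
      (ℚᵘ.*≤* (ℤ.+≤+ (ℕ.s≤s (begin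
        d-1 ℕ.+ 0 ℕ.+ 0                  ≡⟨ trans (ℕ.+-identityʳ _) (ℕ.+-identityʳ d-1) ⟩
        d-1                              ≤⟨ ℕ.m≤m*n d-1 (suc n) ⟩
        d-1 ℕ.* suc n                    ≤⟨ ℕ.m≤n+m _ n ⟩
        n ℕ.+ d-1 ℕ.* suc n              ≡⟨ ℕ.*-identityʳ _ ⟨
        (n ℕ.+ d-1 ℕ.* suc n) ℕ.* 1      ∎)))))
    where open ℕ.≤-Reasoning

  const-pos : ∀ {e} → 0ℚ < e → 0ᴿ ⋖ fromℚ e
  const-pos {e} 0<e = mk⋖ e 0<e (ev-pure λ _ → ≤-reflexive (+-identityˡ e))

  inverse : ∀ k → ∃[ ν ] (0ℚ < ν × qℕ (suc k) * ν ≡ 1ℚ)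
  inverse k = 1/ q , positive⁻¹ (1/ q) {{1/pos⇒pos q}} , *-inverseʳ q
    where
    q = qℕ (suc k)
    0<q : 0ℚ < q
    0<q = <-≤-trans (positive⁻¹ 1ℚ) (≤-trans (≤-reflexive (sym (+-identityˡ 1ℚ))) (+-monoˡ-≤ 1ℚ (0≤qℕ k)))
    instance
      q-pos : Positive q
      q-pos = positive 0<q
      q-nonZero : NonZero q
      q-nonZero = pos⇒nonZero q

  shift-below : ∀ u {i k} → i ℕ.< k → shift u i ⋖ 1ᴿ → shift u k ≼ 0ᴿ
  shift-below u i<k h = ¬⋖⇒≼ (λ p → separated u i<k p h)

  shift-above : ∀ u {i k} → i ℕ.< k → 0ᴿ ⋖ shift u k → 1ᴿ ≼ shift u i
  shift-above u i<k h = ¬⋖⇒≼ (separated u i<k h)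

  ≼-affine : ∀ K {x} → x ≼ 0ᴿ → affine K 0ℚ x ≼ 0ᴿ
  ≼-affine K {x} (mk≼ h) = mk≼ λ η 0<η → let δ , 0<δ , le = divide K η 0<η in
    ev-map (λ n a → subst (_≤ 0ℚ + η) (sym (seq-affine K 0ℚ x n)) (≤-from
        (0≤+ (0≤* (0≤qℕ K) (≤⇒0≤ a)) (≤⇒0≤ le))
        (solve 4 (λ k x δ η → k :* (con 0ℚ :+ δ :- x) :+ (η :- k :* δ) := con 0ℚ :+ η :- (k :* x :+ con 0ℚ)) refl (qℕ K) (seq x n) δ η)))
      (h δ 0<δ)

  affine-shift : ∀ K {x i} → 1ᴿ ≼ x → i ℕ.< K → 1ᴿ ≼ shift (affine K 0ℚ x) i
  affine-shift K {x} {i} (mk≼ h) i<K = mk≼ λ η 0<η → let δ , 0<δ , le = divide K η 0<η in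
    ev-map (λ n a → subst (λ s → 1ℚ ≤ s + η) (sym (trans (seq-shift (affine K 0ℚ x) i n) (cong (_- qℕ i) (seq-affine K 0ℚ x n)))) (≤-from
        (0≤+ (0≤* (0≤qℕ K) (≤⇒0≤ a)) (0≤+ (≤⇒0≤ le) (≤⇒0≤ (qℕ-mono i<K))))
        (solve 5 (λ k i x δ η → k :* (x :+ δ :- con 1ℚ) :+ ((η :- k :* δ) :+ (k :- (i :+ con 1ℚ)))
           := k :* x :+ con 0ℚ :- i :+ η :- con 1ℚ) refl (qℕ K) (qℕ i) (seq x n) δ η)))
      (h δ 0<δ)

  W-limit : ∀ {x y} → (∀ ε → 0ℚ < ε → W ε x y) → x ≋ y
  W-limit h = ≋-from-close λ η 0<η → ev-map (λ n → close-mono (≤-reflexive (+-halves η)))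
    (W.ev (h (½ * η) (half-pos 0<η)) (½ * η) (half-pos 0<η))

  ≋-value-const : ∀ {x a} → x ≃ᴿ fromℚ a → x ≋ fromℚ a
  ≋-value-const {x} {a} = toW {0ℚ} {x} {fromℚ a}

  cons : {A : Set} → A → (ℕ → A) → ℕ → A
  cons a f zero    = a
  cons a f (suc n) = f n

  splice : {A : Set} → ℕ → (ℕ → A) → (ℕ → A) → ℕ → A
  splice zero    f g = g
  splice (suc n) f g = cons (f 0) (splice n (f ∘ suc) g)

  splice-tail : {A : Set} → ∀ n (f g : ℕ → A) k → splice n f g (n ℕ.+ k) ≡ g k
  splice-tail zero    f g k = refl
  splice-tail (suc n) f g k = splice-tail n (f ∘ suc) g k

  module _ {A : Set} {R : A → A → Set} where
    cons-path : ∀ {a f} → R a (f 0) → (∀ i → R (f i) (f (suc i))) → ∀ i → R (cons a f i) (cons a f (suc i))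
    cons-path h k zero    = h
    cons-path h k (suc i) = k i

    splice-path : ∀ n {f g} → (∀ i → R (f i) (f (suc i))) → R (f n) (g 0) → (∀ i → R (g i) (g (suc i))) →
      ∀ i → R (splice (suc n) f g i) (splice (suc n) f g (suc i))
    splice-path zero    hf h hg = cons-path h hg
    splice-path (suc n) hf h hg = cons-path (hf 0) (splice-path n (hf ∘ suc) h hg)

-- Vertices of uniformly positive weight, and path connectedness.

module Connectivity where
  open import Defs hiding (_⊗_)
  open import Data.Empty using (⊥; ⊥-elim)
  open import Data.List using ([]; _∷_; length)
  import Data.List.Relation.Unary.Unique.Setoid as SetoidUnique
  open import Data.Nat as ℕ using (ℕ; zero; suc)
  import Data.Nat.Properties as ℕ
  open import Data.Product using (∃-syntax; _,_; proj₁; proj₂)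
  open import Data.Rational
  open import Data.Rational.Properties
  open import Data.Rational.Solver using (module +-*-Solver)
  open import Data.Sum using (inj₁; inj₂; swap)
  open import Function using (_∘_)
  open import Level using (0ℓ)
  open import Relation.Binary.Bundles using (Poset)
  open import Relation.Binary.PropositionalEquality hiding ([_])
  open import Relation.Nullary using (Dec; yes; no)
  open Rationals
  open Reals
  open GridHomotopy
  open Polygons
  open Estimates
  open +-*-Solver using (solve; _:+_; _:*_; _:-_; _:=_; con; :-_)

  -- This is `e / 4 ^ k`.
  share : ℕ → ℚ → ℚ
  share zero    e = e
  share (suc k) e = share k (½ * (½ * e))

  share-pos : ∀ k {e} → 0ℚ < e → 0ℚ < share k e
  share-pos zero    p = p
  share-pos (suc k) p = share-pos k (half-pos (half-pos p))

  quarter-≤ : ∀ {e} → 0ℚ < e → ½ * (½ * e) ≤ e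
  quarter-≤ {e} p = ≤-from (0≤+ (<⇒≤ (half-pos p)) (<⇒≤ (half-pos (half-pos p))))
    (solve 1 (λ e → con ½ :* e :+ con ½ :* (con ½ :* e) := e :- con ½ :* (con ½ :* e)) refl e)

  share-≤ : ∀ k {e} → 0ℚ < e → share k e ≤ e
  share-≤ zero    p = ≤-refl
  share-≤ (suc k) p = ≤-trans (share-≤ k (half-pos (half-pos p))) (quarter-≤ p)

  ⋖⇒≼ : ∀ {x y} → x ⋖ y → x ≼ y
  ⋖⇒≼ {x} {y} (mk⋖ g 0<g h) = mk≼ λ η 0<η → ev-map (λ n a → ≤-from (0≤+ (0≤+ (≤⇒0≤ a) (<⇒≤ 0<g)) (<⇒≤ 0<η))
    (solve 4 (λ x y g η → y :- (x :+ g) :+ g :+ η := y :+ η :- x) refl (seq x n) (seq y n) g η)) h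

  fromℚ-≼ : ∀ {a b} → a ≤ b → fromℚ a ≼ fromℚ b
  fromℚ-≼ le = mk≼ λ η 0<η → ev-pure λ _ → ≤-+ (<⇒≤ 0<η) le

  -- Either the first summand exceeds `e / 4`, or it is at most `e / 2` and the rest still sums to
  -- more than `e / 4`. The loss by a factor 4 per step is the price of an approximate comparison.
  large-summand : ∀ {A : Set} k (f : A → ℝ) l e → 0ℚ < e → length l ℕ.≤ k → fromℚ e ≼ sumOf f l →
    ∃[ x ] fromℚ (share k e) ≼ f x
  large-summand k f [] e 0<e le h = ⊥-elim (⋖-irrefl (const-pos 0<e) h)
  large-summand (suc k) f (x ∷ l) e 0<e (ℕ.s≤s le) (mk≼ h)
    with ⋖-dichotomy (fromℚ (½ * (½ * e))) (f x) (½ * (½ * e)) (half-pos (half-pos 0<e))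
  ... | inj₁ p = x , ≼-trans (fromℚ-≼ (share-≤ k (half-pos (half-pos 0<e)))) (⋖⇒≼ p)
  ... | inj₂ q = large-summand k f l (½ * (½ * e)) (half-pos (half-pos 0<e)) le (mk≼ λ η 0<η → ev-map₂
    (λ n a b → ≤-from (0≤+ (0≤+ (≤⇒0≤ (subst (λ s → e ≤ s + η) (seq-⊞ (f x) (sumOf f l) n) a)) (≤⇒0≤ b)) (<⇒≤ (half-pos (half-pos 0<e))))
      (solve 4 (λ e x s η → (x :+ s :+ η :- e) :+ (con ½ :* (con ½ :* e) :+ con ½ :* (con ½ :* e) :- x) :+ con ½ :* (con ½ :* e)
          := s :+ η :- con ½ :* (con ½ :* e)) refl e (seq (f x) n) (seq (sumOf f l) n) η))
    (h η 0<η) q)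

  𝕀-monotone : Monotone 𝕀
  𝕀-monotone = record { mono = λ {δ} {ε} s t le near → fromW {ε} {value s} {value t} (W-mono le (toW {δ} {value s} {value t} near)) }

  ⊗-monotone : ∀ {A B} → Monotone A → Monotone B → Monotone (Defs._⊗_ A B)
  ⊗-monotone a b = record { mono = λ (p , q) (p′ , q′) le (h , k) → Monotone.mono a p p′ le h , Monotone.mono b q q′ le k }

  module Topology
    (P : Poset 0ℓ 0ℓ 0ℓ) (_≈?_ : ∀ x y → Dec (Poset._≈_ P x y))
    (bound : ℕ) (bounded-length : ∀ l → SetoidUnique.Unique (Poset.Eq.setoid P) l → length l ℕ.≤ bound)
    where

    private module P = Poset P
    open P using (Carrier; _≈_) renaming (_≤_ to _⊑_)
    open Rows P
    open Points P _≈?_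
    open PointFields

    S : Space
    S = ∣ P ∣ᴳ

    -- Lists of distinct elements have bounded length, so a single threshold serves every point; the
    -- mesh of a loop is chosen in terms of it.
    c : ℚ
    c = share bound 1ℚ

    0<c : 0ℚ < c
    0<c = share-pos bound (positive⁻¹ 1ℚ)

    abstract
      pick : ∀ p → ∃[ x ] fromℚ c ≼ weight p x
      pick p = large-summand bound (weight p) (support p) 1ℚ (positive⁻¹ 1ℚ) (bounded-length (support p) (distinct p))
        (≋⇒≼ (W-sym (total-support p)))

    pick-charges : ∀ p → Charges p (proj₁ (pick p))
    pick-charges p = ⋖-≼ (const-pos 0<c) (proj₂ (pick p))

    infix 4 _≈ᴾ_
    record _≈ᴾ_ (p q : Point) : Set where
      constructor mk≈ᴾ
      field weight-≈ : ∀ x → weight p x ≋ weight q x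

    open _≈ᴾ_

    ≈ₚ⇒≈ᴾ : ∀ {p q} → _≈ₚ_ S p q → p ≈ᴾ q
    ≈ₚ⇒≈ᴾ {p} {q} h = mk≈ᴾ λ x → W-limit λ ε 0<ε → toW {ε} {weight p x} {weight q x} (h ε 0<ε x)

    ≈ᴾ⇒≈ₚ : ∀ {p q} → p ≈ᴾ q → _≈ₚ_ S p q
    ≈ᴾ⇒≈ₚ {p} {q} h ε 0<ε x = fromW {ε} {weight p x} {weight q x} (≋⇒W (<⇒≤ 0<ε) (weight-≈ h x))

    ≈ᴾ-trans : ∀ {p q r} → p ≈ᴾ q → q ≈ᴾ r → p ≈ᴾ r
    ≈ᴾ-trans h k = mk≈ᴾ λ x → ≋-trans (weight-≈ h x) (weight-≈ k x)

    ≈ᴾ-sym : ∀ {p q} → p ≈ᴾ q → q ≈ᴾ p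
    ≈ᴾ-sym h = mk≈ᴾ λ x → W-sym (weight-≈ h x)

    ≈ᴾ-refl : ∀ {p} → p ≈ᴾ p
    ≈ᴾ-refl = mk≈ᴾ λ x → ≋-refl

    charges-≈ᴾ : ∀ {p q x} → p ≈ᴾ q → Charges p x → Charges q x
    charges-≈ᴾ {x = x} h k = ⋖-≼ k (≋⇒≼ (weight-≈ h x))

    charges-≈ : ∀ p {x y} → x ≈ y → Charges p x → Charges p y
    charges-≈ p x≈y k = ⋖-≼ k (≋⇒≼ (weight-≋ p x≈y))

    ~-resp : ∀ {x x′ y y′} → x ≈ x′ → y ≈ y′ → x ~ y → x′ ~ y′
    ~-resp a b (inj₁ le) = inj₁ (P.trans (P.reflexive (P.Eq.sym a)) (P.trans le (P.reflexive b)))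
    ~-resp a b (inj₂ ge) = inj₂ (P.trans (P.reflexive (P.Eq.sym b)) (P.trans ge (P.reflexive a)))

    charged-~ : ∀ p x y → Charges p x → Charges p y → x ~ y
    charged-~ p x y a b = chain p x y (from⋖ a) (from⋖ b)

    self-compatible : ∀ p → Compatible p p
    self-compatible p = compatible (charged-~ p)

    compatible-sym : ∀ {p q} → Compatible p q → Compatible q p
    compatible-sym (compatible h) = compatible λ x y a b → swap (h y x b a)

    compatible-within : ∀ {p q} → (∀ x → Charges q x → Charges p x) → Compatible p q
    compatible-within {p} h = compatible λ x y a b → charged-~ p x y a (h y b)

    vertex-within : ∀ p v → Charges p v → ∀ x → Charges (vertex v) x → Charges p x
    vertex-within p v h x k = charges-≈ p (P.Eq.sym (vertex-pos v x k)) h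

    vertices-compatible : ∀ {a b} → a ~ b → Compatible (vertex a) (vertex b)
    vertices-compatible {a} {b} h = compatible λ x y p q → ~-resp (P.Eq.sym (vertex-pos a x p)) (P.Eq.sym (vertex-pos b y q)) h

    poly-end : ∀ z Q J co → (∀ k → suc k ≡ J → 1ᴿ ≼ shift z k) → poly z Q J co ≈ᴾ Q J
    poly-end z Q zero    co h = ≈ᴾ-refl
    poly-end z Q (suc J) co h = mk≈ᴾ (poly-last z Q J co (h J refl))

    -- A gap of two or more would place the common parameter `z` on both sides of an integer. Hence
    -- two rows traversed simultaneously are always in equal or neighbouring columns.
    located-≤ : ∀ {z Q Q′ J x y} (a : Located z Q J x) (b : Located z Q′ J y) → Located.index b ℕ.≤ suc (Located.index a)
    located-≤ {z} a b with Located.index b ℕ.≤? suc (Located.index a)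
    ... | yes le = le
    ... | no  ≰  = ⊥-elim (go (Located.index b) refl (ℕ.≰⇒> ≰))
      where
      go : ∀ i → i ≡ Located.index b → suc (Located.index a) ℕ.< i → ⊥
      go (suc k) eq (ℕ.s≤s lt) = separated z lt (Located.above b k eq)
        (Located.below a (ℕ.≤-trans (ℕ.m≤n⇒m≤1+n lt) (ℕ.≤-trans (ℕ.≤-reflexive eq) (Located.index≤ b))))

    module _ (D : Space) (monotone : Monotone D) where
      open Continuity D monotone

      constant-continuous : ∀ q → Continuousᴾ (λ _ → q)
      constant-continuous q ε 0<ε = 1ℚ , positive⁻¹ 1ℚ , λ _ _ _ x → ≋⇒W (<⇒≤ 0<ε) ≋-refl

      affine-continuous : ∀ k d {f : Pt D → ℝ} → Continuousᴿ f → Continuousᴿ (λ t → affine k d (f t))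
      affine-continuous k d hf ε 0<ε =
        let δ , 0<δ , le = divide k ε 0<ε
            μ , 0<μ , h = hf δ 0<δ
        in μ , 0<μ , λ p q near → W-affine k d le (h p q near)

      Continuousᴾ⇒ : ∀ {f} → Continuousᴾ f → Continuous D S f
      Continuousᴾ⇒ {f} hf ε 0<ε = let δ , 0<δ , h = hf ε 0<ε in
        δ , 0<δ , λ p q near x → fromW {ε} {weight (f p) x} {weight (f q) x} (h p q near x)

    value-continuous : Continuity.Continuousᴿ 𝕀 𝕀-monotone value
    value-continuous ε 0<ε = ε , 0<ε , λ s t near → toW {ε} {value s} {value t} near

    module Connect (p q : Point) {v v′ : Carrier} (p∋v : Charges p v) (q∋v′ : Charges q v′)
      (n : ℕ) (via : ℕ → Carrier) (via-path : ∀ i → via i ~ via (suc i)) (via-first : via 0 ⊑ v) (via-last : via n ⊑ v′) where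
      private
        tail : ℕ → Point
        tail = cons (vertex v′) (λ _ → q)

        Q : ℕ → Point
        Q = cons p (cons (vertex v) (splice (suc n) (vertex ∘ via) tail))

        Q-path : ∀ i → Compatible (Q i) (Q (suc i))
        Q-path = cons-path {R = Compatible} (compatible-within {p} {vertex v} (vertex-within p v p∋v))
          (cons-path {R = Compatible} (vertices-compatible {v} {via 0} (inj₂ via-first))
            (splice-path {R = Compatible} n (λ i → vertices-compatible (via-path i))
              (vertices-compatible (inj₁ via-last))
              (cons-path {R = Compatible} (compatible-sym {q} {vertex v′} (compatible-within {q} {vertex v′} (vertex-within q v′ q∋v′)))
                (λ _ → self-compatible q))))

        len : ℕ
        -- `p`, `v`, the `n + 1` members of `via` and `v′` come before `q`, which therefore has
        -- index `n + 4`, the value of `suc len`.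
        len = suc (suc n ℕ.+ 1)

        Q-last : Q (suc len) ≡ q
        Q-last = splice-tail (suc n) (vertex ∘ via) tail 1

        z : UnitInterval → ℝ
        z t = affine (suc len) 0ℚ (value t)

        Q-compat : ∀ t j → j ℕ.< suc len → CompatAt (z t) Q j
        Q-compat t j _ _ _ = Q-path j

        pathAt : UnitInterval → Point
        pathAt t = poly (z t) Q (suc len) (Q-compat t)

        open Continuity 𝕀 𝕀-monotone

        pathAt-continuous : Continuousᴾ pathAt
        pathAt-continuous = poly-continuous {z} {λ _ → Q} (suc len) Q-compat
          (affine-continuous 𝕀 𝕀-monotone (suc len) 0ℚ value-continuous) (λ j _ → constant-continuous 𝕀 𝕀-monotone (Q j))

        pathAt-source : ∀ t → value t ≋ 0ᴿ → pathAt t ≈ᴾ p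
        pathAt-source t h = mk≈ᴾ (poly-first (z t) Q (suc len) (Q-compat t) (≼-affine (suc len) (≋⇒≼ h)))

        pathAt-target′ : ∀ t → value t ≋ 1ᴿ → pathAt t ≈ᴾ Q (suc len)
        pathAt-target′ t h = mk≈ᴾ (poly-last (z t) Q len (Q-compat t)
          (affine-shift (suc len) {value t} {len} (≋⇒≼ (W-sym h)) (ℕ.n<1+n len)))

        pathAt-target : ∀ t → value t ≋ 1ᴿ → pathAt t ≈ᴾ q
        pathAt-target t h = ≈ᴾ-trans (pathAt-target′ t h) (mk≈ᴾ λ x → ≋-pointwise λ n → cong (λ r → seq (weight r x) n) Q-last)

      path : Path S p q
      path = record
        { at = pathAt
        ; continuous = Continuousᴾ⇒ 𝕀 𝕀-monotone {pathAt} pathAt-continuous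
        ; source = λ t h → ≈ᴾ⇒≈ₚ (pathAt-source t (≋-value-const {value t} h))
        ; target = λ t h → ≈ᴾ⇒≈ₚ (pathAt-target t (≋-value-const {value t} h))
        }

-- Null-homotopies: sampling the loop, realizing the grid, gluing both.

module Contractibility where
  open import Defs hiding (_⊗_; E; at)
  open import Data.Empty using (⊥-elim)
  open import Data.List using (length)
  import Data.List.Relation.Unary.Unique.Setoid as SetoidUnique
  open import Data.Nat as ℕ using (ℕ; zero; suc; s≤s; z≤n)
  import Data.Nat.Properties as ℕ
  open import Data.Product using (∃-syntax; _×_; _,_; proj₁; proj₂)
  open import Data.Rational
  open import Data.Rational.Properties
  open import Data.Rational.Solver using (module +-*-Solver)
  open import Data.Sum using (_⊎_; inj₁; inj₂)
  open import Function using (_∘_)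
  open import Level using (0ℓ)
  open import Relation.Binary.Bundles using (Poset)
  open import Relation.Binary.Definitions using (tri<; tri≈; tri>)
  open import Relation.Binary.PropositionalEquality hiding ([_])
  open import Relation.Nullary using (Dec; yes; no; _⊎-dec_)
  open Rationals
  open Reals
  open GridHomotopy
  open Polygons
  open Estimates
  open Connectivity
  open +-*-Solver using (solve; _:+_; _:*_; _:-_; _:=_; con; :-_)

  W-const : ∀ {ε a b} → Close ε a b → W ε (fromℚ a) (fromℚ b)
  W-const {ε} c = mkW λ η 0<η → ev-pure λ _ → close-mono (≤-+ (<⇒≤ 0<η) ≤-refl) c

  clamp-fixed : ∀ {a} → 0ℚ ≤ a → a ≤ 1ℚ → clamp a ≡ a
  clamp-fixed {a} 0≤a a≤1 = ≤-antisym (clamp-≤ {a} {a} 0≤a ≤-refl) (clamp-≥ {a} {a} a≤1 ≤-refl)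

  *-monoˡ : ∀ {a b c} → 0ℚ ≤ c → a ≤ b → a * c ≤ b * c
  *-monoˡ {a} {b} {c} 0≤c le = *-monoʳ-≤-nonNeg c {{nonNegative 0≤c}} le

  -- `y ≥ x - ε ≥ c - ε ≥ ε`, up to the slack absorbed by halving `ε`.
  near-large : ∀ {c ε x y} → W ε x y → fromℚ c ≼ x → 0ℚ < ε → ε + ε ≤ c → 0ᴿ ⋖ y
  near-large {c} {ε} {x} {y} (mkW h) (mk≼ k) 0<ε 2ε≤c = mk⋖ (½ * ε) (half-pos 0<ε) (ev-map₂ bound (h e 0<e) (k e 0<e))
    where
    e : ℚ
    e = ½ * (½ * ε)
    0<e : 0ℚ < e
    0<e = half-pos (half-pos 0<ε)
    bound : ∀ n → Close (ε + e) (seq x n) (seq y n) → c ≤ seq x n + e → 0ℚ + ½ * ε ≤ seq y n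
    bound n (a , _) b = ≤-from (0≤+ (0≤+ (≤⇒0≤ a) (≤⇒0≤ b)) (≤⇒0≤ 2ε≤c))
      (solve 4 (λ x y ε c → let e = con ½ :* (con ½ :* ε) in
          (y :+ (ε :+ e) :- x) :+ (x :+ e :- c) :+ (c :- (ε :+ ε)) := y :- (con 0ℚ :+ con ½ :* ε))
        refl (seq x n) (seq y n) ε c)

  inverse⁺ : ∀ m → 0 ℕ.< m → ∃[ μ ] (0ℚ < μ × qℕ m * μ ≡ 1ℚ)
  inverse⁺ (suc m) _ = inverse m

  module _ (W' : ℕ) (ω : ℚ) (0<ω : 0ℚ < ω) (Wω : qℕ W' * ω ≡ 1ℚ) (τ : ℝ) where
    -- The hypotheses locate `W' * τ` within 1 of `i`, which is divided by `W'`. At the first and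
    -- last column the missing bound comes from truncating `τ`.
    near-vertex : ∀ i → i ℕ.≤ W' → (i ℕ.< W' → shift (affine W' 0ℚ τ) i ⋖ 1ᴿ) →
      (∀ k → suc k ≡ i → 0ᴿ ⋖ shift (affine W' 0ℚ τ) k) → W ω (value (clampᴵ τ)) (fromℚ (qℕ i * ω))
    near-vertex i i≤W below above = mkW λ η 0<η → ev-map₂ (λ n a b →
        subst (λ s → Close (ω + η) s (qℕ i * ω)) (sym (seq-clamp τ n))
          (≤-trans a (+-monoʳ-≤ (qℕ i * ω) (≤-+ (<⇒≤ 0<η) ≤-refl)) , ≤-trans b (+-monoʳ-≤ (clamp (seq τ n)) (≤-+ (<⇒≤ 0<η) ≤-refl))))
      (upper-bound (ℕ.m≤n⇒m<n∨m≡n i≤W)) (lower-bound i i≤W above)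
      where
      0≤iω : ∀ i → 0ℚ ≤ qℕ i * ω
      0≤iω i = 0≤* (0≤qℕ i) (<⇒≤ 0<ω)

      expand : ∀ n i → seq (shift (affine W' 0ℚ τ) i) n ≡ qℕ W' * seq τ n + 0ℚ - qℕ i
      expand n i = trans (seq-shift (affine W' 0ℚ τ) i n) (cong (_- qℕ i) (seq-affine W' 0ℚ τ n))

      scale : ∀ n → seq τ n ≡ ω * (qℕ W' * seq τ n)
      scale n = trans (sym (*-identityˡ _)) (trans (cong (_* seq τ n) (sym Wω))
        (solve 3 (λ w o t → w :* o :* t := o :* (w :* t)) refl (qℕ W') ω (seq τ n)))

      upper-bound : i ℕ.< W' ⊎ i ≡ W' → Eventually λ n → clamp (seq τ n) ≤ qℕ i * ω + ω
      upper-bound (inj₁ i<W) with mk⋖ g 0<g h ← below i<W = ev-map (λ n a →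
        clamp-≤ (0≤+ (0≤iω i) (<⇒≤ 0<ω)) (≤-trans (≤-reflexive (scale n))
          (≤-from (0≤* (<⇒≤ 0<ω) (0≤+ (≤⇒0≤ (subst (λ s → s + g ≤ 1ℚ) (expand n i) a)) (<⇒≤ 0<g)))
            (solve 4 (λ o x i g → o :* (con 1ℚ :- (x :+ con 0ℚ :- i :+ g) :+ g) := i :* o :+ o :- o :* x) refl
              ω (qℕ W' * seq τ n) (qℕ i) g)))) h
      upper-bound (inj₂ refl) = ev-pure λ n → ≤-+ (<⇒≤ 0<ω) (≤-trans (clamp≤1 (seq τ n)) (≤-reflexive (sym Wω)))

      lower-bound : ∀ i → i ℕ.≤ W' → (∀ k → suc k ≡ i → 0ᴿ ⋖ shift (affine W' 0ℚ τ) k) →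
        Eventually λ n → qℕ i * ω ≤ clamp (seq τ n) + ω
      lower-bound zero    _ _ = ev-pure λ n → ≤-trans (≤-reflexive (*-zeroˡ ω)) (0≤+ (clamp≥0 (seq τ n)) (<⇒≤ 0<ω))
      lower-bound (suc k) k<W ab with mk⋖ g 0<g h ← ab k refl = ev-map (λ n a →
        ≤-trans (≤-reflexive (solve 2 (λ k o → (k :+ con 1ℚ) :* o := k :* o :+ o) refl (qℕ k) ω))
          (+-monoˡ-≤ ω (clamp-≥ {seq τ n} {qℕ k * ω}
            (≤-trans (*-monoˡ (<⇒≤ 0<ω) (qℕ-mono (ℕ.<⇒≤ k<W))) (≤-reflexive Wω))
            (≤-trans (≤-from (0≤* (<⇒≤ 0<ω) (0≤+ (≤⇒0≤ (≤-trans a (≤-reflexive (expand n k)))) (<⇒≤ 0<g)))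
              (solve 4 (λ o x k g → o :* (x :+ con 0ℚ :- k :- (con 0ℚ :+ g) :+ g) := o :* x :- k :* o) refl ω (qℕ W' * seq τ n) (qℕ k) g))
              (≤-reflexive (sym (scale n))))))) h

  module Contractible
    (P : Poset 0ℓ 0ℓ 0ℓ) (_≈?_ : ∀ x y → Dec (Poset._≈_ P x y))
    (bound : ℕ) (bounded-length : ∀ l → SetoidUnique.Unique (Poset.Eq.setoid P) l → length l ℕ.≤ bound)
    where

    private module P = Poset P
    open P using (Carrier; _≈_) renaming (_≤_ to _⊑_)
    open Rows P
    open Points P _≈?_
    open PointFields
    open Topology P _≈?_ bound bounded-length
    open _≈ᴾ_
    open Compatible

    module Loop (p : Point) (g : UnitInterval → Point)
      (g-continuous : ∀ ε → 0ℚ < ε → ∃[ δ ] (0ℚ < δ × (∀ s t → W δ (value s) (value t) → ∀ x → W ε (weight (g s) x) (weight (g t) x))))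
      (g-0 : ∀ t → value t ≋ 0ᴿ → g t ≈ᴾ p) (g-1 : ∀ t → value t ≋ 1ᴿ → g t ≈ᴾ p)
      where

      g-cong : ∀ s t → value s ≋ value t → g s ≈ᴾ g t
      g-cong s t eq = mk≈ᴾ λ x → W-limit λ ε 0<ε →
        let δ , 0<δ , h = g-continuous ε 0<ε in h s t (≋⇒W (<⇒≤ 0<δ) eq) x

      z : Carrier
      z = proj₁ (pick p)

      -- The factor 2 in `2ν≤δ` is for a comparison in two steps: from a time to the grid column in
      -- use, and from there to the sample point.
      record Mesh : Set where
        field
          δ      : ℚ
          N′     : ℕ
          ν      : ℚ
          0<ν    : 0ℚ < ν
          Nν     : qℕ (suc N′) * ν ≡ 1ℚ
          2ν≤δ   : ν + ν ≤ δ
          charge : ∀ s t x → W δ (value s) (value t) → fromℚ c ≼ weight (g s) x → Charges (g t) x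

      makeMesh : ∀ δ → (∀ s t → W δ (value s) (value t) → ∀ x → W (½ * c) (weight (g s) x) (weight (g t) x)) →
        ∀ k → 1ℚ ≤ qℕ k * (½ * δ) → Mesh
      makeMesh δ h zero     le = ⊥-elim (<⇒≱ (positive⁻¹ 1ℚ) (≤-trans le (≤-reflexive (*-zeroˡ (½ * δ)))))
      makeMesh δ h (suc N′) le = record
        { δ = δ ; N′ = N′ ; ν = ν ; 0<ν = proj₁ (proj₂ (inverse N′)) ; Nν = Nν
        ; 2ν≤δ = ≤-trans (+-mono-≤ ν≤ ν≤) (≤-reflexive (+-halves δ))
        ; charge = λ s t x near k → near-large (h s t near x) k (half-pos 0<c) (≤-reflexive (+-halves c))
        }
        where
        ν = proj₁ (inverse N′)
        Nν = proj₂ (proj₂ (inverse N′))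
        ν≤ : ν ≤ ½ * δ
        ν≤ = ≤-trans (≤-reflexive (sym (*-identityˡ ν))) (≤-trans (*-monoˡ (<⇒≤ (proj₁ (proj₂ (inverse N′)))) le)
          (≤-reflexive (trans (solve 3 (λ n d v → n :* d :* v := n :* v :* d) refl (qℕ (suc N′)) (½ * δ) ν)
            (trans (cong (_* (½ * δ)) Nν) (*-identityˡ (½ * δ))))))

      mesh : Mesh
      mesh = let δ , 0<δ , h = g-continuous (½ * c) (half-pos 0<c)
                 k , le = archimedean (½ * δ) (half-pos 0<δ)
             in makeMesh δ h k le

      -- Here ν = 1 / N, so y q is the sample point q / N of the loop g.
      module Sample (M : Mesh) where
        open Mesh M

        N : ℕ
        N = suc N′

        y : ℕ → UnitInterval
        y q = clampᴵ (fromℚ (qℕ q * ν))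

        -- Sequences are infinite, so everything from the end of the loop on counts as the base.
        End : ℕ → Set
        End q = q ≡ 0 ⊎ N ℕ.≤ q

        end? : ∀ q → Dec (End q)
        end? q = (q ℕ.≟ 0) ⊎-dec (N ℕ.≤? q)

        -- At the ends `z` is prescribed: `g (y q)` equals `p` only in its weights, and `pick` might
        -- return another vertex for it.
        sample : ∀ q → Dec (End q) → Carrier
        sample q (yes _) = z
        sample q (no  _) = proj₁ (pick (g (y q)))

        x : ℕ → Carrier
        x q = sample q (end? q)

        x-end : ∀ q → End q → x q ≡ z
        x-end q e with end? q
        ... | yes _ = refl
        ... | no ¬e = ⊥-elim (¬e e)

        y-end : ∀ q → End q → g (y q) ≈ᴾ p
        y-end q (inj₁ refl) = g-0 (y 0) (clamp-zero (fromℚ-≼ (≤-reflexive (*-zeroˡ ν))))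
        y-end q (inj₂ N≤q)  = g-1 (y q) (clamp-one (fromℚ-≼ (≤-trans (≤-reflexive (sym Nν)) (*-monoˡ (<⇒≤ 0<ν) (qℕ-mono N≤q)))))

        sample-large : ∀ q (d : Dec (End q)) → fromℚ c ≼ weight (g (y q)) (sample q d)
        sample-large q (yes e) = ≼-trans (proj₂ (pick p)) (≋⇒≼ (W-sym (weight-≈ (y-end q e) z)))
        sample-large q (no  _) = proj₂ (pick (g (y q)))

        x-charged : ∀ q t → W δ (value (y q)) (value t) → Charges (g t) (x q)
        x-charged q t near = charge (y q) t (x q) near (sample-large q (end? q))

        ν≤δ : ν ≤ δ
        ν≤δ = ≤-trans (≤-+ (<⇒≤ 0<ν) ≤-refl) 2ν≤δ

        0≤δ : 0ℚ ≤ δ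
        0≤δ = ≤-trans (<⇒≤ 0<ν) ν≤δ

        y-step : ∀ q → W δ (value (y (suc q))) (value (y q))
        y-step q = W-mono ν≤δ (W-clamp (<⇒≤ 0<ν) (W-const (≤-reflexive eq , ≤-+ (<⇒≤ 0<ν)
            (≤-trans (≤-+ (<⇒≤ 0<ν) ≤-refl) (≤-reflexive (sym eq))))))
          where
          eq : qℕ (suc q) * ν ≡ qℕ q * ν + ν
          eq = solve 2 (λ q v → (q :+ con 1ℚ) :* v := q :* v :+ v) refl (qℕ q) ν

        -- Both vertices are charged by the single point `g (y q)`, the second one because the
        -- sample points are at most `δ` apart.
        x-path : ∀ q → x q ~ x (suc q)
        x-path q = charged-~ (g (y q)) (x q) (x (suc q)) (x-charged q (y q) (≋⇒W 0≤δ ≋-refl)) (x-charged (suc q) (y q) (y-step q))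

        module Fill (contr : Contraction x (λ q → x q ≡ z) z) where
          open Contraction contr using (homotopy)
          open Stretch (Contraction.stretch contr) renaming (factor to m; lower to quot-lower; upper to quot-upper)

          μ ω : ℚ
          μ = proj₁ (inverse⁺ m factor>0)
          ω = ν * μ

          0<μ : 0ℚ < μ
          0<μ = proj₁ (proj₂ (inverse⁺ m factor>0))

          0<ω : 0ℚ < ω
          0<ω = ≤-<-trans (≤-reflexive (sym (*-zeroʳ ν))) (*-monoʳ-<-pos ν {{positive 0<ν}} 0<μ)

          mω : qℕ m * ω ≡ ν
          mω = trans (solve 3 (λ m v u → m :* (v :* u) := v :* (m :* u)) refl (qℕ m) ν μ)
            (trans (cong (ν *_) (proj₂ (proj₂ (inverse⁺ m factor>0)))) (*-identityʳ ν))

          W# : ℕ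
          W# = N ℕ.* m

          Wω : qℕ W# * ω ≡ 1ℚ
          Wω = trans (cong (_* ω) (qℕ-* N m)) (trans (*-assoc (qℕ N) (qℕ m) ω) (trans (cong (qℕ N *_) mω) Nν))

          ω≤ν : ω ≤ ν
          ω≤ν = ≤-trans (≤-reflexive (sym (*-identityˡ ω))) (≤-trans (*-monoˡ (<⇒≤ 0<ω) (qℕ-mono factor>0)) (≤-reflexive mω))

          -- With `q = quot i`, the number `i * ω` lies between `q * ν` and `(q + 1) * ν`, since
          -- `ν = m * ω`.
          near-sample : ∀ i → i ℕ.≤ W# → W ν (fromℚ (qℕ i * ω)) (value (y (quot i)))
          near-sample i i≤W = W-≋ (W-const {ν} {qℕ i * ω} {qℕ q * ν} (upper-bound , lower-bound)) ≋-refl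
            (≋-pointwise λ n → sym (trans (seq-clamp (fromℚ (qℕ q * ν)) n) (clamp-fixed (0≤* (0≤qℕ q) (<⇒≤ 0<ν)) qν≤1)))
            where
            q : ℕ
            q = quot i
            qν : ∀ k → qℕ (k ℕ.* m) * ω ≡ qℕ k * ν
            qν k = trans (cong (_* ω) (qℕ-* k m)) (trans (*-assoc (qℕ k) (qℕ m) ω) (cong (qℕ k *_) mω))
            qν≤iω : qℕ q * ν ≤ qℕ i * ω
            qν≤iω = ≤-trans (≤-reflexive (sym (qν q))) (*-monoˡ (<⇒≤ 0<ω) (qℕ-mono (quot-lower i)))
            qν≤1 : qℕ q * ν ≤ 1ℚ
            qν≤1 = ≤-trans qν≤iω (≤-trans (*-monoˡ (<⇒≤ 0<ω) (qℕ-mono i≤W)) (≤-reflexive Wω))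
            upper-bound : qℕ i * ω ≤ qℕ q * ν + ν
            upper-bound = ≤-trans (*-monoˡ (<⇒≤ 0<ω) (qℕ-mono (ℕ.<⇒≤ (quot-upper i)))) (≤-trans (≤-reflexive (qν (suc q)))
              (≤-reflexive (solve 2 (λ q v → (q :+ con 1ℚ) :* v := q :* v :+ v) refl (qℕ q) ν)))
            lower-bound : qℕ q * ν ≤ qℕ i * ω + ν
            lower-bound = ≤-+ (<⇒≤ 0<ν) qν≤iω

          L : ℕ → ℕ → Carrier
          L = grid homotopy

          M# : ℕ
          M# = height homotopy

          L-first : ∀ i → L 0 i ≡ x (quot i)
          L-first i = cong (λ R → R i) (grid-first homotopy)

          L-last : ∀ i → L M# i ≡ z
          L-last i = cong (λ R → R i) (grid-last homotopy)

          L-base : ∀ j q → End q → L j (q ℕ.* m) ⊑ z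
          L-base j q e = IsRow.base (grid-row homotopy j) (q ℕ.* m) (q , x-end q e , refl)

          -- Time is cut into the five pieces of `Kseq`; `τ` runs from 0 to 1 during the middle one,
          -- and `zt` spreads it over the columns of the grid.
          u τ zt : UnitInterval → ℝ
          u t = affine 5 0ℚ (value t)
          τ t = shift (u t) 2
          zt t = affine W# 0ℚ (τ t)

          β : UnitInterval → UnitInterval
          β t = clampᴵ (τ t)

          -- The homotopy parameter is cut into the four stages of `Hseq`; `σ` runs from 0 to 1
          -- during the third, where the rows of the grid are traversed.
          v σ zs : UnitInterval → ℝ
          v s = affine 4 0ℚ (value s)
          σ s = shift (v s) 2
          zs s = affine M# 0ℚ (σ s)

          L-path : ∀ j i → Compatible (vertex (L j i)) (vertex (L j (suc i)))
          L-path j i = vertices-compatible (IsRow.path (grid-row homotopy j) i)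

          row : ℕ → UnitInterval → Point
          row j t = poly (zt t) (vertex ∘ L j) W# (λ i _ _ _ → L-path j i)

          Cell : ℕ → UnitInterval → Carrier → Set
          Cell j t = Located (zt t) (vertex ∘ L j) W#

          cell : ∀ j t a → Charges (row j t) a → Cell j t a
          cell j t a = locate (zt t) (vertex ∘ L j) W# (λ i _ _ _ → L-path j i) a

          cell-≈ : ∀ j t a (l : Cell j t a) → a ≈ L j (Located.index l)
          cell-≈ j t a l = vertex-pos (L j (Located.index l)) a (Located.charges l)

          L-adjacent : ∀ j i i′ → i′ ℕ.≤ suc i → i ℕ.≤ suc i′ → L j i ~ L (suc j) i′
          L-adjacent j i i′ le le′ with ℕ.<-cmp i i′
          ... | tri≈ _ refl _ = proj₁ (grid-Adj homotopy j i)
          ... | tri< lt _ _ with refl ← ℕ.≤-antisym le lt = proj₁ (proj₂ (grid-Adj homotopy j i))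
          ... | tri> _ _ gt with refl ← ℕ.≤-antisym le′ gt = proj₂ (proj₂ (grid-Adj homotopy j i′))

          -- At a common time two rows are at columns at most one apart, and the grid supplies
          -- comparability of vertical and diagonal neighbours.
          row-compatible : ∀ j t → Compatible (row j t) (row (suc j) t)
          row-compatible j t = compatible λ a b pa pb →
            let l = cell j t a pa
                l′ = cell (suc j) t b pb
            in ~-resp (P.Eq.sym (cell-≈ j t a l)) (P.Eq.sym (cell-≈ (suc j) t b l′))
                 (L-adjacent j (Located.index l) (Located.index l′) (located-≤ l l′) (located-≤ l′ l))

          E : UnitInterval → UnitInterval → Point
          E s t = poly (zs s) (λ j → row j t) M# (λ j _ _ _ → row-compatible j t)

          E-cell : ∀ s t a → Charges (E s t) a → ∃[ j ] Cell j t a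
          E-cell s t a h = Located.index l , cell (Located.index l) t a (Located.charges l)
            where
            l : Located (zs s) (λ j → row j t) M# a
            l = locate (zs s) (λ j → row j t) M# (λ j _ _ _ → row-compatible j t) a h

          -- The column in use is within `ω` of `β t` and within `ν` of its sample point, so the
          -- sampled vertex is still charged at `β t`. This puts the first row into the simplices
          -- through which the slowed loop runs.
          row-0-charges : ∀ t a → Cell 0 t a → Charges (g (β t)) a
          row-0-charges t a l = charges-≈ (g (β t)) (P.Eq.sym (P.Eq.trans (cell-≈ 0 t a l) (P.Eq.reflexive (L-first i))))
            (x-charged (quot i) (β t) (W-mono ων≤δ (W-sym (W-trans
              (near-vertex W# ω 0<ω Wω (τ t) i index≤ below above) (near-sample i index≤)))))
            where
            open Located l renaming (index to i)
            ων≤δ : ω + ν ≤ δ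
            ων≤δ = ≤-trans (+-monoˡ-≤ ν ω≤ν) 2ν≤δ

          E-early : ∀ s t → σ s ≼ 0ᴿ → ∀ a → Charges (E s t) a → Charges (g (β t)) a
          E-early s t σ≼0 a h = row-0-charges t a (cell 0 t a (charges-≈ᴾ {E s t} {row 0 t} {a}
            (mk≈ᴾ (poly-first (zs s) (λ j → row j t) M# (λ j _ _ _ → row-compatible j t) (≼-affine M# σ≼0))) h))

          E-late : ∀ s t → 1ᴿ ≼ σ s → ∀ a → Charges (E s t) a → a ≈ z
          E-late s t 1≼σ a h = P.Eq.trans (cell-≈ M# t a l) (P.Eq.reflexive (L-last (Located.index l)))
            where
            l : Cell M# t a
            l = cell M# t a (charges-≈ᴾ {E s t} {row M# t} {a} (poly-end (zs s) (λ j → row j t) M# (λ j _ _ _ → row-compatible j t)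
                  (λ k eq → affine-shift M# 1≼σ (ℕ.≤-reflexive eq))) h)

          -- Before the middle piece only column 0 is charged, and this marked column stays below
          -- `z` in every row.
          E-left : ∀ s t → τ t ≼ 0ᴿ → ∀ a → Charges (E s t) a → a ⊑ z
          E-left s t τ≼0 a h = go (Located.index l) refl
            where
            j : ℕ
            j = proj₁ (E-cell s t a h)
            l : Cell j t a
            l = proj₂ (E-cell s t a h)
            go : ∀ i → i ≡ Located.index l → a ⊑ z
            go zero eq = P.trans (P.reflexive (cell-≈ j t a l)) (subst (λ i → L j i ⊑ z) eq (L-base j 0 (inj₁ refl)))
            go (suc k) eq = ⊥-elim (⋖-irrefl (Located.above l k eq) (≼-trans (shift-≼ (zt t) k) (≼-affine W# τ≼0)))

          E-right : ∀ s t → 1ᴿ ≼ τ t → ∀ a → Charges (E s t) a → a ⊑ z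
          E-right s t 1≼τ a h = go (ℕ.m≤n⇒m<n∨m≡n (Located.index≤ l))
            where
            j : ℕ
            j = proj₁ (E-cell s t a h)
            l : Cell j t a
            l = proj₂ (E-cell s t a h)
            go : Located.index l ℕ.< W# ⊎ Located.index l ≡ W# → a ⊑ z
            go (inj₂ eq) = P.trans (P.reflexive (cell-≈ j t a l)) (subst (λ i → L j i ⊑ z) (sym eq) (L-base j N (inj₂ ℕ.≤-refl)))
            go (inj₁ lt) = ⊥-elim (⋖-irrefl (Located.below l lt) (affine-shift W# 1≼τ lt))

          apex : Point
          apex = vertex z

          apex-in : ∀ q → Charges q z → ∀ a → Charges apex a → Charges q a
          apex-in q = vertex-within q z

          p∋z : Charges p z
          p∋z = pick-charges p

          p∋ : ∀ {a} → a ≈ z → Charges p a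
          p∋ a≈z = charges-≈ p (P.Eq.sym a≈z) p∋z

          β-left : ∀ t → τ t ≼ 0ᴿ → g (β t) ≈ᴾ p
          β-left t h = g-0 (β t) (clamp-zero h)

          β-right : ∀ t → 1ᴿ ≼ τ t → g (β t) ≈ᴾ p
          β-right t h = g-1 (β t) (clamp-one h)

          apex-below : ∀ {q} → (∀ a → Charges q a → a ⊑ z) → Compatible apex q
          apex-below h = compatible λ a b pa pb →
            inj₂ (P.trans (h b pb) (P.reflexive (P.Eq.sym (vertex-pos z a pa))))

          -- In the time t: p is joined to apex, and apex to the grid; β stays 0 meanwhile,
          -- runs from 0 to 1 in the middle piece, and stays 1 on the way back.
          Kseq : UnitInterval → UnitInterval → ℕ → Point
          Kseq s t = cons p (cons apex (cons (E s t) (cons (E s t) (cons apex (λ _ → p)))))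

          K-compat : ∀ s t j → j ℕ.< 5 → CompatAt (u t) (Kseq s t) j
          K-compat s t 0 _ _ _ = compatible-within (apex-in p p∋z)
          K-compat s t 1 _ _ h = apex-below (E-left s t (shift-below (u t) (s≤s (s≤s z≤n)) h))
          -- Equal corners: in this piece the motion comes only from the arguments inside `E`.
          K-compat s t 2 _ _ _ = self-compatible (E s t)
          K-compat s t 3 _ h _ = compatible-sym (apex-below (E-right s t (shift-above (u t) (s≤s (s≤s (s≤s z≤n))) h)))
          K-compat s t 4 _ _ _ = compatible-sym (compatible-within (apex-in p p∋z))
          K-compat s t (suc (suc (suc (suc (suc j))))) (s≤s (s≤s (s≤s (s≤s (s≤s ()))))) _ _

          K : UnitInterval → UnitInterval → Point
          K s t = poly (u t) (Kseq s t) 5 (K-compat s t)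

          KCell : UnitInterval → UnitInterval → Carrier → Set
          KCell s t = Located (u t) (Kseq s t) 5

          -- In the outer pieces `β t` rests at 0 or 1, so `g (β t)` is `p`, which charges `z`; in
          -- the middle the first row lies under the loop. This allows a straight homotopy from the
          -- slowed loop to `K`.
          K-early-cell : ∀ s t → σ s ≼ 0ᴿ → ∀ a → KCell s t a → Charges (g (β t)) a
          K-early-cell s t h a record { index = 0 ; charges = k ; below = b } =
            charges-≈ᴾ (≈ᴾ-sym (β-left t (shift-below (u t) (s≤s z≤n) (b (s≤s z≤n))))) k
          K-early-cell s t h a record { index = 1 ; charges = k ; below = b } =
            charges-≈ᴾ (≈ᴾ-sym (β-left t (shift-below (u t) (s≤s (s≤s z≤n)) (b (s≤s (s≤s z≤n))))))
              (apex-in p p∋z a k)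
          K-early-cell s t h a record { index = 2 ; charges = k } = E-early s t h a k
          K-early-cell s t h a record { index = 3 ; charges = k } = E-early s t h a k
          K-early-cell s t h a record { index = 4 ; charges = k ; above = ab } =
            charges-≈ᴾ (≈ᴾ-sym (β-right t (shift-above (u t) (s≤s (s≤s (s≤s z≤n))) (ab 3 refl))))
              (apex-in p p∋z a k)
          K-early-cell s t h a record { index = 5 ; charges = k ; above = ab } =
            charges-≈ᴾ (≈ᴾ-sym (β-right t (shift-above (u t) (s≤s (s≤s (s≤s z≤n))) (ab 4 refl)))) k
          K-early-cell s t h a record { index = suc (suc (suc (suc (suc (suc j))))) ; index≤ = s≤s (s≤s (s≤s (s≤s (s≤s ())))) }

          -- After the contraction only `z` and the vertices of `p` remain, and all of them are
          -- charged by `p`.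
          K-late-cell : ∀ s t → 1ᴿ ≼ σ s → ∀ a → KCell s t a → Charges p a
          K-late-cell s t h a record { index = 0 ; charges = k } = k
          K-late-cell s t h a record { index = 1 ; charges = k } = apex-in p p∋z a k
          K-late-cell s t h a record { index = 2 ; charges = k } = p∋ (E-late s t h a k)
          K-late-cell s t h a record { index = 3 ; charges = k } = p∋ (E-late s t h a k)
          K-late-cell s t h a record { index = 4 ; charges = k } = apex-in p p∋z a k
          K-late-cell s t h a record { index = 5 ; charges = k } = k
          K-late-cell s t h a record { index = suc (suc (suc (suc (suc (suc j))))) ; index≤ = s≤s (s≤s (s≤s (s≤s (s≤s ())))) }

          K-cell : ∀ s t a → Charges (K s t) a → KCell s t a
          K-cell s t = locate (u t) (Kseq s t) 5 (K-compat s t)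

          -- In the first stage the time is moved linearly from `t` to `β t`; afterwards it remains
          -- there.
          b : UnitInterval → UnitInterval → UnitInterval
          b s t = lerp (shift (v s) 0) t (β t)

          b-left : ∀ s t → (0ᴿ ⋖ shift (v s) 0 → value t ≋ value (β t)) → value (b s t) ≋ value t
          b-left s t h = subst (_≋ value t) (sym (value-lerp (shift (v s) 0) t (β t))) (lerp-left (shift (v s) 0) t (β t) h)

          b-right : ∀ s t → (shift (v s) 0 ⋖ 1ᴿ → value t ≋ value (β t)) → value (b s t) ≋ value (β t)
          b-right s t h = subst (_≋ value (β t)) (sym (value-lerp (shift (v s) 0) t (β t))) (lerp-right (shift (v s) 0) t (β t) h)

          -- In the parameter s: g is slowed down to g ∘ β, which waits at p while K leaves p;
          -- g ∘ β moves to K; the grid inside K contracts to apex; K collapses to p.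
          Hseq : UnitInterval → UnitInterval → ℕ → Point
          Hseq s t = cons (g (b s t)) (cons (g (b s t)) (cons (K s t) (cons (K s t) (λ _ → p))))

          H-compat : ∀ s t j → j ℕ.< 4 → CompatAt (v s) (Hseq s t) j
          H-compat s t 0 _ _ _ = self-compatible (g (b s t))
          -- In the second stage `b` has already reached `β`, and `σ` has not yet left 0.
          H-compat s t 1 _ k h = compatible-within λ a ka → charges-≈ᴾ
            (g-cong (β t) (b s t) (W-sym (b-right s t λ r → ⊥-elim (⋖-irrefl r (shift-above (v s) (s≤s z≤n) k)))))
            (K-early-cell s t (shift-below (v s) (s≤s (s≤s z≤n)) h) a (K-cell s t a ka))
          H-compat s t 2 _ _ _ = self-compatible (K s t)
          H-compat s t 3 _ k _ = compatible-sym (compatible-within λ a ka →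
            K-late-cell s t (shift-above (v s) (s≤s (s≤s (s≤s z≤n))) k) a (K-cell s t a ka))
          H-compat s t (suc (suc (suc (suc j)))) (s≤s (s≤s (s≤s (s≤s ())))) _ _

          H : UnitInterval → UnitInterval → Point
          H s t = poly (v s) (Hseq s t) 4 (H-compat s t)

          H-start : ∀ s t → value s ≋ 0ᴿ → H s t ≈ᴾ g t
          H-start s t s≋0 = ≈ᴾ-trans (mk≈ᴾ (poly-first (v s) (Hseq s t) 4 (H-compat s t) v≼0))
            (g-cong (b s t) t (b-left s t λ r → ⊥-elim (⋖-irrefl r (≼-trans (shift-≼ (v s) 0) v≼0))))
            where
            v≼0 : v s ≼ 0ᴿ
            v≼0 = ≼-affine 4 (≋⇒≼ s≋0)

          H-end : ∀ s t → value s ≋ 1ᴿ → H s t ≈ᴾ p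
          H-end s t s≋1 = mk≈ᴾ (poly-last (v s) (Hseq s t) 3 (H-compat s t)
            (affine-shift 4 (≋⇒≼ (W-sym s≋1)) (s≤s (s≤s (s≤s (s≤s z≤n))))))

          -- All corners of `Hseq` coincide with `p` here, so the polygon is constant.
          H-side : ∀ s t → g (b s t) ≈ᴾ p → K s t ≈ᴾ p → H s t ≈ᴾ p
          H-side s t gb k = mk≈ᴾ λ a → poly-constant (v s) (Hseq s t) 4 (H-compat s t) a (weight p a) (pieces a)
            where
            pieces : ∀ a j → j ℕ.≤ 4 → weight (Hseq s t j) a ≋ weight p a
            pieces a 0 _ = weight-≈ gb a
            pieces a 1 _ = weight-≈ gb a
            pieces a 2 _ = weight-≈ k a
            pieces a 3 _ = weight-≈ k a
            pieces a (suc (suc (suc (suc j)))) _ = ≋-refl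

          H-left : ∀ s t → value t ≋ 0ᴿ → H s t ≈ᴾ p
          H-left s t t≋0 = H-side s t
            (g-0 (b s t) (≋-trans (b-left s t λ _ → ≋-trans t≋0 (W-sym (clamp-zero (≼-trans (shift-≼ (u t) 2) u≼0)))) t≋0))
            (mk≈ᴾ (poly-first (u t) (Kseq s t) 5 (K-compat s t) u≼0))
            where
            u≼0 : u t ≼ 0ᴿ
            u≼0 = ≼-affine 5 (≋⇒≼ t≋0)

          H-right : ∀ s t → value t ≋ 1ᴿ → H s t ≈ᴾ p
          H-right s t t≋1 = H-side s t
            (g-1 (b s t) (≋-trans (b-left s t λ _ → ≋-trans t≋1 (W-sym (clamp-one (late 2 (s≤s (s≤s (s≤s z≤n))))))) t≋1))
            (mk≈ᴾ (poly-last (u t) (Kseq s t) 4 (K-compat s t) (late 4 ℕ.≤-refl)))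
            where
            late : ∀ i → i ℕ.< 5 → 1ᴿ ≼ shift (u t) i
            late i = affine-shift 5 (≋⇒≼ (W-sym t≋1))

          square : Space
          square = Defs._⊗_ 𝕀 𝕀

          square-monotone : Monotone square
          square-monotone = ⊗-monotone 𝕀-monotone 𝕀-monotone

          open Continuity square square-monotone

          constantly : ∀ q → Continuousᴾ (λ _ → q)
          constantly = constant-continuous square square-monotone

          affinely : ∀ k d {f} → Continuousᴿ f → Continuousᴿ (λ e → affine k d (f e))
          affinely = affine-continuous square square-monotone

          s-continuous : Continuousᴿ (λ d → value (proj₁ d))
          s-continuous ε 0<ε = ε , 0<ε , λ d d′ near → toW {ε} {value (proj₁ d)} {value (proj₁ d′)} (proj₁ near)

          t-continuous : Continuousᴿ (λ d → value (proj₂ d))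
          t-continuous ε 0<ε = ε , 0<ε , λ d d′ near → toW {ε} {value (proj₂ d)} {value (proj₂ d′)} (proj₂ near)

          u-continuous : Continuousᴿ (λ d → u (proj₂ d))
          u-continuous = affinely 5 0ℚ {λ d → value (proj₂ d)} t-continuous

          v-continuous : Continuousᴿ (λ d → v (proj₁ d))
          v-continuous = affinely 4 0ℚ {λ d → value (proj₁ d)} s-continuous

          τ-continuous : Continuousᴿ (λ d → τ (proj₂ d))
          τ-continuous = shift-continuous {λ d → u (proj₂ d)} 2 u-continuous

          zt-continuous : Continuousᴿ (λ d → zt (proj₂ d))
          zt-continuous = affinely W# 0ℚ {λ d → τ (proj₂ d)} τ-continuous

          zs-continuous : Continuousᴿ (λ d → zs (proj₁ d))
          zs-continuous = affinely M# 0ℚ {λ d → σ (proj₁ d)}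
            (shift-continuous {λ d → v (proj₁ d)} 2 v-continuous)

          E-continuous : Continuousᴾ (λ d → E (proj₁ d) (proj₂ d))
          E-continuous = poly-continuous {λ d → zs (proj₁ d)} {λ d j → row j (proj₂ d)} M#
            (λ d j _ _ _ → row-compatible j (proj₂ d)) zs-continuous
            (λ j _ → poly-continuous {λ d → zt (proj₂ d)} {λ _ i → vertex (L j i)} W# (λ _ i _ _ _ → L-path j i)
              zt-continuous (λ i _ → constantly (vertex (L j i))))

          K-continuous : Continuousᴾ (λ d → K (proj₁ d) (proj₂ d))
          K-continuous = poly-continuous {λ d → u (proj₂ d)} {λ d → Kseq (proj₁ d) (proj₂ d)} 5
            (λ d → K-compat (proj₁ d) (proj₂ d)) u-continuous pieces
            where
            pieces : ∀ j → j ℕ.≤ 5 → Continuousᴾ (λ d → Kseq (proj₁ d) (proj₂ d) j)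
            pieces 0 _ = constantly p
            pieces 1 _ = constantly apex
            pieces 2 _ = E-continuous
            pieces 3 _ = E-continuous
            pieces 4 _ = constantly apex
            pieces (suc (suc (suc (suc (suc j))))) _ = constantly p

          b-continuous : Continuousᴿ (λ d → value (b (proj₁ d) (proj₂ d)))
          b-continuous ε 0<ε =
            let e = ⅓ * ε
                0<e = third-pos 0<ε
                δ₁ , 0<δ₁ , h₁ = shift-continuous {λ d → v (proj₁ d)} 0 v-continuous e 0<e
                δ₂ , 0<δ₂ , h₂ = t-continuous e 0<e
                δ₃ , 0<δ₃ , h₃ = τ-continuous e 0<e
            in δ₁ ⊓ (δ₂ ⊓ δ₃) , ⊓-pos 0<δ₁ (⊓-pos 0<δ₂ 0<δ₃) , λ d d′ near →
              subst₂ (W ε) (sym (value-lerp (shift (v (proj₁ d)) 0) (proj₂ d) (β (proj₂ d))))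
                (sym (value-lerp (shift (v (proj₁ d′)) 0) (proj₂ d′) (β (proj₂ d′))))
                (W-lerp {A = proj₂ d} {proj₂ d′} {β (proj₂ d)} {β (proj₂ d′)}
                  (h₁ d d′ (mono d d′ (p⊓q≤p δ₁ (δ₂ ⊓ δ₃)) near)) (<⇒≤ 0<ε)
                  (h₂ d d′ (mono d d′ (≤-trans (p⊓q≤q δ₁ (δ₂ ⊓ δ₃)) (p⊓q≤p δ₂ δ₃)) near))
                  (W-clamp (<⇒≤ 0<e) (h₃ d d′ (mono d d′ (≤-trans (p⊓q≤q δ₁ (δ₂ ⊓ δ₃)) (p⊓q≤q δ₂ δ₃)) near))))
            where open Monotone square-monotone

          gb-continuous : Continuousᴾ (λ d → g (b (proj₁ d) (proj₂ d)))
          gb-continuous ε 0<ε =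
            let δ , 0<δ , h = g-continuous ε 0<ε
                η , 0<η , k = b-continuous δ 0<δ
            in η , 0<η , λ d d′ near → h (b (proj₁ d) (proj₂ d)) (b (proj₁ d′) (proj₂ d′)) (k d d′ near)

          H-continuous : Continuousᴾ (λ d → H (proj₁ d) (proj₂ d))
          H-continuous = poly-continuous {λ d → v (proj₁ d)} {λ d → Hseq (proj₁ d) (proj₂ d)} 4
            (λ d → H-compat (proj₁ d) (proj₂ d)) v-continuous pieces
            where
            pieces : ∀ j → j ℕ.≤ 4 → Continuousᴾ (λ d → Hseq (proj₁ d) (proj₂ d) j)
            pieces 0 _ = gb-continuous
            pieces 1 _ = gb-continuous
            pieces 2 _ = K-continuous
            pieces 3 _ = K-continuous
            pieces (suc (suc (suc (suc j)))) _ = constantly p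

-- A criterion for finite posets, and the theorem.

open import Defs hiding (_⊗_; E)
open import Data.Bool using (Bool)
import Data.Bool.Properties as Bool
open import Data.Fin as Fin using (Fin; zero; suc)
import Data.Fin.Properties as Fin
open import Data.Empty using (⊥-elim)
open import Data.List as List using (List; _∷_; length)
open import Data.List.Membership.Propositional.Properties using (∈-lookup)
open import Data.List.Relation.Unary.All as All using (All)
open import Data.List.Relation.Unary.AllPairs using (_∷_)
import Data.List.Relation.Unary.Unique.Setoid as SetoidUnique
open import Data.Nat as ℕ using (ℕ; zero; suc; _≤_)
import Data.Nat.Properties as ℕ
open import Data.Product using (∃-syntax; _×_; _,_; proj₁; proj₂)
open import Data.Rational using (0ℚ; _<_)
open import Function using (_∘_)
open import Level using (0ℓ)
open import Relation.Binary.Bundles using (Poset)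
open import Relation.Binary.PropositionalEquality hiding ([_])
open import Relation.Nullary using (Dec; yes; no; ¬?)
open LinearAlgebra
open Regularity
open GridHomotopy
open BasisExchange
open Rationals
open Reals
open Polygons
open Estimates
open Connectivity
open Contractibility

module _
  (P : Poset 0ℓ 0ℓ 0ℓ) (_≈?_ : ∀ x y → Dec (Poset._≈_ P x y))
  (bound : ℕ) (bounded-length : ∀ l → SetoidUnique.Unique (Poset.Eq.setoid P) l → length l ℕ.≤ bound)
  where

  private module P = Poset P
  open P using (Carrier) renaming (_≤_ to _⊑_)
  open Rows P
  open Points P _≈?_
  open Topology P _≈?_ bound bounded-length
  open Contractible P _≈?_ bound bounded-length

  -- The topology is reduced to two combinatorial inputs: zigzags between any two elements, and
  -- contractions of comparable sequences that keep their base columns below `z`.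
  simplyConnected : Carrier →
    (∀ X Y → ∃[ n ] ∃[ via ] ((∀ i → via i ~ via (suc i)) × via 0 ⊑ X × via n ⊑ Y)) →
    (∀ z (x : ℕ → Carrier) → (∀ q → x q ~ x (suc q)) → Contraction x (λ q → x q ≡ z) z) →
    SimplyConnected ∣ P ∣ᴳ
  simplyConnected base connect contract = record
    { point         = vertex base
    ; pathConnected = λ p q →
        let n , via , via-path , first , last = connect (proj₁ (pick p)) (proj₁ (pick q))
        in Connect.path p q (pick-charges p) (pick-charges q) n via via-path first last
    ; nullHomotopic = nullHomotopy
    }
    where
    nullHomotopy : ∀ p (γ : Path S p p) → NullHomotopy S γ
    nullHomotopy p γ = record
      { at         = λ (s , t) → H s t
      ; continuous = Continuousᴾ⇒ square square-monotone {λ d → H (proj₁ d) (proj₂ d)} H-continuous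
      ; start      = λ s t h → ≈ᴾ⇒≈ₚ (H-start s t (≋-value-const {value s} h))
      ; end        = λ s t h → ≈ᴾ⇒≈ₚ (H-end s t (≋-value-const {value s} h))
      ; left       = λ s t h → ≈ᴾ⇒≈ₚ (H-left s t (≋-value-const {value t} h))
      ; right      = λ s t h → ≈ᴾ⇒≈ₚ (H-right s t (≋-value-const {value t} h))
      }
      where
      g : UnitInterval → Point
      g = Path.at γ

      g-continuous : ∀ ε → 0ℚ < ε → ∃[ δ ] (0ℚ < δ × (∀ s t → W δ (value s) (value t) →
        ∀ x → W ε (RealizationPoint.weight (g s) x) (RealizationPoint.weight (g t) x)))
      g-continuous ε 0<ε with Path.continuous γ ε 0<ε
      ... | δ , 0<δ , h = δ , 0<δ , λ s t near x →
        toW {ε} {RealizationPoint.weight (g s) x} {RealizationPoint.weight (g t) x}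
          (h s t (fromW {δ} {value s} {value t} near) x)

      open Loop p g g-continuous
        (λ t h → ≈ₚ⇒≈ᴾ (Path.source γ t (fromW h)))
        (λ t h → ≈ₚ⇒≈ᴾ (Path.target γ t (fromW h)))
      open Sample mesh
      open Fill (contract z x x-path)

≈-dec : ∀ {r} (X Y : RegularSubset r) → Dec (∀ v → set X v ≡ set Y v)
≈-dec {r} X Y with ∃-vec? r (λ v → ¬? (set X v Bool.≟ set Y v))
... | yes (v , ne) = no λ eq → ne (eq v)
... | no  ¬p       = yes (∀-vec r (λ v → set X v Bool.≟ set Y v) ¬p)

-- The characteristic function on all `2 ^ r` vectors, read as a number. Counting these codes yields
-- the finiteness bound behind the uniform weight threshold.
code : ∀ {r} → RegularSubset r → Fin (2 ℕ.^ (2 ℕ.^ r))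
code {r} X = Fin.funToFin (λ i → bit (set X (decode r i)))

code-injective : ∀ {r} (X Y : RegularSubset r) → code X ≡ code Y → ∀ v → set X v ≡ set Y v
code-injective {r} X Y eq v = subst (λ w → set X w ≡ set Y w)
  (encode-injective (decode r (encode v)) v (encode-decode r (encode v)))
  (bit-injective _ _ (trans (sym (Fin.finToFun-funToFin f (encode v)))
    (trans (cong (λ k → Fin.finToFun k (encode v)) eq) (Fin.finToFun-funToFin f′ (encode v)))))
  where
  f f′ : Fin (2 ℕ.^ r) → Fin 2
  f i  = bit (set X (decode r i))
  f′ i = bit (set Y (decode r i))

distinct-length : ∀ {r} l → SetoidUnique.Unique (Poset.Eq.setoid (IR r)) l → length l ℕ.≤ 2 ℕ.^ (2 ℕ.^ r)
distinct-length {r} l d = Fin.injective⇒≤ {f = code ∘ List.lookup l} (λ {i} {j} eq →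
  lookup-injective l d i j (code-injective (List.lookup l i) (List.lookup l j) eq))
  where
  lookup-injective : ∀ l → SetoidUnique.Unique (Poset.Eq.setoid (IR r)) l → ∀ i j →
    (∀ v → set (List.lookup l i) v ≡ set (List.lookup l j) v) → i ≡ j
  lookup-injective (X ∷ l) (p ∷ d) zero    zero    h = refl
  lookup-injective (X ∷ l) (p ∷ d) zero    (suc j) h = ⊥-elim (All.lookupWith (λ { ne refl → ne h }) p (∈-lookup j))
  lookup-injective (X ∷ l) (p ∷ d) (suc i) zero    h = ⊥-elim (All.lookupWith (λ { ne refl → ne (sym ∘ h) }) p (∈-lookup i))
  lookup-injective (X ∷ l) (p ∷ d) (suc i) (suc j) h = cong suc (lookup-injective l d i j h)

theorem2p13 : (r : ℕ) → 1 ≤ r → SimplyConnected ∣ IR r ∣ᴳ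
theorem2p13 r _ = simplyConnected (IR r) ≈-dec _ distinct-length standard connect contraction
  where open Contract {r}
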